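{- For any two simple graphs $G$ and $H$ and every integer $t \geq 1$, the following implications hold: \[ G \simeq_{3t}^{\mathrm{SA}} H \implies G \simeq_t^{\mathrm{L}} H \implies G \simeq_t^{\mathrm{SA}} H . \] Furthermore, for every $t \geq 1$, there exist simple graphs $G$ and $H$ such that $G \simeq_{3t-1}^{\mathrm{SA}} H$ and $G \not\simeq_t^{\mathrm{L}} H$.
   Context: Graphs are finite and undirected; simple means without loops and multiple edges. For a set $X$ and $k \in \mathbb{N}$, $\binom{X}{\leq k}$ is the set of subsets of $X$ of size at most $k$. An element $(g,h) \in V(G)\times V(H)$ is written $gh$. A set $\{g_1h_1,\dots,g_\ell h_\ell\} \subseteq V(G)\times V(H)$ is a partial isomorphism if for all $i,j\in[\ell]$: $g_i=g_j \Leftrightarrow h_i=h_j$, and $g_ig_j\in E(G) \Leftrightarrow h_ih_j \in E(H)$. (The empty set is a partial isomorphism.) Lasserre relaxation: $G \simeq_t^{\mathrm{L}} H$ means that the following system (the level-$t$ Lasserre relaxation for graph isomorphism) in real variables $y_I$, $I \in \binom{V(G)\times V(H)}{\leq 2t}$, is feasible: (i) the matrix $(y_{I\cup J})_{I,J\in\binom{V(G)\times V(H)}{\leq t}}$ is positive semidefinite; (ii) $\sum_{h\in V(H)} y_{I\cup\{gh\}} = y_I$ for all $I \in \binom{V(G)\times V(H)}{\leq 2t-2}$ and $g\in V(G)$; (iii) $\sum_{g\in V(G)} y_{I\cup\{gh\}} = y_I$ for all $I \in \binom{V(G)\times V(H)}{\leq 2t-2}$ and $h\in V(H)$; (iv)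 $y_I=0$ for every $I\in\binom{V(G)\times V(H)}{\leq 2t}$ that is not a partial isomorphism; (v) $y_\emptyset=1$. Sherali--Adams relaxation: $G \simeq_t^{\mathrm{SA}} H$ means that the level-$t$ Sherali--Adams relaxation of the integer quadratic program for graph isomorphism has a non-negative rational solution, i.e. there are non-negative rationals $y_I$, $I\in\binom{V(G)\times V(H)}{\leq t}$, with $y_\emptyset=1$; $y_I=0$ whenever $I$ is not a partial isomorphism; and for all $I\in\binom{V(G)\times V(H)}{\leq t-1}$, $\sum_{h\in V(H)} y_{I\cup\{gh\}} = y_I$ for all $g\in V(G)$ and $\sum_{g\in V(G)} y_{I\cup\{gh\}} = y_I$ for all $h\in V(H)$. It is known, and recalled in the paper, that $G \simeq_t^{\mathrm{SA}} H$ holds if and only if $\hom(F,G)=\hom(F,H)$ for every graph $F$ of treewidth at most $t-1$, where $\hom(F,G)$ is the number of graph homomorphisms from $F$ to $G$. -}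

module Defs where

open import Algebra.Bundles.Raw using (RawMonoid)
import Algebra.Definitions.RawMonoid as RawMonoidDefinitions
open import Data.Fin using (Fin; combine)
open import Data.Fin.Subset using (Subset; inside; outside; _∈_; _∪_; ⁅_⁆; ∣_∣; ⊥)
open import Data.List using (List; []; [_]; _++_; map; filter; length; lookup)
open import Data.Nat as ℕ using (ℕ; zero; suc)
import Data.Nat.Properties as ℕ
open import Data.Product using (∃; _×_; _,_; proj₁; proj₂)
open import Data.Rational as ℚ using (ℚ; 0ℚ; 1ℚ; ½)
import Data.Rational.Properties as ℚ
open import Data.Rational.Solver using (module +-*-Solver)
import Data.Vec as Vec
open import Data.Vec.Functional using (Vector)
open import Function.Bundles using (_⇔_)
open import Level using (0ℓ)
open import Relation.Binary.Core using (Rel)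
open import Relation.Binary.Definitions using (Decidable; Symmetric; Irreflexive)
open import Relation.Binary.PropositionalEquality
  using (_≡_; refl; sym; trans; cong; cong₂; subst)
open import Relation.Nullary using (¬_)

------------------------------------------------------------------------
-- Real numbers: Cauchy sequences of rationals, with equality _≃_

Cauchy : (ℕ → ℚ) → Set
Cauchy x = ∀ ε → 0ℚ ℚ.< ε →
  ∃ λ N → ∀ m n → N ℕ.≤ m → N ℕ.≤ n → ℚ.∣ x m ℚ.- x n ∣ ℚ.≤ ε

private
  abstract
    half-pos : ∀ ε → 0ℚ ℚ.< ε → 0ℚ ℚ.< ½ ℚ.* ε
    half-pos ε ε>0 =
      subst (ℚ._< ½ ℚ.* ε) (ℚ.*-zeroʳ ½) (ℚ.*-monoʳ-<-pos ½ ε>0)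

    halves : ∀ ε → ½ ℚ.* ε ℚ.+ ½ ℚ.* ε ≡ ε
    halves ε = trans (sym (ℚ.*-distribʳ-+ ε ½ ½))
      (trans (cong (ℚ._* ε) ½+½≡1) (ℚ.*-identityˡ ε))
      where
      ½+½≡1 : ½ ℚ.+ ½ ≡ 1ℚ
      ½+½≡1 = refl

    +-cauchy : ∀ x y → Cauchy x → Cauchy y → Cauchy (λ n → x n ℚ.+ y n)
    +-cauchy x y cx cy ε ε>0
      with M , p ← cx (½ ℚ.* ε) (half-pos ε ε>0)
         | N , q ← cy (½ ℚ.* ε) (half-pos ε ε>0) = M ℕ.⊔ N , λ m n m≥ n≥ → begin
      ℚ.∣ (x m ℚ.+ y m) ℚ.- (x n ℚ.+ y n) ∣
        ≡⟨ cong ℚ.∣_∣ (rearrange (x m) (y m) (x n) (y n)) ⟩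
      ℚ.∣ (x m ℚ.- x n) ℚ.+ (y m ℚ.- y n) ∣
        ≤⟨ ℚ.∣p+q∣≤∣p∣+∣q∣ (x m ℚ.- x n) (y m ℚ.- y n) ⟩
      ℚ.∣ x m ℚ.- x n ∣ ℚ.+ ℚ.∣ y m ℚ.- y n ∣
        ≤⟨ ℚ.+-mono-≤
             (p m n (ℕ.≤-trans (ℕ.m≤m⊔n M N) m≥) (ℕ.≤-trans (ℕ.m≤m⊔n M N) n≥))
             (q m n (ℕ.≤-trans (ℕ.m≤n⊔m M N) m≥) (ℕ.≤-trans (ℕ.m≤n⊔m M N) n≥)) ⟩
      ½ ℚ.* ε ℚ.+ ½ ℚ.* ε
        ≡⟨ halves ε ⟩
      ε ∎
      where
      open ℚ.≤-Reasoning
      rearrange : ∀ a b c d → (a ℚ.+ b) ℚ.- (c ℚ.+ d) ≡ (a ℚ.- c) ℚ.+ (b ℚ.- d)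
      rearrange = solve 4
        (λ a b c d → (a :+ b) :- (c :+ d) := (a :- c) :+ (b :- d)) refl
        where open +-*-Solver

    eventually-bounded : ∀ x → Cauchy x →
      ∃ λ K → ℚ.Positive K × ∃ λ N → ∀ n → N ℕ.≤ n → ℚ.∣ x n ∣ ℚ.≤ K
    eventually-bounded x cx with N , p ← cx 1ℚ (ℚ.positive⁻¹ 1ℚ) =
      1ℚ ℚ.+ ℚ.∣ x N ∣ ,
      ℚ.positive (ℚ.+-mono-<-≤ (ℚ.positive⁻¹ 1ℚ) (ℚ.0≤∣p∣ (x N))) ,
      N , λ n n≥ → begin
        ℚ.∣ x n ∣                              ≡⟨ cong ℚ.∣_∣ (split (x n) (x N)) ⟩
        ℚ.∣ (x n ℚ.- x N) ℚ.+ x N ∣            ≤⟨ ℚ.∣p+q∣≤∣p∣+∣q∣ (x n ℚ.- x N) (x N) ⟩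
        ℚ.∣ x n ℚ.- x N ∣ ℚ.+ ℚ.∣ x N ∣        ≤⟨ ℚ.+-monoˡ-≤ ℚ.∣ x N ∣ (p n N n≥ ℕ.≤-refl) ⟩
        1ℚ ℚ.+ ℚ.∣ x N ∣                       ∎
      where
      open ℚ.≤-Reasoning
      split : ∀ a b → a ≡ (a ℚ.- b) ℚ.+ b
      split = solve 2 (λ a b → a := (a :- b) :+ b) refl
        where open +-*-Solver

    -- δ K ε = ε / (2 K)
    δ : ∀ K .{{_ : ℚ.Positive K}} → ℚ → ℚ
    δ K ε = (ℚ.1/ K) {{ℚ.pos⇒nonZero K}} ℚ.* (½ ℚ.* ε)

    δ-pos : ∀ K .{{_ : ℚ.Positive K}} ε → 0ℚ ℚ.< ε → 0ℚ ℚ.< δ K ε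
    δ-pos K ε ε>0 = subst (ℚ._< δ K ε) (ℚ.*-zeroʳ r)
      (ℚ.*-monoʳ-<-pos r {{ℚ.1/pos⇒pos K}} (half-pos ε ε>0))
      where
      r : ℚ
      r = (ℚ.1/ K) {{ℚ.pos⇒nonZero K}}

    K*δ : ∀ K .{{_ : ℚ.Positive K}} ε → K ℚ.* δ K ε ≡ ½ ℚ.* ε
    K*δ K ε = trans (sym (ℚ.*-assoc K _ (½ ℚ.* ε)))
      (trans (cong (ℚ._* (½ ℚ.* ε)) (ℚ.*-inverseʳ K {{ℚ.pos⇒nonZero K}}))
             (ℚ.*-identityˡ (½ ℚ.* ε)))

    *-mono-∣∣ : ∀ {p q} K .{{_ : ℚ.Positive K}} {d} →
      ℚ.∣ p ∣ ℚ.≤ K → ℚ.∣ q ∣ ℚ.≤ d → ℚ.∣ p ℚ.* q ∣ ℚ.≤ K ℚ.* d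
    *-mono-∣∣ {p} {q} K {d} p≤ q≤ = begin
      ℚ.∣ p ℚ.* q ∣          ≡⟨ ℚ.∣p*q∣≡∣p∣*∣q∣ p q ⟩
      ℚ.∣ p ∣ ℚ.* ℚ.∣ q ∣    ≤⟨ ℚ.*-monoʳ-≤-nonNeg ℚ.∣ q ∣ {{ℚ.nonNegative (ℚ.0≤∣p∣ q)}} p≤ ⟩
      K ℚ.* ℚ.∣ q ∣          ≤⟨ ℚ.*-monoˡ-≤-nonNeg K {{ℚ.pos⇒nonNeg K}} q≤ ⟩
      K ℚ.* d                ∎
      where open ℚ.≤-Reasoning

    *-close : ∀ a b c d K L .{{_ : ℚ.Positive K}} .{{_ : ℚ.Positive L}} ε →
      ℚ.∣ a ∣ ℚ.≤ K → ℚ.∣ d ∣ ℚ.≤ L →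
      ℚ.∣ b ℚ.- d ∣ ℚ.≤ δ K ε → ℚ.∣ a ℚ.- c ∣ ℚ.≤ δ L ε →
      ℚ.∣ a ℚ.* b ℚ.- c ℚ.* d ∣ ℚ.≤ ε
    *-close a b c d K L ε a≤ d≤ bd ac = begin
      ℚ.∣ a ℚ.* b ℚ.- c ℚ.* d ∣
        ≡⟨ cong ℚ.∣_∣ (rearrange a b c d) ⟩
      ℚ.∣ a ℚ.* (b ℚ.- d) ℚ.+ d ℚ.* (a ℚ.- c) ∣
        ≤⟨ ℚ.∣p+q∣≤∣p∣+∣q∣ (a ℚ.* (b ℚ.- d)) (d ℚ.* (a ℚ.- c)) ⟩
      ℚ.∣ a ℚ.* (b ℚ.- d) ∣ ℚ.+ ℚ.∣ d ℚ.* (a ℚ.- c) ∣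
        ≤⟨ ℚ.+-mono-≤ (*-mono-∣∣ {a} {b ℚ.- d} K a≤ bd) (*-mono-∣∣ {d} {a ℚ.- c} L d≤ ac) ⟩
      K ℚ.* δ K ε ℚ.+ L ℚ.* δ L ε
        ≡⟨ cong₂ ℚ._+_ (K*δ K ε) (K*δ L ε) ⟩
      ½ ℚ.* ε ℚ.+ ½ ℚ.* ε
        ≡⟨ halves ε ⟩
      ε ∎
      where
      open ℚ.≤-Reasoning
      rearrange : ∀ a b c d →
        a ℚ.* b ℚ.- c ℚ.* d ≡ a ℚ.* (b ℚ.- d) ℚ.+ d ℚ.* (a ℚ.- c)
      rearrange = solve 4
        (λ a b c d → a :* b :- c :* d := a :* (b :- d) :+ d :* (a :- c)) refl
        where open +-*-Solver

    *-cauchy-bounded : ∀ x y K L → ℚ.Positive K → ℚ.Positive L → ∀ A B →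
      (∀ n → A ℕ.≤ n → ℚ.∣ x n ∣ ℚ.≤ K) → (∀ n → B ℕ.≤ n → ℚ.∣ y n ∣ ℚ.≤ L) →
      Cauchy x → Cauchy y → Cauchy (λ n → x n ℚ.* y n)
    *-cauchy-bounded x y K L K>0 L>0 A B bx by cx cy ε ε>0 =
      (A ℕ.⊔ B) ℕ.⊔ (C ℕ.⊔ D) , λ m n m≥ n≥ →
      *-close (x m) (y m) (x n) (y n) K L {{K>0}} {{L>0}} ε
        (bx m (≥A m≥)) (by n (≥B n≥))
        (proj₂ cy′ m n (≥D m≥) (≥D n≥)) (proj₂ cx′ m n (≥C m≥) (≥C n≥))
      where
      cx′ : ∃ λ N → ∀ m n → N ℕ.≤ m → N ℕ.≤ n → ℚ.∣ x m ℚ.- x n ∣ ℚ.≤ δ L {{L>0}} ε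
      cx′ = cx (δ L {{L>0}} ε) (δ-pos L {{L>0}} ε ε>0)
      cy′ : ∃ λ N → ∀ m n → N ℕ.≤ m → N ℕ.≤ n → ℚ.∣ y m ℚ.- y n ∣ ℚ.≤ δ K {{K>0}} ε
      cy′ = cy (δ K {{K>0}} ε) (δ-pos K {{K>0}} ε ε>0)
      C D : ℕ
      C = proj₁ cx′
      D = proj₁ cy′
      ≥A : ∀ {m} → (A ℕ.⊔ B) ℕ.⊔ (C ℕ.⊔ D) ℕ.≤ m → A ℕ.≤ m
      ≥A h = ℕ.m⊔n≤o⇒m≤o A B (ℕ.m⊔n≤o⇒m≤o (A ℕ.⊔ B) (C ℕ.⊔ D) h)
      ≥B : ∀ {m} → (A ℕ.⊔ B) ℕ.⊔ (C ℕ.⊔ D) ℕ.≤ m → B ℕ.≤ m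
      ≥B h = ℕ.m⊔n≤o⇒n≤o A B (ℕ.m⊔n≤o⇒m≤o (A ℕ.⊔ B) (C ℕ.⊔ D) h)
      ≥C : ∀ {m} → (A ℕ.⊔ B) ℕ.⊔ (C ℕ.⊔ D) ℕ.≤ m → C ℕ.≤ m
      ≥C h = ℕ.m⊔n≤o⇒m≤o C D (ℕ.m⊔n≤o⇒n≤o (A ℕ.⊔ B) (C ℕ.⊔ D) h)
      ≥D : ∀ {m} → (A ℕ.⊔ B) ℕ.⊔ (C ℕ.⊔ D) ℕ.≤ m → D ℕ.≤ m
      ≥D h = ℕ.m⊔n≤o⇒n≤o C D (ℕ.m⊔n≤o⇒n≤o (A ℕ.⊔ B) (C ℕ.⊔ D) h)

    *-cauchy : ∀ x y → Cauchy x → Cauchy y → Cauchy (λ n → x n ℚ.* y n)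
    *-cauchy x y cx cy =
      let K , K>0 , A , bx = eventually-bounded x cx
          L , L>0 , B , by = eventually-bounded y cy
      in *-cauchy-bounded x y K L K>0 L>0 A B bx by cx cy

record ℝ : Set where
  constructor mkℝ
  field
    seq    : ℕ → ℚ
    cauchy : Cauchy seq

open ℝ public

infix  4 _≃_ _≤ʳ_
infixl 6 _+ʳ_
infixl 7 _*ʳ_

_≃_ : ℝ → ℝ → Set
x ≃ y = ∀ ε → 0ℚ ℚ.< ε →
  ∃ λ N → ∀ n → N ℕ.≤ n → ℚ.∣ seq x n ℚ.- seq y n ∣ ℚ.≤ ε

_≤ʳ_ : ℝ → ℝ → Set
x ≤ʳ y = ∀ ε → 0ℚ ℚ.< ε →
  ∃ λ N → ∀ n → N ℕ.≤ n → seq x n ℚ.≤ seq y n ℚ.+ ε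

fromℚ : ℚ → ℝ
fromℚ q = mkℝ (λ _ → q) λ ε ε>0 → 0 , λ _ _ _ _ →
  subst (λ p → ℚ.∣ p ∣ ℚ.≤ ε) (sym (ℚ.+-inverseʳ q)) (ℚ.<⇒≤ ε>0)

0ℝ 1ℝ : ℝ
0ℝ = fromℚ 0ℚ
1ℝ = fromℚ 1ℚ

_+ʳ_ : ℝ → ℝ → ℝ
x +ʳ y = mkℝ (λ n → seq x n ℚ.+ seq y n) (+-cauchy (seq x) (seq y) (cauchy x) (cauchy y))

_*ʳ_ : ℝ → ℝ → ℝ
x *ʳ y = mkℝ (λ n → seq x n ℚ.* seq y n) (*-cauchy (seq x) (seq y) (cauchy x) (cauchy y))

+ʳ-0ℝ-rawMonoid : RawMonoid 0ℓ 0ℓ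
+ʳ-0ℝ-rawMonoid = record { Carrier = ℝ ; _≈_ = _≃_ ; _∙_ = _+ʳ_ ; ε = 0ℝ }

open RawMonoidDefinitions +ʳ-0ℝ-rawMonoid public using () renaming (sum to sumℝ)
open RawMonoidDefinitions ℚ.+-0-rawMonoid public using () renaming (sum to sumℚ)

record PositiveSemidefinite {n} (M : Fin n → Fin n → ℝ) : Set where
  field
    symmetric   : ∀ i j → M i j ≃ M j i
    nonNegative : ∀ (x : Vector ℝ n) →
                  0ℝ ≤ʳ sumℝ (λ i → sumℝ (λ j → x i *ʳ M i j *ʳ x j))

------------------------------------------------------------------------
-- Graphs

record SimpleGraph : Set₁ where
  field
    order       : ℕ
    Adj         : Rel (Fin order) 0ℓ
    adj?        : Decidable Adj
    symmetric   : Symmetric Adj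
    irreflexive : Irreflexive _≡_ Adj

open SimpleGraph public using (order; Adj)

V : SimpleGraph → Set
V G = Fin (order G)

-- V(G) × V(H) is encoded as Fin (order G * order H) through the bijection
-- `combine`, so that its subsets are those of Data.Fin.Subset.

PairSet : SimpleGraph → SimpleGraph → Set
PairSet G H = Subset (order G ℕ.* order H)

PartialIsomorphism : (G H : SimpleGraph) → PairSet G H → Set
PartialIsomorphism G H I =
  ∀ (g g′ : V G) (h h′ : V H) → combine g h ∈ I → combine g′ h′ ∈ I →
  (g ≡ g′ ⇔ h ≡ h′) × (Adj G g g′ ⇔ Adj H h h′)

------------------------------------------------------------------------
-- The two relaxations

allSubsets : ∀ n → List (Subset n)
allSubsets zero    = [ Vec.[] ]
allSubsets (suc n) =
  map (outside Vec.∷_) (allSubsets n) ++ map (inside Vec.∷_) (allSubsets n)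

subsets≤ : ∀ n → ℕ → List (Subset n)
subsets≤ n k = filter (λ I → ∣ I ∣ ℕ.≤? k) (allSubsets n)

momentMatrix : ∀ {n} t → (Subset n → ℝ) →
  let k = length (subsets≤ n t) in Fin k → Fin k → ℝ
momentMatrix {n} t y i j = y (lookup (subsets≤ n t) i ∪ lookup (subsets≤ n t) j)

-- In both systems y is a function on all subsets, but the constraints only
-- involve y I with ∣ I ∣ ≤ 2 t (respectively ∣ I ∣ ≤ t) when t ≥ 1; the other
-- values are unconstrained and play no role.

record IsLasserreSolution (t : ℕ) (G H : SimpleGraph) (y : PairSet G H → ℝ) : Set where
  field
    psd    : PositiveSemidefinite (momentMatrix t y)
    sumH   : ∀ I → ∣ I ∣ ℕ.≤ 2 ℕ.* t ℕ.∸ 2 → ∀ (g : V G) →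
             sumℝ (λ (h : V H) → y (I ∪ ⁅ combine g h ⁆)) ≃ y I
    sumG   : ∀ I → ∣ I ∣ ℕ.≤ 2 ℕ.* t ℕ.∸ 2 → ∀ (h : V H) →
             sumℝ (λ (g : V G) → y (I ∪ ⁅ combine g h ⁆)) ≃ y I
    vanish : ∀ I → ∣ I ∣ ℕ.≤ 2 ℕ.* t → ¬ PartialIsomorphism G H I → y I ≃ 0ℝ
    empty  : y ⊥ ≃ 1ℝ

record IsSheraliAdamsSolution (t : ℕ) (G H : SimpleGraph) (y : PairSet G H → ℚ) : Set where
  field
    nonNegative : ∀ I → ∣ I ∣ ℕ.≤ t → 0ℚ ℚ.≤ y I
    sumH   : ∀ I → ∣ I ∣ ℕ.≤ t ℕ.∸ 1 → ∀ (g : V G) →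
             sumℚ (λ (h : V H) → y (I ∪ ⁅ combine g h ⁆)) ≡ y I
    sumG   : ∀ I → ∣ I ∣ ℕ.≤ t ℕ.∸ 1 → ∀ (h : V H) →
             sumℚ (λ (g : V G) → y (I ∪ ⁅ combine g h ⁆)) ≡ y I
    vanish : ∀ I → ∣ I ∣ ℕ.≤ t → ¬ PartialIsomorphism G H I → y I ≡ 0ℚ
    empty  : y ⊥ ≡ 1ℚ

infix 4 _≃ᴸ[_]_ _≃ˢᴬ[_]_

_≃ᴸ[_]_ : SimpleGraph → ℕ → SimpleGraph → Set
G ≃ᴸ[ t ] H = ∃ λ y → IsLasserreSolution t G H y

_≃ˢᴬ[_]_ : SimpleGraph → ℕ → SimpleGraph → Set
G ≃ˢᴬ[ t ] H = ∃ λ y → IsSheraliAdamsSolution t G H y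

{-# OPTIONS --safe #-}
-- The support of a solution of level k is a back-and-forth system on positions of at most k
-- pairs, and the equivalence it generates on vertex tuples of G and H is a stable colouring.
-- Giving every pair of equally coloured tuples the weight 1/|class| yields a rational
-- Sherali–Adams solution of level k.  If k = 3t, the colours of pairs of t-tuples form a
-- coherent configuration; writing K for the moment matrix on t-tuples, this gives Z K = K²
-- with Z positive definite, hence K is positive semidefinite.
--
-- For strictness, take the Cai–Fürer–Immerman graphs over the complete graph on 3t vertices,
-- where Duplicator survives with 3t - 1 pebbles but only one graph has a 3t-clique.  Lasserre
-- moments intertwine the matrices A_G and A_H of the relation "the two t-tuples form a
-- 2t-clique", so they preserve triangles of these matrices, which are the 3t-cliques.

module Submission where

open import Algebra.Bundles using (CommutativeRing)
import Algebra.Properties.CommutativeMonoid.Sum as Sum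
open import Data.Bool using (Bool; true; false; if_then_else_; _xor_)
import Data.Bool.Properties as Bool
open import Data.Empty using (⊥-elim)
  renaming (⊥ to Empty)
open import Data.Fin as Fin using (Fin; zero; suc; combine; remQuot; fromℕ<; funToFin; finToFun; cast)
open import Data.Fin.Permutation using (permutation)
import Data.Fin.Properties as Fin
open import Data.Fin.Subset as Subset
  using (Subset; inside; outside; _∪_; ⁅_⁆)
  renaming (_∈_ to _∈ˢ_; _⊆_ to _⊆ˢ_)
import Data.Fin.Subset.Properties as Subset
import Data.Integer as ℤ
open import Data.List
  using (List; []; _∷_; _++_; map; tabulate; cartesianProductWith; length; allFin; lookup;
    concatMap; upTo; filter; take; drop; cartesianProduct; deduplicate; replicate; zip)
open import Data.List.Membership.DecPropositional using ()
  renaming (_∈?_ to member?)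
open import Data.List.Membership.Propositional using (_∈_; find; _∉_; lose)
open import Data.List.Membership.Propositional.Properties
  using (∈-++⁺ʳ; ∈-++⁺ˡ; ∈-++⁻; ∈-allFin; ∈-cartesianProductWith⁺; ∈-cartesianProductWith⁻;
    ∈-cartesianProduct⁺; ∈-cartesianProduct⁻; ∈-concatMap⁺; ∈-concatMap⁻; ∈-deduplicate⁺;
    ∈-deduplicate⁻; ∈-filter⁺; ∈-filter⁻; ∈-lookup; ∈-map⁺; ∈-map⁻; ∈-upTo⁺; ∈-upTo⁻)
open import Data.List.Membership.Propositional.Properties.WithK using (unique∧set⇒bag)
open import Data.List.Properties as List using (∷-injective)
open import Data.List.Relation.Binary.BagAndSetEquality using (∼bag⇒↭)
open import Data.List.Relation.Binary.Permutation.Propositional as Perm using (_↭_)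
open import Data.List.Relation.Binary.Permutation.Propositional.Properties as Perm using (∈-resp-↭; ↭-length)
open import Data.List.Relation.Binary.Subset.Propositional using (_⊆_)
import Data.List.Relation.Binary.Subset.Propositional.Properties as Subsetᴸ
open import Data.List.Relation.Unary.All as All using (All; []; _∷_)
import Data.List.Relation.Unary.All.Properties as All
open import Data.List.Relation.Unary.AllPairs as AllPairs using ([]; _∷_; AllPairs; allPairs?)
import Data.List.Relation.Unary.AllPairs.Properties as AllPairs
open import Data.List.Relation.Unary.Any as Any using (here; there)
import Data.List.Relation.Unary.Any.Properties as Any
import Data.List.Relation.Unary.Unique.DecPropositional.Properties as DecUnique
open import Data.List.Relation.Unary.Unique.Propositional using (Unique)
import Data.List.Relation.Unary.Unique.Propositional.Properties as Unique
open import Data.Maybe using (Maybe; just; nothing)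
open import Data.Maybe.Properties using (just-injective)
open import Data.Nat as ℕ using (ℕ; zero; suc; _≤_; _<_; z≤n; s≤s)
import Data.Nat.Properties as ℕ
open import Data.Product using (_,_; ∃; _×_; proj₁; proj₂; ∃₂)
import Data.Product.Properties as Product
open import Data.Rational as ℚ using (ℚ; 0ℚ; 1ℚ; ½)
import Data.Rational.Properties as ℚ
open import Data.Rational.Solver using (module +-*-Solver)
open import Data.Sum using (inj₁; inj₂; _⊎_; [_,_]′)
import Data.Vec as Vec
import Data.Vec.Properties as Vec
open import Defs
open import Function using (_∘_; id)
open import Function.Bundles using (mk⇔; _⇔_; Equivalence; Inverse)
open import Level using (0ℓ)
open import Relation.Binary.Definitions using (DecidableEquality; Symmetric; tri<; tri≈; tri>)
open import Relation.Binary.PropositionalEquality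
  using (_≡_; _≢_; refl; sym; trans; cong; cong₂; subst; subst₂; module ≡-Reasoning)
open import Relation.Nullary using (Dec; yes; no; ¬_; does)
open import Relation.Nullary.Decidable using (map′; _×-dec_; _→-dec_; ¬?; decidable-stable)

-- Finite sums and tuples

-- Of a given solution only the support survives; all weights are rebuilt from class sizes. This is
-- how real moments lead to rational ones. Whether a real number is zero cannot be decided, so the
-- support is chosen only under a double negation, which suffices because the search for a suitable
-- family of sets is finite.
--
-- The factor 3 counts the corners of a triangle: an entry of a matrix product fixes two blocks of t
-- vertices and sums over a third, and such counts depend on colours alone only if all three blocks
-- can be coloured together. The strictness half meets the same number from the other side: a
-- product of two matrices, each read off moments on 2t pairs, detects cliques on 3t vertices.
--
-- Positive semidefiniteness has to be shown over ℚ, without eigenvalues or square roots. `Z` is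
-- therefore factored explicitly as a Gram matrix, and Z w = u is solved by elimination.
--
-- For t-tuples, sums over one more pair may involve sets of 2t - 1 pairs, one more than the
-- Lasserre sum constraints allow. The missing equations say that certain combinations are null
-- vectors of the positive semidefinite form, and this is how they are derived.

module ListSum {ℓ₁ ℓ₂} (R : CommutativeRing ℓ₁ ℓ₂) where
  open CommutativeRing R hiding (zero; refl; sym; trans)
  open CommutativeRing R using () renaming (refl to ≈-refl; sym to ≈-sym; trans to ≈-trans)
  open import Algebra.Properties.CommutativeSemigroup +-commutativeSemigroup using (interchange)
  open import Algebra.Definitions.RawMonoid +-rawMonoid using (sum)
  open import Relation.Binary.Reasoning.Setoid setoid

  -- The ring is a parameter because the same lemmas serve rational weights, real moments and
  -- parities over the two-element field. Lists are the index sets because most sums run over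
  -- tuples.
  ∑ : ∀ {a} {A : Set a} → List A → (A → Carrier) → Carrier
  ∑ []       f = 0#
  ∑ (x ∷ xs) f = f x + ∑ xs f

  𝟙 : ∀ {p} {P : Set p} → Dec P → Carrier
  𝟙 (yes _) = 1#
  𝟙 (no  _) = 0#

  𝟙-yes : ∀ {p} {P : Set p} (d : Dec P) → P → 𝟙 d ≡ 1#
  𝟙-yes (yes _) p = refl
  𝟙-yes (no ¬p) p = ⊥-elim (¬p p)

  𝟙-no : ∀ {p} {P : Set p} (d : Dec P) → ¬ P → 𝟙 d ≡ 0#
  𝟙-no (yes p) ¬p = ⊥-elim (¬p p)
  𝟙-no (no _)  ¬p = refl

  𝟙-cong : ∀ {p q} {P : Set p} {Q : Set q} (d : Dec P) (e : Dec Q) → (P → Q) → (Q → P) → 𝟙 d ≡ 𝟙 e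
  𝟙-cong (yes p) e f g = sym (𝟙-yes e (f p))
  𝟙-cong (no ¬p) e f g = sym (𝟙-no e (¬p ∘ g))

  module _ {a} {A : Set a} where

    ∑-cong∈ : ∀ xs {f g : A → Carrier} → (∀ {x} → x ∈ xs → f x ≈ g x) → ∑ xs f ≈ ∑ xs g
    ∑-cong∈ []       h = ≈-refl
    ∑-cong∈ (x ∷ xs) h = +-cong (h (here refl)) (∑-cong∈ xs (h ∘ there))

    ∑-cong : ∀ xs {f g : A → Carrier} → (∀ x → f x ≈ g x) → ∑ xs f ≈ ∑ xs g
    ∑-cong xs h = ∑-cong∈ xs (λ {x} _ → h x)

    ∑-zero : ∀ xs {f : A → Carrier} → (∀ {x} → x ∈ xs → f x ≈ 0#) → ∑ xs f ≈ 0#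
    ∑-zero []       h = ≈-refl
    ∑-zero (x ∷ xs) h = ≈-trans (+-cong (h (here refl)) (∑-zero xs (h ∘ there))) (+-identityˡ 0#)

    ∑-distrib-+ : ∀ xs (f g : A → Carrier) → ∑ xs (λ x → f x + g x) ≈ ∑ xs f + ∑ xs g
    ∑-distrib-+ []       f g = ≈-sym (+-identityˡ 0#)
    ∑-distrib-+ (x ∷ xs) f g = ≈-trans (+-congˡ (∑-distrib-+ xs f g)) (interchange _ _ _ _)

    *-distribˡ-∑ : ∀ xs q (f : A → Carrier) → q * ∑ xs f ≈ ∑ xs (λ x → q * f x)
    *-distribˡ-∑ []       q f = zeroʳ q
    *-distribˡ-∑ (x ∷ xs) q f = ≈-trans (distribˡ q _ _) (+-congˡ (*-distribˡ-∑ xs q f))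

    *-distribʳ-∑ : ∀ xs q (f : A → Carrier) → ∑ xs f * q ≈ ∑ xs (λ x → f x * q)
    *-distribʳ-∑ []       q f = zeroˡ q
    *-distribʳ-∑ (x ∷ xs) q f = ≈-trans (distribʳ q _ _) (+-congˡ (*-distribʳ-∑ xs q f))

    ∑-++ : ∀ xs ys (f : A → Carrier) → ∑ (xs ++ ys) f ≈ ∑ xs f + ∑ ys f
    ∑-++ []       ys f = ≈-sym (+-identityˡ _)
    ∑-++ (x ∷ xs) ys f = ≈-trans (+-congˡ (∑-++ xs ys f)) (≈-sym (+-assoc _ _ _))

    ∑-pick : ∀ {xs x} (f : A → Carrier) → Unique xs → x ∈ xs →
             (∀ {y} → y ∈ xs → y ≢ x → f y ≈ 0#) → ∑ xs f ≈ f x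
    ∑-pick f (x∉ ∷ u) (here refl) h = ≈-trans (+-congˡ (∑-zero _ λ y∈ →
      h (there y∈) (All.lookup x∉ y∈ ∘ sym))) (+-identityʳ _)
    ∑-pick f (x∉ ∷ u) (there x∈) h = ≈-trans (+-cong (h (here refl) (All.lookup x∉ x∈))
      (∑-pick f u x∈ (h ∘ there))) (+-identityˡ _)

    ∑-δ : ∀ (_≟_ : DecidableEquality A) {xs x} (f : A → Carrier) → Unique xs → x ∈ xs →
          ∑ xs (λ y → 𝟙 (y ≟ x) * f y) ≈ f x
    ∑-δ _≟_ {xs} {x} f u x∈ = begin
      ∑ xs (λ y → 𝟙 (y ≟ x) * f y)  ≈⟨ ∑-pick _ u x∈ (λ _ y≢x → ≈-trans (*-congʳ (reflexive (𝟙-no (_ ≟ _) y≢x))) (zeroˡ _)) ⟩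
      𝟙 (x ≟ x) * f x               ≈⟨ *-congʳ (reflexive (𝟙-yes (x ≟ x) refl)) ⟩
      1# * f x                      ≈⟨ *-identityˡ _ ⟩
      f x                           ∎

    ∑-tabulate : ∀ {n} (g : Fin n → A) f → ∑ (tabulate g) f ≡ sum (f ∘ g)
    ∑-tabulate {ℕ.zero}  g f = refl
    ∑-tabulate {ℕ.suc n} g f = cong (f (g zero) +_) (∑-tabulate (g ∘ suc) f)

  module _ {a b} {A : Set a} {B : Set b} where

    ∑-map : ∀ xs (g : A → B) f → ∑ (map g xs) f ≡ ∑ xs (f ∘ g)
    ∑-map []       g f = refl
    ∑-map (x ∷ xs) g f = cong (f (g x) +_) (∑-map xs g f)

    ∑-swap : ∀ xs ys (f : A → B → Carrier) → ∑ xs (λ x → ∑ ys (f x)) ≈ ∑ ys (λ y → ∑ xs (λ x → f x y))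
    ∑-swap []       ys f = ≈-sym (∑-zero ys (λ _ → ≈-refl))
    ∑-swap (x ∷ xs) ys f = ≈-trans (+-congˡ (∑-swap xs ys f)) (≈-sym (∑-distrib-+ ys _ _))

    ∑-*-∑ : ∀ xs ys (f : A → Carrier) (g : B → Carrier) →
            ∑ xs f * ∑ ys g ≈ ∑ xs (λ x → ∑ ys (λ y → f x * g y))
    ∑-*-∑ xs ys f g = ≈-trans (*-distribʳ-∑ xs _ f) (∑-cong xs (λ x → *-distribˡ-∑ ys (f x) g))

  ∑-cartesianProductWith : ∀ {a b c} {A : Set a} {B : Set b} {C : Set c} (h : A → B → C) xs ys f →
    ∑ (cartesianProductWith h xs ys) f ≈ ∑ xs (λ x → ∑ ys (λ y → f (h x y)))
  ∑-cartesianProductWith h []       ys f = ≈-refl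
  ∑-cartesianProductWith h (x ∷ xs) ys f = ≈-trans (∑-++ (map (h x) ys) _ f)
    (+-cong (reflexive (∑-map ys (h x) f)) (∑-cartesianProductWith h xs ys f))

  ∑-concatMap : ∀ {a b} {A : Set a} {B : Set b} (h : A → List B) xs f →
    ∑ (concatMap h xs) f ≈ ∑ xs (λ x → ∑ (h x) f)
  ∑-concatMap h []       f = ≈-refl
  ∑-concatMap h (x ∷ xs) f = ≈-trans (∑-++ (h x) (concatMap h xs) f) (+-congˡ (∑-concatMap h xs f))

  sum≡∑ : ∀ {n} (f : Fin n → Carrier) → sum f ≡ ∑ (allFin n) f
  sum≡∑ f = sym (∑-tabulate id f)

listsOf : ∀ {a} {A : Set a} → List A → ℕ → List (List A)
listsOf xs ℕ.zero    = [] ∷ []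
listsOf xs (ℕ.suc m) = cartesianProductWith _∷_ xs (listsOf xs m)

module _ {a} {A : Set a} where

  ∈-listsOf : ∀ {xs : List A} l → (∀ {x} → x ∈ l → x ∈ xs) → l ∈ listsOf xs (length l)
  ∈-listsOf []      h = here refl
  ∈-listsOf (x ∷ l) h = ∈-cartesianProductWith⁺ _∷_ (h (here refl)) (∈-listsOf l (h ∘ there))

  length-listsOf : ∀ (xs : List A) m {l} → l ∈ listsOf xs m → length l ≡ m
  length-listsOf xs ℕ.zero    (here refl) = refl
  length-listsOf xs (ℕ.suc m) l∈
    with _ , _ , _ , l′∈ , refl ← ∈-cartesianProductWith⁻ _∷_ xs (listsOf xs m) l∈ =
    cong ℕ.suc (length-listsOf xs m l′∈)

  listsOf-unique : ∀ {xs : List A} m → Unique xs → Unique (listsOf xs m)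
  listsOf-unique ℕ.zero    u = [] ∷ []
  listsOf-unique (ℕ.suc m) u = Unique.cartesianProductWith⁺ _∷_ ∷-injective u (listsOf-unique m u)

tuples : (n m : ℕ) → List (List (Fin n))
tuples n = listsOf (allFin n)

tuples-unique : ∀ n m → Unique (tuples n m)
tuples-unique n m = listsOf-unique m (Unique.allFin⁺ n)

∈-tuples : ∀ {n} (l : List (Fin n)) → l ∈ tuples n (length l)
∈-tuples l = ∈-listsOf l (λ _ → ∈-allFin _)

length-tuples : ∀ n m {l} → l ∈ tuples n m → length l ≡ m
length-tuples n = length-listsOf (allFin n)

module _ {ℓ₁ ℓ₂} (R : CommutativeRing ℓ₁ ℓ₂) where
  open CommutativeRing R hiding (zero; refl; sym; trans)
  open CommutativeRing R using () renaming (refl to ≈-refl; sym to ≈-sym; trans to ≈-trans)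
  open ListSum R

  ∑-listsOf-+ : ∀ {a} {A : Set a} (xs : List A) m m′ f →
    ∑ (listsOf xs (m ℕ.+ m′)) f ≈ ∑ (listsOf xs m) (λ u → ∑ (listsOf xs m′) (λ v → f (u ++ v)))
  ∑-listsOf-+ xs ℕ.zero    m′ f = ≈-sym (+-identityʳ _)
  ∑-listsOf-+ xs (ℕ.suc m) m′ f = ≈-trans (∑-cartesianProductWith _∷_ xs (listsOf xs (m ℕ.+ m′)) f)
    (≈-trans (∑-cong xs λ x → ∑-listsOf-+ xs m m′ (f ∘ (x ∷_)))
           (≈-sym (∑-cartesianProductWith _∷_ xs (listsOf xs m) _)))

-- Colourings and the uniform solution of the Sherali–Adams system

module _ where
  open ListSum ℚ.+-*-commutativeRing
  open import Data.Fin.Subset using (∣_∣)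

  module Merge {A : Set} (_≟_ : DecidableEquality A) where

    relabel : A → A → A → A
    relabel a b x with x ≟ a
    ... | yes _ = b
    ... | no  _ = x

    -- Naive union-find: each edge renames the label of one end to that of the other, everywhere.
    -- Equality of labels is then a decidable form of the equivalence generated by the edges.
    merge : List (A × A) → A → A
    merge []             = id
    merge ((u , v) ∷ es) = relabel (merge es u) (merge es v) ∘ merge es

    merge-joins : ∀ es {u v} → (u , v) ∈ es → merge es u ≡ merge es v
    merge-joins ((u , v) ∷ es) (here refl) with merge es u ≟ merge es u | merge es v ≟ merge es u
    ... | yes _ | yes _ = refl
    ... | yes _ | no  _ = refl
    ... | no ¬p | _     = ⊥-elim (¬p refl)
    merge-joins ((u , v) ∷ es) (there e∈) = cong (relabel _ _) (merge-joins es e∈)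

    -- Minimality of the generated equivalence: a label is reached from its element through edges
    -- only. Every invariance statement about colours rests on this.
    merge-invariant : ∀ {B : Set} (F : A → B) es → (∀ {u v} → (u , v) ∈ es → F u ≡ F v) →
                      ∀ x → F (merge es x) ≡ F x
    merge-invariant F []             h x = refl
    merge-invariant F ((u , v) ∷ es) h x with merge es x ≟ merge es u
    ... | no  _ = merge-invariant F es (h ∘ there) x
    ... | yes p = trans (merge-invariant F es (h ∘ there) v) (trans (sym (h (here refl)))
                  (trans (sym (merge-invariant F es (h ∘ there) u)) (trans (cong F (sym p)) (merge-invariant F es (h ∘ there) x))))

  -- Naturality forces op to rearrange, drop or repeat entries by position only.
  record Rearrangement : Set₁ where
    field
      op     : ∀ {A : Set} → List A → List A
      op-map : ∀ {A B : Set} (f : A → B) l → op (map f l) ≡ map f (op l)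
      op-⊆   : ∀ {A : Set} (l : List A) → op l ⊆ l

  open Rearrangement

  ∈-take : ∀ {A : Set} n (l : List A) → take n l ⊆ l
  ∈-take (suc n) (x ∷ l) (here p)  = here p
  ∈-take (suc n) (x ∷ l) (there p) = there (∈-take n l p)

  ∈-drop : ∀ {A : Set} n (l : List A) → drop n l ⊆ l
  ∈-drop zero    l       p = p
  ∈-drop (suc n) (x ∷ l) p = there (∈-drop n l p)

  takeᴿ dropᴿ : ℕ → Rearrangement
  takeᴿ n = record { op = take n ; op-map = λ f l → List.take-map n l ; op-⊆ = ∈-take n }
  dropᴿ n = record { op = drop n ; op-map = λ f l → List.drop-map n l ; op-⊆ = ∈-drop n }

  infixr 5 _++ᴿ_
  infixr 9 _∘ᴿ_

  _++ᴿ_ : Rearrangement → Rearrangement → Rearrangement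
  ρ ++ᴿ σ = record
    { op     = λ l → op ρ l ++ op σ l
    ; op-map = λ f l → trans (cong₂ _++_ (op-map ρ f l) (op-map σ f l)) (sym (List.map-++ f (op ρ l) (op σ l)))
    ; op-⊆   = λ l x∈ → case-++ l (∈-++⁻ (op ρ l) x∈)
    }
    where
    open import Data.Sum using (_⊎_)
    case-++ : ∀ {A : Set} {x : A} l → x ∈ op ρ l ⊎ x ∈ op σ l → x ∈ l
    case-++ l (inj₁ p) = op-⊆ ρ l p
    case-++ l (inj₂ p) = op-⊆ σ l p

  _∘ᴿ_ : Rearrangement → Rearrangement → Rearrangement
  ρ ∘ᴿ σ = record
    { op     = op ρ ∘ op σ
    ; op-map = λ f l → trans (cong (op ρ) (op-map σ f l)) (op-map ρ f (op σ l))
    ; op-⊆   = λ l → op-⊆ σ l ∘ op-⊆ ρ (op σ l)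
    }

  -- Reads off the listed positions; an index past the end contributes nothing. Through `⊆⇒select`,
  -- an inclusion between the entries of two lists becomes a rearrangement, to which the colouring
  -- is stable.
  selectᴿ : List ℕ → Rearrangement
  selectᴿ []      = record { op = λ _ → [] ; op-map = λ _ _ → refl ; op-⊆ = λ _ () }
  selectᴿ (i ∷ ι) = takeᴿ 1 ∘ᴿ dropᴿ i ++ᴿ selectᴿ ι

  length-select : ∀ {A : Set} ι (l : List A) → length (op (selectᴿ ι) l) ≤ length ι
  length-select []      l = z≤n
  length-select (i ∷ ι) l = subst (_≤ suc (length ι)) (sym (List.length-++ (take 1 (drop i l))))
    (ℕ.+-mono-≤ (subst (_≤ 1) (sym (List.length-take 1 (drop i l))) (ℕ.m⊓n≤m 1 _)) (length-select ι l))

  ∈⇒position : ∀ {A : Set} {x : A} {l} → x ∈ l → ∃ λ i → take 1 (drop i l) ≡ x ∷ []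
  ∈⇒position (here refl) = 0 , refl
  ∈⇒position (there p) with i , eq ← ∈⇒position p = suc i , eq

  ⊆⇒select : ∀ {A : Set} {l : List A} l′ → l′ ⊆ l → ∃ λ ι → op (selectᴿ ι) l ≡ l′ × length ι ≡ length l′
  ⊆⇒select []       h = [] , refl , refl
  ⊆⇒select (x ∷ l′) h with i , p ← ∈⇒position (h (here refl)) | ι , q , r ← ⊆⇒select l′ (h ∘ there) =
    i ∷ ι , cong₂ _++_ p q , cong suc r

  -- Winning positions for Duplicator in the bijective k-pebble game, with `true` and `false`
  -- naming the two graphs.  S-ext replaces the bijection by its consequence for invariant sums,
  -- which also follows from a fractional bijection.
  record BackAndForth (ord : Bool → ℕ) (E : ∀ s → Fin (ord s) → Fin (ord s) → Bool) (k : ℕ) : Set₁ where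
    Pair : Set
    Pair = Fin (ord true) × Fin (ord false)

    field
      S     : List Pair → Set
      S?    : ∀ l → Dec (S l)
      S-[]  : S []
      S-⊆   : ∀ {l l′} → l′ ⊆ l → S l → S l′
      S-≡   : ∀ {l p q} → S l → p ∈ l → q ∈ l → does (proj₁ p Fin.≟ proj₁ q) ≡ does (proj₂ p Fin.≟ proj₂ q)
      S-E   : ∀ {l p q} → S l → p ∈ l → q ∈ l → E true (proj₁ p) (proj₁ q) ≡ E false (proj₂ p) (proj₂ q)
      S-ext : ∀ {l} → S l → length l < k → ∀ φ ψ → (∀ g h → S ((g , h) ∷ l) → φ g ≡ ψ h) →
              ∑ (allFin (ord true)) φ ≡ ∑ (allFin (ord false)) ψ

  -- The stable colouring generated by the winning positions

  module Colouring {ord E k} (B : BackAndForth ord E k) where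
    open BackAndForth B

    Verts : Bool → Set
    Verts s = Fin (ord s)

    Node : Set
    Node = ∃ λ s → List (Verts s)

    pr : ∀ s → Pair → Verts s
    pr true  = proj₁
    pr false = proj₂

    node : Bool → List Pair → Node
    node s l = s , map (pr s) l

    len : Node → ℕ
    len = length ∘ proj₂

    -- The colouring enters later arguments through `c-edge` and `c-invariant′` alone; sealing it
    -- keeps the enumeration in `edges` from being unfolded.
    abstract
      _≟ᴺ_ : DecidableEquality Node
      _≟ᴺ_ = Product.≡-dec Bool._≟_ (List.≡-dec Fin._≟_)

      open Merge _≟ᴺ_

      edges : List (Node × Node)
      edges = map (λ l → node true l , node false l) (filter S?
        (concatMap (listsOf (cartesianProduct (allFin (ord true)) (allFin (ord false)))) (upTo (suc k))))

      -- c u is a representative of the class of u under the equivalence generated by edges.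
      c : Node → Node
      c = merge edges

      c-edge : ∀ l → length l ≤ k → S l → c (node true l) ≡ c (node false l)
      c-edge l l≤k s = merge-joins edges (∈-map⁺ _ (∈-filter⁺ S?
        (∈-concatMap⁺ (listsOf _) (Any.map (λ { refl → ∈-listsOf l (λ _ → ∈-cartesianProduct⁺ (∈-allFin _) (∈-allFin _)) })
          (∈-upTo⁺ (s≤s l≤k)))) s))

      edge⇒S : ∀ {u v} → (u , v) ∈ edges → ∃ λ l → length l ≤ k × S l × u ≡ node true l × v ≡ node false l
      edge⇒S e∈ with l , l∈ , refl ← ∈-map⁻ _ e∈ with l∈′ , s ← ∈-filter⁻ S? {xs = concatMap (listsOf _) (upTo (suc k))} l∈
        with m , m∈ , l∈m ← find (∈-concatMap⁻ (listsOf _) {xs = upTo (suc k)} l∈′) =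
        l , subst (_≤ k) (sym (length-listsOf _ m l∈m)) (ℕ.≤-pred (∈-upTo⁻ m∈)) , s , refl , refl

      c-invariant′ : ∀ {X : Set} (F : Node → X) → (∀ l → length l ≤ k → S l → F (node true l) ≡ F (node false l)) →
                    ∀ {u v} → c u ≡ c v → F u ≡ F v
      c-invariant′ F h {u} {v} eq = trans (sym (inv u)) (trans (cong F eq) (inv v))
        where
        inv : ∀ u → F (c u) ≡ F u
        inv = merge-invariant F edges λ e∈ → case (edge⇒S e∈)
          where
          case : ∀ {u v} → (∃ λ l → length l ≤ k × S l × u ≡ node true l × v ≡ node false l) → F u ≡ F v
          case (l , l≤k , s , refl , refl) = h l l≤k s

    c-len : ∀ {u v} → c u ≡ c v → len u ≡ len v
    c-len = c-invariant′ len λ l _ _ → trans (List.length-map _ l) (sym (List.length-map _ l))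

    -- Edges join tuples of equal length, so `F` only has to respect the edges of its own length j.
    -- Elsewhere it is replaced by `nothing`, which makes it invariant for trivial reasons.
    c-invariant : ∀ {X : Set} (F : Node → X) j →
                  (∀ l → length l ≡ j → length l ≤ k → S l → F (node true l) ≡ F (node false l)) →
                  ∀ {u v} → len u ≡ j → c u ≡ c v → F u ≡ F v
    c-invariant {X} F j h {u} {v} uj eq = just-injective (trans (sym (F′-just u uj))
      (trans (c-invariant′ F′ h′ eq) (F′-just v (trans (sym (c-len {u} {v} eq)) uj))))
      where
      F′ : Node → Maybe X
      F′ u with len u ℕ.≟ j
      ... | yes _ = just (F u)
      ... | no  _ = nothing
      F′-just : ∀ u → len u ≡ j → F′ u ≡ just (F u)
      F′-just u p with len u ℕ.≟ j
      ... | yes _ = refl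
      ... | no ¬p = ⊥-elim (¬p p)
      h′ : ∀ l → length l ≤ k → S l → F′ (node true l) ≡ F′ (node false l)
      h′ l l≤k s with len (node true l) ℕ.≟ j | len (node false l) ℕ.≟ j
      ... | yes p | yes _ = cong just (h l (trans (sym (List.length-map _ l)) p) l≤k s)
      ... | no _  | no  _ = refl
      ... | yes p | no ¬q = ⊥-elim (¬q (trans (trans (List.length-map _ l) (sym (List.length-map _ l))) p))
      ... | no ¬p | yes q = ⊥-elim (¬p (trans (trans (List.length-map _ l) (sym (List.length-map _ l))) q))

    apply : Rearrangement → Node → Node
    apply ρ (s , l) = s , op ρ l

    -- On a generating edge, naturality moves `op` to the underlying list of pairs, and `S-⊆` keeps
    -- that list a winning position. The length bound is there because only positions of at most k
    -- pairs give edges.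
    c-apply : ∀ ρ {u v} → (∀ (l : List Pair) → length l ≡ len u → length l ≤ k → length (op ρ l) ≤ k) →
              c u ≡ c v → c (apply ρ u) ≡ c (apply ρ v)
    c-apply ρ {u} {v} h = c-invariant (c ∘ apply ρ) (len u) (λ l lj l≤k s →
      subst₂ (λ a b → c (true , a) ≡ c (false , b)) (sym (op-map ρ proj₁ l)) (sym (op-map ρ proj₂ l))
        (c-edge (op ρ l) (h l lj l≤k) (S-⊆ (op-⊆ ρ l) s))) refl

    -- For `T` the equality or adjacency test, this is the corresponding part of the atomic type of
    -- the tuple.
    matrix : (∀ s → Verts s → Verts s → Bool) → Node → List (List Bool)
    matrix T (s , l) = map (λ x → map (T s x) l) l

    matrix-node : ∀ T s l → matrix T (node s l) ≡ map (λ p → map (λ q → T s (pr s p) (pr s q)) l) l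
    matrix-node T s l = trans (sym (List.map-∘ l)) (List.map-cong (λ p → sym (List.map-∘ l)) l)

    map-cong∈ : ∀ {X Y : Set} {f g : X → Y} l → (∀ {x} → x ∈ l → f x ≡ g x) → map f l ≡ map g l
    map-cong∈ []      h = refl
    map-cong∈ (x ∷ l) h = cong₂ _∷_ (h (here refl)) (map-cong∈ l (h ∘ there))

    map-≡⇒≡ : ∀ {X Y : Set} {f g : X → Y} l → map f l ≡ map g l → ∀ {x} → x ∈ l → f x ≡ g x
    map-≡⇒≡ (x ∷ l) eq (here refl) = List.∷-injectiveˡ eq
    map-≡⇒≡ (x ∷ l) eq (there p)   = map-≡⇒≡ l (List.∷-injectiveʳ eq) p

    c-matrix : ∀ T → (∀ {l p q} → S l → p ∈ l → q ∈ l → T true (proj₁ p) (proj₁ q) ≡ T false (proj₂ p) (proj₂ q)) →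
               ∀ {u v} → c u ≡ c v → matrix T u ≡ matrix T v
    c-matrix T h = c-invariant′ (matrix T) λ l _ s → trans (matrix-node T true l)
      (trans (map-cong∈ l (λ p∈ → map-cong∈ l (λ q∈ → h s p∈ q∈))) (sym (matrix-node T false l)))

    T-≡ : ∀ s → Verts s → Verts s → Bool
    T-≡ s x y = does (x Fin.≟ y)

    c-node-T : ∀ T → (∀ {l p q} → S l → p ∈ l → q ∈ l → T true (proj₁ p) (proj₁ q) ≡ T false (proj₂ p) (proj₂ q)) →
               ∀ {l} → c (node true l) ≡ c (node false l) → ∀ {p q} → p ∈ l → q ∈ l →
               T true (proj₁ p) (proj₁ q) ≡ T false (proj₂ p) (proj₂ q)
    c-node-T T h {l} eq p∈ q∈ = map-≡⇒≡ l (map-≡⇒≡ l (trans (sym (matrix-node T true l))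
      (trans (c-matrix T h eq) (matrix-node T false l))) p∈) q∈

    -- The colour determines which entries coincide, and on the right the head coincides with an
    -- entry of `a`.
    c-∷-injective : ∀ {s g h a} → g ∈ a → c (s , h ∷ a) ≡ c (s , g ∷ a) → h ≡ g
    c-∷-injective {s} {g} {h} {a} g∈a eq with h Fin.≟ g | g Fin.≟ g | row
      where
      row : T-≡ s h g ≡ T-≡ s g g
      row = map-≡⇒≡ a (List.∷-injectiveʳ (List.∷-injectiveˡ (c-matrix T-≡ S-≡ eq))) g∈a
    ... | yes p | _     | _  = p
    ... | no _  | yes _ | ()
    ... | no _  | no ¬q | _  = ⊥-elim (¬q refl)

    Σext : (Node → ℚ) → Node → ℚ
    Σext φ (s , l) = ∑ (allFin (ord s)) (λ g → φ (s , g ∷ l))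

    Σexts : (Node → ℚ) → ℕ → Node → ℚ
    Σexts φ m (s , l) = ∑ (tuples (ord s) m) (λ z → φ (s , z ++ l))

    Invariant : ℕ → (Node → ℚ) → Set
    Invariant j φ = ∀ {u v} → len u ≡ j → c u ≡ c v → φ u ≡ φ v

    -- Stability under refinement: on a generating edge, `S-ext` compares the extensions on the two
    -- sides, since a winning extension of the position is again an edge.
    Σext-invariant : ∀ {j} φ → j < k → Invariant (suc j) φ → Invariant j (Σext φ)
    Σext-invariant {j} φ j<k inv = c-invariant (Σext φ) j (λ l lj l≤k s →
      S-ext s (subst (_< k) (sym lj) j<k) _ _ (λ g h s′ →
        inv (cong suc (trans (List.length-map _ l) lj))
            (c-edge ((g , h) ∷ l) (subst (_≤ k) (cong suc (sym lj)) j<k) s′)))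

    Σexts-suc : ∀ φ m u → Σexts φ (suc m) u ≡ Σexts (Σext φ) m u
    Σexts-suc φ m (s , l) = trans (∑-cartesianProductWith _∷_ (allFin (ord s)) (tuples (ord s) m) _)
                                  (∑-swap (allFin (ord s)) (tuples (ord s) m) _)

    Σexts-invariant : ∀ {j} φ m → m ℕ.+ j ≤ k → Invariant (m ℕ.+ j) φ → Invariant j (Σexts φ m)
    Σexts-invariant φ zero    _   inv uj eq = cong (ℚ._+ 0ℚ) (inv uj eq)
    Σexts-invariant φ (suc m) j≤k inv {u} {v} uj eq = begin
      Σexts φ (suc m) u   ≡⟨ Σexts-suc φ m u ⟩
      Σexts (Σext φ) m u  ≡⟨ Σexts-invariant (Σext φ) m (ℕ.<⇒≤ j≤k) (Σext-invariant φ j≤k inv) uj eq ⟩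
      Σexts (Σext φ) m v  ≡⟨ Σexts-suc φ m v ⟨
      Σexts φ (suc m) v   ∎
      where open ≡-Reasoning

  ∑-nonNegative : ∀ {A : Set} xs {f : A → ℚ} → (∀ {x} → x ∈ xs → 0ℚ ℚ.≤ f x) → 0ℚ ℚ.≤ ∑ xs f
  ∑-nonNegative []       h = ℚ.≤-refl
  ∑-nonNegative (x ∷ xs) h = ℚ.+-mono-≤ (h (here refl)) (∑-nonNegative xs (h ∘ there))

  ≤-∑ : ∀ {A : Set} {xs x} {f : A → ℚ} → (∀ {x} → x ∈ xs → 0ℚ ℚ.≤ f x) → x ∈ xs → f x ℚ.≤ ∑ xs f
  ≤-∑ {xs = x ∷ xs} {f = f} h (here refl) = subst (ℚ._≤ f x ℚ.+ ∑ xs f) (ℚ.+-identityʳ _)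
    (ℚ.+-monoʳ-≤ (f x) (∑-nonNegative xs (h ∘ there)))
  ≤-∑ {xs = y ∷ xs} {x} {f} h (there x∈) = subst (ℚ._≤ f y ℚ.+ ∑ xs f) (ℚ.+-identityˡ _)
    (ℚ.+-mono-≤ (h (here refl)) (≤-∑ (h ∘ there) x∈))

  0≤𝟙 : ∀ {P : Set} (d : Dec P) → 0ℚ ℚ.≤ 𝟙 d
  0≤𝟙 (yes _) = ℚ.nonNegative⁻¹ 1ℚ
  0≤𝟙 (no _)  = ℚ.≤-refl

  -- 1/q, extended by 1/0 = 0.
  recip : ℚ → ℚ
  recip q with q ℚ.≟ 0ℚ
  ... | yes _  = 0ℚ
  ... | no q≢0 = (ℚ.1/ q) {{ℚ.≢-nonZero q≢0}}

  *-recip : ∀ {q} → q ≢ 0ℚ → q ℚ.* recip q ≡ 1ℚ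
  *-recip {q} q≢0 with q ℚ.≟ 0ℚ
  ... | yes q≡0 = ⊥-elim (q≢0 q≡0)
  ... | no q≢0′ = ℚ.*-inverseʳ q {{ℚ.≢-nonZero q≢0′}}

  recip-nonNegative : ∀ {q} → 0ℚ ℚ.≤ q → 0ℚ ℚ.≤ recip q
  recip-nonNegative {q} 0≤q with q ℚ.≟ 0ℚ
  ... | yes _  = ℚ.≤-refl
  ... | no q≢0 = ℚ.<⇒≤ (ℚ.positive⁻¹ _ {{ℚ.1/pos⇒pos q {{ℚ.positive (ℚ.≰⇒> (λ q≤0 → q≢0 (ℚ.≤-antisym q≤0 0≤q)))}}}})

  *-recip-* : ∀ a m → a ℚ.* m ≢ 0ℚ → m ℚ.* recip (a ℚ.* m) ≡ recip a
  *-recip-* a m am≢0 = begin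
    m ℚ.* r                        ≡⟨ ℚ.*-identityˡ _ ⟨
    1ℚ ℚ.* (m ℚ.* r)               ≡⟨ cong (ℚ._* (m ℚ.* r)) (*-recip a≢0) ⟨
    a ℚ.* recip a ℚ.* (m ℚ.* r)    ≡⟨ lemma a (recip a) m r ⟩
    a ℚ.* m ℚ.* r ℚ.* recip a      ≡⟨ cong (ℚ._* recip a) (*-recip am≢0) ⟩
    1ℚ ℚ.* recip a                 ≡⟨ ℚ.*-identityˡ _ ⟩
    recip a                        ∎
    where
    open ≡-Reasoning
    open import Data.Rational.Solver using (module +-*-Solver)
    r = recip (a ℚ.* m)
    a≢0 : a ≢ 0ℚ
    a≢0 a≡0 = am≢0 (trans (cong (ℚ._* m) a≡0) (ℚ.*-zeroˡ m))
    lemma : ∀ a b m r → a ℚ.* b ℚ.* (m ℚ.* r) ≡ a ℚ.* m ℚ.* r ℚ.* b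
    lemma = solve 4 (λ a b m r → a :* b :* (m :* r) := a :* m :* r :* b) refl
      where open +-*-Solver

  unique-⊆⇒↭ : ∀ {A : Set} {xs ys : List A} → Unique xs → Unique ys → xs ⊆ ys → ys ⊆ xs → xs ↭ ys
  unique-⊆⇒↭ u v p q = ∼bag⇒↭ (unique∧set⇒bag u v (mk⇔ p q))

  -- Class sizes and uniform weights

  module Weights {ord E k} (B : BackAndForth ord E k) where
    open BackAndForth B
    open Colouring B

    -- The size of the class of u among the tuples of graph s.
    N : Bool → Node → ℚ
    N s u = ∑ (tuples (ord s) (len u)) (λ v → 𝟙 (c (s , v) ≟ᴺ c u))

    N-cong : ∀ s {u v} → c u ≡ c v → N s u ≡ N s v
    N-cong s {u} {v} eq rewrite c-len {u} {v} eq = ∑-cong (tuples (ord s) (len v)) λ w →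
      𝟙-cong (_ ≟ᴺ _) (_ ≟ᴺ _) (λ p → trans p eq) (λ p → trans p (sym eq))

    class : Node → Node → ℚ
    class u w = 𝟙 (c w ≟ᴺ c u)

    class-cong : ∀ u {v w} → c v ≡ c w → class u v ≡ class u w
    class-cong u eq = 𝟙-cong (_ ≟ᴺ _) (_ ≟ᴺ _) (trans (sym eq)) (trans eq)

    -- A class size is an iterated sum of extensions of the empty tuple, and the two empty tuples
    -- are joined by the edge from `S-[]`.
    N-sides : ∀ {u} → len u ≤ k → N true u ≡ N false u
    N-sides {u} u≤k = begin
      N true u                                ≡⟨ nil true ⟩
      Σexts (class u) (len u) (true , [])     ≡⟨ Σexts-invariant (class u) (len u) (subst (_≤ k) (sym (ℕ.+-identityʳ _)) u≤k)
                                                   (λ {v} {w} _ → class-cong u {v} {w}) refl (c-edge [] z≤n S-[]) ⟩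
      Σexts (class u) (len u) (false , [])    ≡⟨ nil false ⟨
      N false u                               ∎
      where
      open ≡-Reasoning
      nil : ∀ s → N s u ≡ Σexts (class u) (len u) (s , [])
      nil s = ∑-cong (tuples (ord s) (len u)) λ z → cong (λ z → class u (s , z)) (sym (List.++-identityʳ z))

    c-tail : ∀ {s s′ g h a b} → c (s , g ∷ a) ≡ c (s′ , h ∷ b) → c (s , a) ≡ c (s′ , b)
    c-tail {s} {s′} {g} {h} {a} {b} = c-apply (dropᴿ 1) {s , g ∷ a} {s′ , h ∷ b}
      λ l _ l≤k → ℕ.≤-trans (subst (_≤ length l) (sym (List.length-drop 1 l)) (ℕ.m∸n≤m (length l) 1)) l≤k

    Σclass : ∀ s′ g a → ℚ
    Σclass s′ g a = Σext (class (s′ , g ∷ a)) (s′ , a)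

    Σext-class : ∀ {s s′ v g a} → length v < k →
                 Σext (class (s′ , g ∷ a)) (s , v) ≡ class (s′ , a) (s , v) ℚ.* Σclass s′ g a
    Σext-class {s} {s′} {v} {g} {a} v<k with c (s , v) ≟ᴺ c (s′ , a)
    ... | yes p = trans (Σext-invariant (class (s′ , g ∷ a)) v<k (λ {v} {w} _ → class-cong (s′ , g ∷ a) {v} {w}) refl p)
                        (sym (ℚ.*-identityˡ _))
    ... | no ¬p = trans (∑-zero (allFin (ord s)) (λ _ → 𝟙-no (_ ≟ᴺ _) (¬p ∘ c-tail)))
                        (sym (ℚ.*-zeroˡ (Σclass s′ g a)))

    -- Fibre counting: deleting the head maps the class of `g ∷ a` to the class of `a`, and by
    -- stability every fibre has `Σclass s′ g a` elements, in whichever graph it lies.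
    N-∷ : ∀ s s′ g a → length a < k → N s (s′ , g ∷ a) ≡ N s (s′ , a) ℚ.* Σclass s′ g a
    N-∷ s s′ g a a<k = begin
      N s (s′ , g ∷ a)
        ≡⟨ ∑-cartesianProductWith _∷_ (allFin (ord s)) _ _ ⟩
      ∑ (allFin (ord s)) (λ h → ∑ ts (λ v → class (s′ , g ∷ a) (s , h ∷ v)))
        ≡⟨ ∑-swap (allFin (ord s)) ts _ ⟩
      ∑ ts (λ v → Σext (class (s′ , g ∷ a)) (s , v))
        ≡⟨ ∑-cong∈ ts (λ v∈ → Σext-class (subst (_< k) (sym (length-tuples (ord s) (length a) v∈)) a<k)) ⟩
      ∑ ts (λ v → class (s′ , a) (s , v) ℚ.* Σclass s′ g a)
        ≡⟨ *-distribʳ-∑ ts (Σclass s′ g a) _ ⟨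
      N s (s′ , a) ℚ.* Σclass s′ g a
        ∎
      where
      open ≡-Reasoning
      ts = tuples (ord s) (length a)

    -- The class contains `u` itself; if `u` belongs to the other graph, `N-sides` carries this
    -- over.
    N-nonZero : ∀ {u} → len u ≤ k → N true u ≢ 0ℚ
    N-nonZero {s , a} u≤k N≡0 = ℚ.<⇒≢ (ℚ.<-≤-trans (ℚ.positive⁻¹ 1ℚ)
      (subst₂ ℚ._≤_ (𝟙-yes (c (s , a) ≟ᴺ c (s , a)) refl) (own s) (≤-∑ (λ {x} _ → 0≤𝟙 (_ ≟ᴺ _)) (∈-tuples a)))) (sym N≡0)
      where
      own : ∀ s′ → N s′ (s , a) ≡ N true (s , a)
      own true  = refl
      own false = sym (N-sides {s , a} u≤k)

    N-nonNegative : ∀ s u → 0ℚ ℚ.≤ N s u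
    N-nonNegative s u = ∑-nonNegative (tuples (ord s) (len u)) (λ _ → 0≤𝟙 (_ ≟ᴺ _))

    W : Node → Node → ℚ
    W u v = 𝟙 (c u ≟ᴺ c v) ℚ.* recip (N true u)

    W-nonNegative : ∀ u v → 0ℚ ℚ.≤ W u v
    W-nonNegative u v = subst (ℚ._≤ W u v) (ℚ.*-zeroʳ (𝟙 (c u ≟ᴺ c v)))
      (ℚ.*-monoˡ-≤-nonNeg (𝟙 (c u ≟ᴺ c v)) {{ℚ.nonNegative (0≤𝟙 (c u ≟ᴺ c v))}} (recip-nonNegative (N-nonNegative true u)))

    W-≢ : ∀ {u v} → c u ≢ c v → W u v ≡ 0ℚ
    W-≢ {u} {v} u≢v = trans (cong (ℚ._* recip (N true u)) (𝟙-no (c u ≟ᴺ c v) u≢v)) (ℚ.*-zeroˡ (recip (N true u)))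

    W-≡ : ∀ {u v} → c u ≡ c v → W u v ≡ recip (N true u)
    W-≡ {u} {v} u≡v = trans (cong (ℚ._* recip (N true u)) (𝟙-yes (c u ≟ᴺ c v) u≡v)) (ℚ.*-identityˡ _)

    W-sym : ∀ u v → W u v ≡ W v u
    W-sym u v with c u ≟ᴺ c v
    ... | yes p = trans (ℚ.*-identityˡ _) (trans (cong recip (N-cong true {u} {v} p)) (sym (W-≡ {v} {u} (sym p))))
    ... | no ¬p = trans (ℚ.*-zeroˡ (recip (N true u))) (sym (W-≢ {v} {u} (¬p ∘ sym)))

    -- There are `Σclass s g a` admissible heads h, and by `N-∷` this factor is exactly the ratio of
    -- the two class sizes. If the tails differ in colour, every term vanishes.
    ∑-W : ∀ {s s′ g a b} → length a < k → ∑ (allFin (ord s′)) (λ h → W (s , g ∷ a) (s′ , h ∷ b)) ≡ W (s , a) (s′ , b)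
    ∑-W {s} {s′} {g} {a} {b} a<k with c (s , a) ≟ᴺ c (s′ , b)
    ... | no ¬p = trans (∑-zero (allFin (ord s′)) (λ {h} _ → W-≢ {s , g ∷ a} {s′ , h ∷ b} (¬p ∘ c-tail)))
                        (sym (ℚ.*-zeroˡ (recip (N true (s , a)))))
    ... | yes p = begin
      ∑ hs (λ h → 𝟙 (c (s , g ∷ a) ≟ᴺ c (s′ , h ∷ b)) ℚ.* r)  ≡⟨ *-distribʳ-∑ hs r _ ⟨
      ∑ hs (λ h → 𝟙 (c (s , g ∷ a) ≟ᴺ c (s′ , h ∷ b))) ℚ.* r  ≡⟨ cong (ℚ._* r) (∑-cong hs (λ h → 𝟙-cong (_ ≟ᴺ _) (_ ≟ᴺ _) sym sym)) ⟩
      Σext (class (s , g ∷ a)) (s′ , b) ℚ.* r                 ≡⟨ cong (ℚ._* r) (Σext-invariant (class (s , g ∷ a)) a<k (λ {v} {w} _ → class-cong (s , g ∷ a) {v} {w}) refl p) ⟨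
      Σclass s g a ℚ.* r                                      ≡⟨ cong (λ q → Σclass s g a ℚ.* recip q) (N-∷ true s g a a<k) ⟩
      Σclass s g a ℚ.* recip (N true (s , a) ℚ.* Σclass s g a)
        ≡⟨ *-recip-* (N true (s , a)) (Σclass s g a) (subst (_≢ 0ℚ) (N-∷ true s g a a<k) (N-nonZero {s , g ∷ a} a<k)) ⟩
      recip (N true (s , a))                                  ≡⟨ ℚ.*-identityˡ _ ⟨
      1ℚ ℚ.* recip (N true (s , a))                           ∎
      where
      open ≡-Reasoning
      hs = allFin (ord s′)
      r = recip (N true (s , g ∷ a))

    module _ (s₀ s : Bool) where

      private
        n : List (Verts s) → ℚ
        n a = N s₀ (s , a)

      -- A head that repeats an entry of the tail has exactly one extension of its colour, by
      -- `c-∷-injective`.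
      N-contract : ∀ {g a} → g ∈ a → length a < k → n (g ∷ a) ≡ n a
      N-contract {g} {a} g∈a a<k = trans (N-∷ s₀ s g a a<k) (trans (cong (n a ℚ.*_) Σ≡1) (ℚ.*-identityʳ _))
        where
        Σ≡1 : Σclass s g a ≡ 1ℚ
        Σ≡1 = trans (∑-pick _ (Unique.allFin⁺ _) (∈-allFin g) (λ _ h≢g → 𝟙-no (_ ≟ᴺ _) (h≢g ∘ c-∷-injective g∈a)))
                    (𝟙-yes (c (s , g ∷ a) ≟ᴺ c (s , g ∷ a)) refl)

      Σclass-mono : ∀ {g h a a′} → length a′ < k → a′ ⊆ a → c (s , h ∷ a) ≡ c (s , g ∷ a) → c (s , h ∷ a′) ≡ c (s , g ∷ a′)
      Σclass-mono {g} {h} {a} {a′} a′<k sub eq with ι , refl , ι≡ ← ⊆⇒select a′ sub =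
        c-apply (takeᴿ 1 ++ᴿ selectᴿ ι ∘ᴿ dropᴿ 1) {s , h ∷ a} {s , g ∷ a} bound eq
        where
        bound : ∀ (l : List Pair) → length l ≡ suc (length a) → length l ≤ k →
                length (take 1 l ++ Rearrangement.op (selectᴿ ι) (drop 1 l)) ≤ k
        bound (x ∷ l) _ _ = ℕ.≤-trans (s≤s (length-select ι l)) (subst (_≤ k) (cong suc (sym ι≡)) a′<k)

      N-prep : ∀ g {a a′} → length a < k → length a′ < k → a ⊆ a′ → a′ ⊆ a → n a ≡ n a′ → n (g ∷ a) ≡ n (g ∷ a′)
      N-prep g {a} {a′} a<k a′<k p q eq = trans (N-∷ s₀ s g a a<k) (trans (cong₂ ℚ._*_ eq
        (∑-cong (allFin (ord s)) λ h → 𝟙-cong (_ ≟ᴺ _) (_ ≟ᴺ _) (Σclass-mono a′<k q) (Σclass-mono a<k p)))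
        (sym (N-∷ s₀ s g a′ a′<k)))

      c-swap : ∀ {s s′ g h a g′ h′ a′} → c (s , g ∷ h ∷ a) ≡ c (s′ , g′ ∷ h′ ∷ a′) → c (s , h ∷ g ∷ a) ≡ c (s′ , h′ ∷ g′ ∷ a′)
      c-swap {s} {s′} {g} {h} {a} {g′} {h′} {a′} = c-apply ((takeᴿ 1 ∘ᴿ dropᴿ 1) ++ᴿ takeᴿ 1 ++ᴿ dropᴿ 2)
        {s , g ∷ h ∷ a} {s′ , g′ ∷ h′ ∷ a′} λ { (_ ∷ _ ∷ _) _ l≤k → l≤k }

      N-swap : ∀ g h a → n (g ∷ h ∷ a) ≡ n (h ∷ g ∷ a)
      N-swap g h a = begin
        n (g ∷ h ∷ a)
          ≡⟨ expand (class (s , g ∷ h ∷ a)) ⟩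
        ∑ vs (λ x → ∑ vs (λ y → ∑ ts (λ z → class (s , g ∷ h ∷ a) (s₀ , x ∷ y ∷ z))))
          ≡⟨ ∑-swap vs vs _ ⟩
        ∑ vs (λ y → ∑ vs (λ x → ∑ ts (λ z → class (s , g ∷ h ∷ a) (s₀ , x ∷ y ∷ z))))
          ≡⟨ ∑-cong vs (λ y → ∑-cong vs λ x → ∑-cong ts λ z → 𝟙-cong (_ ≟ᴺ _) (_ ≟ᴺ _) c-swap c-swap) ⟩
        ∑ vs (λ y → ∑ vs (λ x → ∑ ts (λ z → class (s , h ∷ g ∷ a) (s₀ , y ∷ x ∷ z))))
          ≡⟨ expand (class (s , h ∷ g ∷ a)) ⟨
        n (h ∷ g ∷ a)
          ∎
        where
        open ≡-Reasoning
        vs = allFin (ord s₀)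
        ts = tuples (ord s₀) (length a)
        expand : ∀ φ → ∑ (tuples (ord s₀) (suc (suc (length a)))) (λ v → φ (s₀ , v)) ≡
                       ∑ vs (λ x → ∑ vs (λ y → ∑ ts (λ z → φ (s₀ , x ∷ y ∷ z))))
        expand φ = trans (∑-cartesianProductWith _∷_ vs _ _) (∑-cong vs λ x → ∑-cartesianProductWith _∷_ vs _ _)

      N-↭ : ∀ {a a′} → a ↭ a′ → length a ≤ k → n a ≡ n a′
      N-↭ Perm.refl          _   = refl
      N-↭ (Perm.prep x p)    a≤k = N-prep x a≤k (subst (_< k) (↭-length p) a≤k) (∈-resp-↭ p) (∈-resp-↭ (Perm.↭-sym p))
                                     (N-↭ p (ℕ.<⇒≤ a≤k))
      N-↭ (Perm.swap {a} x y p) a≤k = trans (N-swap x y a)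
        (N-prep y a≤k (subst (λ m → suc (suc m) ≤ k) (↭-length p) a≤k) (∈-resp-↭ q) (∈-resp-↭ (Perm.↭-sym q))
          (N-prep x (ℕ.<⇒≤ a≤k) (ℕ.<⇒≤ (subst (λ m → suc (suc m) ≤ k) (↭-length p) a≤k)) (∈-resp-↭ p) (∈-resp-↭ (Perm.↭-sym p))
            (N-↭ p (ℕ.<⇒≤ (ℕ.<⇒≤ a≤k)))))
        where q = Perm.prep x p
      N-↭ (Perm.trans p q)   a≤k = trans (N-↭ p a≤k) (N-↭ q (subst (_≤ k) (↭-length p) a≤k))

      N-unique : ∀ a {u} → Unique u → a ⊆ u → u ⊆ a → length a ≤ k → n a ≡ n u
      N-unique []      {[]}    _  _ _ _ = refl
      N-unique []      {x ∷ u} _  _ q _ with () ← q (here refl)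
      N-unique (x ∷ a) {u}     u! p q a≤k = trans
        (N-prep x a≤k (ℕ.≤-<-trans (List.length-deduplicate Fin._≟_ a) a≤k) d⁺ d⁻ (N-unique a d! d⁺ d⁻ (ℕ.<⇒≤ a≤k)))
        rest
        where
        d = deduplicate Fin._≟_ a
        d! = DecUnique.deduplicate-! Fin._≟_ a
        d⁺ : a ⊆ d
        d⁺ = ∈-deduplicate⁺ Fin._≟_
        d⁻ : d ⊆ a
        d⁻ = ∈-deduplicate⁻ Fin._≟_ a
        d<k = ℕ.≤-<-trans (List.length-deduplicate Fin._≟_ a) a≤k
        rest : n (x ∷ d) ≡ n u
        rest with member? Fin._≟_ x d
        ... | yes x∈d = trans (N-contract x∈d d<k) (N-↭ (unique-⊆⇒↭ d! u! (p ∘ there ∘ d⁻) (drop-here ∘ q)) (ℕ.<⇒≤ d<k))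
          where
          drop-here : x ∷ a ⊆ d
          drop-here (here refl) = x∈d
          drop-here (there y∈)  = d⁺ y∈
        ... | no x∉d = N-↭ (unique-⊆⇒↭ (All.tabulate (λ y∈ x≡y → x∉d (subst (_∈ d) (sym x≡y) y∈)) ∷ d!) u! f g) d<k
          where
          f : x ∷ d ⊆ u
          f (here refl) = p (here refl)
          f (there y∈)  = p (there (d⁻ y∈))
          g : u ⊆ x ∷ d
          g y∈ with q y∈
          ... | here refl = here refl
          ... | there y∈a = there (d⁺ y∈a)

      -- Moments are indexed by sets, colours by tuples; this bridges the two. Repetitions are
      -- removed with `N-contract`, and what remains is a permutation.
      N-set : ∀ {a a′} → length a ≤ k → length a′ ≤ k → a ⊆ a′ → a′ ⊆ a → n a ≡ n a′
      N-set {a} {a′} a≤k a′≤k p q = trans (N-unique a d! (∈-deduplicate⁺ Fin._≟_ ∘ p) (q ∘ ∈-deduplicate⁻ Fin._≟_ a′) a≤k)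
        (sym (N-unique a′ d! (∈-deduplicate⁺ Fin._≟_) (∈-deduplicate⁻ Fin._≟_ a′) a′≤k))
        where d! = DecUnique.deduplicate-! Fin._≟_ a′

  -- Sets of pairs as lists, and the uniform Sherali-Adams solution

  elements : ∀ {n} → Subset n → List (Fin n)
  elements Vec.[]              = []
  elements (inside  Vec.∷ I) = zero ∷ map suc (elements I)
  elements (outside Vec.∷ I) = map suc (elements I)

  ∈-elements⁺ : ∀ {n} {I : Subset n} {x} → x ∈ˢ I → x ∈ elements I
  ∈-elements⁺ {I = inside  Vec.∷ I} Vec.here      = here refl
  ∈-elements⁺ {I = inside  Vec.∷ I} (Vec.there p) = there (∈-map⁺ suc (∈-elements⁺ p))
  ∈-elements⁺ {I = outside Vec.∷ I} (Vec.there p) = ∈-map⁺ suc (∈-elements⁺ p)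

  ∈-elements⁻ : ∀ {n} (I : Subset n) {x} → x ∈ elements I → x ∈ˢ I
  ∈-elements⁻ (inside  Vec.∷ I) (here refl) = Vec.here
  ∈-elements⁻ (inside  Vec.∷ I) (there p) with _ , q , refl ← ∈-map⁻ suc p = Vec.there (∈-elements⁻ I q)
  ∈-elements⁻ (outside Vec.∷ I) p with _ , q , refl ← ∈-map⁻ suc p = Vec.there (∈-elements⁻ I q)

  length-elements : ∀ {n} (I : Subset n) → length (elements I) ≡ ∣ I ∣
  length-elements Vec.[]             = refl
  length-elements (inside  Vec.∷ I) = cong suc (trans (List.length-map suc (elements I)) (length-elements I))
  length-elements (outside Vec.∷ I) = trans (List.length-map suc (elements I)) (length-elements I)

  elements-⊥ : ∀ n → elements (Subset.⊥ {n}) ≡ []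
  elements-⊥ zero    = refl
  elements-⊥ (suc n) = cong (map suc) (elements-⊥ n)

  does-≡⇒⇔ : ∀ {P Q : Set} (d : Dec P) (e : Dec Q) → does d ≡ does e → P ⇔ Q
  does-≡⇒⇔ (yes p) (yes q) _ = mk⇔ (λ _ → q) (λ _ → p)
  does-≡⇒⇔ (no ¬p) (no ¬q) _ = mk⇔ (λ p → ⊥-elim (¬p p)) (λ q → ⊥-elim (¬q q))

  graph : SimpleGraph → SimpleGraph → Bool → SimpleGraph
  graph G H true  = G
  graph G H false = H

  orders : SimpleGraph → SimpleGraph → Bool → ℕ
  orders G H s = order (graph G H s)

  adjacency : ∀ G H s → Fin (orders G H s) → Fin (orders G H s) → Bool
  adjacency G H s x y = does (SimpleGraph.adj? (graph G H s) x y)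

  module _ (G H : SimpleGraph) where

    Pairs : Set
    Pairs = List (V G × V H)

    code : V G × V H → Fin (order G ℕ.* order H)
    code (g , h) = combine g h

    pairs : PairSet G H → Pairs
    pairs I = map (remQuot (order H)) (elements I)

    ∈-pairs⁺ : ∀ {I p} → code p ∈ˢ I → p ∈ pairs I
    ∈-pairs⁺ {I} {g , h} p∈ = subst (_∈ pairs I) (Fin.remQuot-combine g h) (∈-map⁺ (remQuot (order H)) (∈-elements⁺ p∈))

    ∈-pairs⁻ : ∀ {I p} → p ∈ pairs I → code p ∈ˢ I
    ∈-pairs⁻ {I} p∈ with x , x∈ , refl ← ∈-map⁻ (remQuot (order H)) p∈ =
      subst (_∈ˢ I) (sym (Fin.combine-remQuot {order G} (order H) x)) (∈-elements⁻ I x∈)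

    length-pairs : ∀ I → length (pairs I) ≡ ∣ I ∣
    length-pairs I = trans (List.length-map _ (elements I)) (length-elements I)

    pairs-⊥ : pairs Subset.⊥ ≡ []
    pairs-⊥ = cong (map (remQuot (order H))) (elements-⊥ (order G ℕ.* order H))

    pairs-∪-⁅⁆⁺ : ∀ I p → pairs (I ∪ ⁅ code p ⁆) ⊆ p ∷ pairs I
    pairs-∪-⁅⁆⁺ I p {q} q∈ with Subset.x∈p∪q⁻ I ⁅ code p ⁆ (∈-pairs⁻ q∈)
    ... | inj₁ q∈I = there (∈-pairs⁺ q∈I)
    ... | inj₂ q∈p = here (trans (sym (Fin.remQuot-combine (proj₁ q) (proj₂ q)))
      (trans (cong (remQuot (order H)) (Subset.x∈⁅y⁆⇒x≡y (code p) q∈p)) (Fin.remQuot-combine (proj₁ p) (proj₂ p))))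

    pairs-∪-⁅⁆⁻ : ∀ I p → p ∷ pairs I ⊆ pairs (I ∪ ⁅ code p ⁆)
    pairs-∪-⁅⁆⁻ I p (here refl) = ∈-pairs⁺ {I ∪ ⁅ code p ⁆} (Subset.x∈p∪q⁺ {p = I} (inj₂ (Subset.x∈⁅x⁆ (code p))))
    pairs-∪-⁅⁆⁻ I p (there q∈)  = ∈-pairs⁺ {I ∪ ⁅ code p ⁆} (Subset.x∈p∪q⁺ {p = I} (inj₁ (∈-pairs⁻ {I} q∈)))

  ∣∪∣≤ : ∀ {n} (I J : Subset n) → ∣ I ∪ J ∣ ≤ ∣ I ∣ ℕ.+ ∣ J ∣
  ∣∪∣≤ Vec.[] Vec.[] = z≤n
  ∣∪∣≤ (outside Vec.∷ I) (outside Vec.∷ J) = ∣∪∣≤ I J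
  ∣∪∣≤ (outside Vec.∷ I) (inside  Vec.∷ J) = subst (suc ∣ I ∪ J ∣ ≤_) (sym (ℕ.+-suc _ _)) (s≤s (∣∪∣≤ I J))
  ∣∪∣≤ (inside  Vec.∷ I) (outside Vec.∷ J) = s≤s (∣∪∣≤ I J)
  ∣∪∣≤ (inside  Vec.∷ I) (inside  Vec.∷ J) = s≤s (ℕ.≤-trans (∣∪∣≤ I J) (ℕ.+-monoʳ-≤ ∣ I ∣ (ℕ.n≤1+n _)))

  ∣∪⁅⁆∣≤ : ∀ {n} (I : Subset n) x → ∣ I ∪ ⁅ x ⁆ ∣ ≤ suc ∣ I ∣
  ∣∪⁅⁆∣≤ I x = subst (∣ I ∪ ⁅ x ⁆ ∣ ≤_) (trans (cong (∣ I ∣ ℕ.+_) (Subset.∣⁅x⁆∣≡1 x)) (ℕ.+-comm _ 1)) (∣∪∣≤ I ⁅ x ⁆)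

  module Uniform {G H k} (B : BackAndForth (orders G H) (adjacency G H) k) where
    open BackAndForth B
    open Colouring B
    open Weights B

    val : Pairs G H → ℚ
    val l = W (node true l) (node false l)

    c-nodes-⊆ : ∀ {l l′} → length l′ ≤ k → l′ ⊆ l → c (node true l) ≡ c (node false l) → c (node true l′) ≡ c (node false l′)
    c-nodes-⊆ {l} {l′} l′≤k sub eq with ι , refl , ι≡ ← ⊆⇒select l′ sub =
      subst₂ (λ a b → c (true , a) ≡ c (false , b)) (Rearrangement.op-map (selectᴿ ι) proj₁ l) (Rearrangement.op-map (selectᴿ ι) proj₂ l)
        (c-apply (selectᴿ ι) {node true l} {node false l}
          (λ m _ _ → ℕ.≤-trans (length-select ι m) (subst (_≤ k) (sym ι≡) l′≤k)) eq)

    -- Both factors of the weight see only the set of entries: equality of colours passes to any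
    -- selection of positions, and the class size obeys `N-set`.
    val-set : ∀ {l l′} → length l ≤ k → length l′ ≤ k → l ⊆ l′ → l′ ⊆ l → val l ≡ val l′
    val-set {l} {l′} l≤k l′≤k p q = cong₂ ℚ._*_
      (𝟙-cong (_ ≟ᴺ _) (_ ≟ᴺ _) (c-nodes-⊆ l′≤k q) (c-nodes-⊆ l≤k p))
      (cong recip (N-set true true (subst (_≤ k) (sym (List.length-map proj₁ l)) l≤k) (subst (_≤ k) (sym (List.length-map proj₁ l′)) l′≤k)
        (Subsetᴸ.map⁺ proj₁ p) (Subsetᴸ.map⁺ proj₁ q)))

    val-[] : val [] ≡ 1ℚ
    val-[] = trans (W-≡ {true , []} {false , []} (c-edge [] z≤n S-[])) (cong recip N≡1)
      where
      N≡1 : N true (true , []) ≡ 1ℚ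
      N≡1 = trans (ℚ.+-identityʳ _) (𝟙-yes (c (true , []) ≟ᴺ c (true , [])) refl)

    ∑-valʰ : ∀ {l} g → length l < k → ∑ (allFin (order H)) (λ h → val ((g , h) ∷ l)) ≡ val l
    ∑-valʰ {l} g l<k = ∑-W (subst (_< k) (sym (List.length-map proj₁ l)) l<k)

    ∑-valᵍ : ∀ {l} h → length l < k → ∑ (allFin (order G)) (λ g → val ((g , h) ∷ l)) ≡ val l
    ∑-valᵍ {l} h l<k = trans (∑-cong (allFin (order G)) (λ g → W-sym (node true ((g , h) ∷ l)) (node false ((g , h) ∷ l))))
      (trans (∑-W (subst (_< k) (sym (List.length-map proj₂ l)) l<k)) (W-sym (node false l) (node true l)))

    y : PairSet G H → ℚ
    y I = val (pairs G H I)

    pairs≤k : ∀ I → ∣ I ∣ ≤ k → length (pairs G H I) ≤ k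
    pairs≤k I = subst (_≤ k) (sym (length-pairs G H I))

    y-∪-⁅⁆ : ∀ I p → ∣ I ∣ < k → y (I ∪ ⁅ code G H p ⁆) ≡ val (p ∷ pairs G H I)
    y-∪-⁅⁆ I p I<k = val-set (pairs≤k (I ∪ ⁅ code G H p ⁆) (ℕ.≤-trans (∣∪⁅⁆∣≤ I _) I<k))
      (subst (_< k) (sym (length-pairs G H I)) I<k) (pairs-∪-⁅⁆⁺ G H I p) (pairs-∪-⁅⁆⁻ G H I p)

    ∑-yʰ : ∀ I → ∣ I ∣ < k → ∀ (g : Fin (order G)) → sumℚ (λ (h : Fin (order H)) → y (I ∪ ⁅ combine g h ⁆)) ≡ y I
    ∑-yʰ I I<k g = trans (sum≡∑ {order H} _) (trans (∑-cong (allFin (order H)) (λ h → y-∪-⁅⁆ I (g , h) I<k))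
      (∑-valʰ g (subst (_< k) (sym (length-pairs G H I)) I<k)))

    ∑-yᵍ : ∀ I → ∣ I ∣ < k → ∀ (h : Fin (order H)) → sumℚ (λ (g : Fin (order G)) → y (I ∪ ⁅ combine g h ⁆)) ≡ y I
    ∑-yᵍ I I<k h = trans (sum≡∑ {order G} _) (trans (∑-cong (allFin (order G)) (λ g → y-∪-⁅⁆ I (g , h) I<k))
      (∑-valᵍ h (subst (_< k) (sym (length-pairs G H I)) I<k)))

    -- Equally coloured tuples have the same equality and adjacency matrices, so matching colours
    -- already certify a partial isomorphism.
    y-vanish : ∀ I → ¬ PartialIsomorphism G H I → y I ≡ 0ℚ
    y-vanish I ¬PI = W-≢ {node true (pairs G H I)} {node false (pairs G H I)} λ eq → ¬PI λ g g′ h h′ p q →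
      does-≡⇒⇔ (g Fin.≟ g′) (h Fin.≟ h′) (c-node-T T-≡ S-≡ eq (∈-pairs⁺ G H p) (∈-pairs⁺ G H q)) ,
      does-≡⇒⇔ (SimpleGraph.adj? G g g′) (SimpleGraph.adj? H h h′)
        (c-node-T (adjacency G H) S-E eq (∈-pairs⁺ G H p) (∈-pairs⁺ G H q))

    y-⊥ : y Subset.⊥ ≡ 1ℚ
    y-⊥ = trans (cong val (pairs-⊥ G H)) val-[]

    isSheraliAdams : 1 ≤ k → IsSheraliAdamsSolution k G H y
    isSheraliAdams 1≤k = record
      { nonNegative = λ I _ → W-nonNegative _ _
      ; sumH        = λ I I≤ → ∑-yʰ I (<k I≤)
      ; sumG        = λ I I≤ → ∑-yᵍ I (<k I≤)
      ; vanish      = λ I _ → y-vanish I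
      ; empty       = y-⊥
      }
      where
      <k : ∀ {m} → m ≤ k ℕ.∸ 1 → m < k
      <k {m} m≤ = subst (m <_) (ℕ.m+[n∸m]≡n 1≤k) (s≤s m≤)

-- Positivity of the uniform moment matrix

module _ where
  open ListSum ℚ.+-*-commutativeRing
  open import Data.Fin.Subset using (∣_∣)
  open import Data.Rational using (_+_; _*_; -_; _-_)
  open +-*-Solver using (solve; _:=_; _:+_; _:*_; :-_; _:-_; con)

  ∑-allFin-suc : ∀ n (f : Fin (suc n) → ℚ) → ∑ (allFin (suc n)) f ≡ f zero + ∑ (allFin n) (f ∘ suc)
  ∑-allFin-suc n f = cong (f zero +_) (trans (∑-tabulate {n = n} suc f) (sum≡∑ {n} (f ∘ suc)))

  Kernel : ℕ → Set
  Kernel n = Fin n → Fin n → ℚ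

  infixr 8 _·_

  _·_ : ∀ {n} → Kernel n → (Fin n → ℚ) → Fin n → ℚ
  _·_ {n} z u i = ∑ (allFin n) (λ j → z i j * u j)

  ⟨_,_⟩ : ∀ {n} → (Fin n → ℚ) → (Fin n → ℚ) → ℚ
  ⟨_,_⟩ {n} u v = ∑ (allFin n) (λ i → u i * v i)

  -- For a positive semidefinite kernel this is definiteness. It is phrased without the order
  -- because elimination needs only that no pivot vanishes.
  Anisotropic : ∀ {n} → Kernel n → Set
  Anisotropic {n} z = ∀ u → ⟨ u , z · u ⟩ ≡ 0ℚ → ∀ i → u i ≡ 0ℚ

  -- Elimination of the first unknown: the Schur complement is again anisotropic.
  anisotropic⇒solvable : ∀ {n} (z : Kernel n) → Anisotropic z →
                           ∀ (b : Fin n → ℚ) → ∃ λ (w : Fin n → ℚ) → ∀ i → (z · w) i ≡ b i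
  anisotropic⇒solvable {zero}  z an b = (λ ()) , λ ()
  anisotropic⇒solvable {suc n} z an b = w , solved
    where
    open ≡-Reasoning

    α r : ℚ
    α = z zero zero
    r = recip α

    cons : ℚ → (Fin n → ℚ) → Fin (suc n) → ℚ
    cons q v zero    = q
    cons q v (suc i) = v i

    ·-cons : ∀ q v i → (z · cons q v) i ≡ z i zero * q + ∑ (allFin n) (λ j → z i (suc j) * v j)
    ·-cons q v i = ∑-allFin-suc n (λ j → z i j * cons q v j)

    α≢0 : α ≢ 0ℚ
    -- The first unit vector has `α` as its value under the form, so a zero pivot would be
    -- isotropic.
    α≢0 α≡0 with () ← an (cons 1ℚ (λ _ → 0ℚ)) (trans (∑-allFin-suc n (λ i → cons 1ℚ (λ _ → 0ℚ) i * (z · cons 1ℚ (λ _ → 0ℚ)) i)) (cong₂ _+_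
        (trans (ℚ.*-identityˡ _) (trans (·-cons 1ℚ (λ _ → 0ℚ) zero) (cong₂ _+_ (trans (ℚ.*-identityʳ α) α≡0)
          (∑-zero (allFin n) (λ {j} _ → ℚ.*-zeroʳ (z zero (suc j)))))))
        (∑-zero (allFin n) (λ {i} _ → ℚ.*-zeroˡ ((z · cons 1ℚ (λ _ → 0ℚ)) (suc i)))))) zero

    αr : α * r ≡ 1ℚ
    αr = *-recip α≢0

    z′ : Kernel n
    z′ i j = z (suc i) (suc j) - z (suc i) zero * r * z zero (suc j)

    row : (Fin n → ℚ) → ℚ
    row v = ∑ (allFin n) (λ j → z zero (suc j) * v j)

    z′· : ∀ v i → (z′ · v) i ≡ ∑ (allFin n) (λ j → z (suc i) (suc j) * v j) - z (suc i) zero * r * row v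
    z′· v i = begin
      ∑ (allFin n) (λ j → z′ i j * v j)
        ≡⟨ ∑-cong (allFin n) (λ j → expand (z (suc i) (suc j)) k (z zero (suc j)) (v j)) ⟩
      ∑ (allFin n) (λ j → z (suc i) (suc j) * v j + (- k) * (z zero (suc j) * v j))
        ≡⟨ ∑-distrib-+ (allFin n) _ _ ⟩
      s + ∑ (allFin n) (λ j → (- k) * (z zero (suc j) * v j))
        ≡⟨ cong (s +_) (*-distribˡ-∑ (allFin n) (- k) _) ⟨
      s + (- k) * row v
        ≡⟨ collect s k (row v) ⟩
      s - k * row v
        ∎
      where
      k = z (suc i) zero * r
      s = ∑ (allFin n) (λ j → z (suc i) (suc j) * v j)
      expand : ∀ a k b c → (a - k * b) * c ≡ a * c + (- k) * (b * c)
      expand = solve 4 (λ a k b c → (a :- k :* b) :* c := a :* c :+ (:- k) :* (b :* c)) refl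
      collect : ∀ s k q → s + (- k) * q ≡ s - k * q
      collect = solve 3 (λ s k q → s :+ (:- k) :* q := s :- k :* q) refl

    an′ : Anisotropic z′
    an′ v h i = an u Qu≡0 (suc i)
      where
      -- The new first coordinate is chosen to annihilate the first row of `z`; the form of `z` at
      -- `u` then equals that of the Schur complement at `v`.
      u : Fin (suc n) → ℚ
      u = cons (- (r * row v)) v
      zu₀ : (z · u) zero ≡ 0ℚ
      zu₀ = trans (·-cons _ v zero) (trans (factor α r (row v)) (trans (cong (λ q → (1ℚ - q) * row v) αr) (ℚ.*-zeroˡ (row v))))
        where
        factor : ∀ a r q → a * - (r * q) + q ≡ (1ℚ - a * r) * q
        factor = solve 3 (λ a r q → a :* :- (r :* q) :+ q := (con 1ℚ :- a :* r) :* q) refl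
      zuₛ : ∀ i → (z · u) (suc i) ≡ (z′ · v) i
      zuₛ i = trans (·-cons _ v (suc i)) (trans (regroup (z (suc i) zero) r (row v) _) (sym (z′· v i)))
        where
        regroup : ∀ a r q s → a * - (r * q) + s ≡ s - a * r * q
        regroup = solve 4 (λ a r q s → a :* :- (r :* q) :+ s := s :- a :* r :* q) refl
      Qu≡0 : ⟨ u , z · u ⟩ ≡ 0ℚ
      Qu≡0 = trans (∑-allFin-suc n (λ i → u i * (z · u) i)) (cong₂ _+_
        (trans (cong (u zero *_) zu₀) (ℚ.*-zeroʳ (u zero)))
        (trans (∑-cong (allFin n) (λ i → cong (v i *_) (zuₛ i))) h))

    IH : ∃ λ (w : Fin n → ℚ) → ∀ i → (z′ · w) i ≡ b (suc i) - z (suc i) zero * r * b zero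
    IH = anisotropic⇒solvable z′ an′ _

    w : Fin (suc n) → ℚ
    w = cons (r * (b zero - row (proj₁ IH))) (proj₁ IH)

    solved : ∀ i → (z · w) i ≡ b i
    solved zero = trans (·-cons _ _ zero) (trans (factor α r (b zero) (row (proj₁ IH)))
      (trans (cong (λ q → q * (b zero - row (proj₁ IH)) + row (proj₁ IH)) αr) (cancel (b zero) (row (proj₁ IH)))))
      where
      factor : ∀ a r b q → a * (r * (b - q)) + q ≡ a * r * (b - q) + q
      factor = solve 4 (λ a r b q → a :* (r :* (b :- q)) :+ q := a :* r :* (b :- q) :+ q) refl
      cancel : ∀ b q → 1ℚ * (b - q) + q ≡ b
      cancel = solve 2 (λ b q → con 1ℚ :* (b :- q) :+ q := b) refl
    solved (suc i) = begin
      (z · w) (suc i)                    ≡⟨ ·-cons _ _ (suc i) ⟩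
      a * (r * (b zero - q)) + s         ≡⟨ regroup a r (b zero) q s ⟩
      a * r * b zero + (s - a * r * q)   ≡⟨ cong (a * r * b zero +_) (trans (sym (z′· (proj₁ IH) i)) (proj₂ IH i)) ⟩
      a * r * b zero + (b (suc i) - a * r * b zero)  ≡⟨ cancel (a * r * b zero) (b (suc i)) ⟩
      b (suc i)                          ∎
      where
      a = z (suc i) zero
      q = row (proj₁ IH)
      s = ∑ (allFin n) (λ j → z (suc i) (suc j) * proj₁ IH j)
      regroup : ∀ a r b q s → a * (r * (b - q)) + s ≡ a * r * b + (s - a * r * q)
      regroup = solve 5 (λ a r b q s → a :* (r :* (b :- q)) :+ s := a :* r :* b :+ (s :- a :* r :* q)) refl
      cancel : ∀ p q → p + (q - p) ≡ q
      cancel = solve 2 (λ p q → p :+ (q :- p) := q) refl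

  module _ {n : ℕ} where

    ⟨⟩-cong : ∀ {u u′ v v′ : Fin n → ℚ} → (∀ i → u i ≡ u′ i) → (∀ i → v i ≡ v′ i) → ⟨ u , v ⟩ ≡ ⟨ u′ , v′ ⟩
    ⟨⟩-cong p q = ∑-cong (allFin n) (λ i → cong₂ _*_ (p i) (q i))

    ⟨⟩-comm : ∀ (u v : Fin n → ℚ) → ⟨ u , v ⟩ ≡ ⟨ v , u ⟩
    ⟨⟩-comm u v = ∑-cong (allFin n) (λ i → ℚ.*-comm (u i) (v i))

    ·-cong : ∀ (z : Kernel n) {u v} → (∀ i → u i ≡ v i) → ∀ i → (z · u) i ≡ (z · v) i
    ·-cong z p i = ∑-cong (allFin n) (λ j → cong (z i j *_) (p j))

    ·-selfAdjoint : ∀ (z : Kernel n) → (∀ i j → z i j ≡ z j i) → ∀ u v → ⟨ u , z · v ⟩ ≡ ⟨ z · u , v ⟩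
    ·-selfAdjoint z z-sym u v = begin
      ∑ (allFin n) (λ i → u i * ∑ (allFin n) (λ j → z i j * v j))    ≡⟨ ∑-cong (allFin n) (λ i → *-distribˡ-∑ (allFin n) (u i) _) ⟩
      ∑ (allFin n) (λ i → ∑ (allFin n) (λ j → u i * (z i j * v j)))  ≡⟨ ∑-swap (allFin n) (allFin n) _ ⟩
      ∑ (allFin n) (λ j → ∑ (allFin n) (λ i → u i * (z i j * v j)))  ≡⟨ ∑-cong (allFin n) (λ j → ∑-cong (allFin n) (λ i →
        trans (shuffle (u i) (z i j) (v j)) (cong (λ q → q * u i * v j) (z-sym i j)))) ⟩
      ∑ (allFin n) (λ j → ∑ (allFin n) (λ i → z j i * u i * v j))    ≡⟨ ∑-cong (allFin n) (λ j → *-distribʳ-∑ (allFin n) (v j) _) ⟨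
      ⟨ z · u , v ⟩                                                  ∎
      where
      open ≡-Reasoning
      shuffle : ∀ a b c → a * (b * c) ≡ b * a * c
      shuffle = solve 3 (λ a b c → a :* (b :* c) := b :* a :* c) refl

    ·-· : ∀ (z k : Kernel n) u i → (z · (k · u)) i ≡ ∑ (allFin n) (λ l → ∑ (allFin n) (λ j → z i j * k j l) * u l)
    ·-· z k u i = begin
      ∑ (allFin n) (λ j → z i j * ∑ (allFin n) (λ l → k j l * u l))    ≡⟨ ∑-cong (allFin n) (λ j → *-distribˡ-∑ (allFin n) (z i j) _) ⟩
      ∑ (allFin n) (λ j → ∑ (allFin n) (λ l → z i j * (k j l * u l)))  ≡⟨ ∑-swap (allFin n) (allFin n) _ ⟩
      ∑ (allFin n) (λ l → ∑ (allFin n) (λ j → z i j * (k j l * u l)))  ≡⟨ ∑-cong (allFin n) (λ l → trans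
        (∑-cong (allFin n) (λ j → sym (ℚ.*-assoc (z i j) (k j l) (u l)))) (sym (*-distribʳ-∑ (allFin n) (u l) _))) ⟩
      ∑ (allFin n) (λ l → ∑ (allFin n) (λ j → z i j * k j l) * u l)    ∎
      where open ≡-Reasoning

    -- Writing u = z · w, self-adjointness and zk = k² turn ⟨ u , k u ⟩ into ⟨ k w , z (k w) ⟩.
    absorbing⇒positive : ∀ (z k : Kernel n) → (∀ i j → z i j ≡ z j i) → (∀ i j → k i j ≡ k j i) →
      Anisotropic z → (∀ u → 0ℚ ℚ.≤ ⟨ u , z · u ⟩) →
      (∀ i l → ∑ (allFin n) (λ j → z i j * k j l) ≡ ∑ (allFin n) (λ j → k i j * k j l)) →
      ∀ u → 0ℚ ℚ.≤ ⟨ u , k · u ⟩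
    absorbing⇒positive z k z-sym k-sym an z≥0 zk≡kk u with w , zw≡u ← anisotropic⇒solvable z an u =
      subst (0ℚ ℚ.≤_) (sym eq) (z≥0 (k · w))
      where
      open ≡-Reasoning
      absorb : ∀ v i → (z · k · v) i ≡ (k · k · v) i
      absorb v i = trans (·-· z k v i) (trans (∑-cong (allFin n) (λ l → cong (_* v l) (zk≡kk i l))) (sym (·-· k k v i)))
      eq : ⟨ u , k · u ⟩ ≡ ⟨ k · w , z · k · w ⟩
      eq = begin
        ⟨ u , k · u ⟩                  ≡⟨ ⟨⟩-cong (sym ∘ zw≡u) (·-cong k (sym ∘ zw≡u)) ⟩
        ⟨ z · w , k · z · w ⟩          ≡⟨ ·-selfAdjoint z z-sym w (k · z · w) ⟨
        ⟨ w , z · k · z · w ⟩          ≡⟨ ⟨⟩-cong {u = w} (λ _ → refl) (absorb (z · w)) ⟩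
        ⟨ w , k · k · z · w ⟩          ≡⟨ trans (·-selfAdjoint k k-sym w (k · z · w)) (·-selfAdjoint k k-sym (k · w) (z · w)) ⟩
        ⟨ k · k · w , z · w ⟩          ≡⟨ ·-selfAdjoint z z-sym (k · k · w) w ⟩
        ⟨ z · k · k · w , w ⟩          ≡⟨ ⟨⟩-cong {v = w} (absorb (k · w)) (λ _ → refl) ⟩
        ⟨ k · k · k · w , w ⟩          ≡⟨ ·-selfAdjoint k k-sym (k · k · w) w ⟨
        ⟨ k · k · w , k · w ⟩          ≡⟨ ⟨⟩-cong {v = k · w} (sym ∘ absorb w) (λ _ → refl) ⟩
        ⟨ z · k · w , k · w ⟩          ≡⟨ ⟨⟩-comm (z · k · w) (k · w) ⟩
        ⟨ k · w , z · k · w ⟩          ∎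

  0≤q*q : ∀ q → 0ℚ ℚ.≤ q * q
  0≤q*q q with ℚ.≤-total 0ℚ q
  ... | inj₁ 0≤q = subst (ℚ._≤ q * q) (ℚ.*-zeroʳ q) (ℚ.*-monoˡ-≤-nonNeg q {{ℚ.nonNegative 0≤q}} 0≤q)
  ... | inj₂ q≤0 = subst (ℚ._≤ q * q) (ℚ.*-zeroʳ q) (ℚ.*-monoˡ-≤-nonPos q {{ℚ.nonPositive q≤0}} q≤0)

  q*q≡0⇒q≡0 : ∀ q → q * q ≡ 0ℚ → q ≡ 0ℚ
  q*q≡0⇒q≡0 q qq≡0 with q ℚ.≟ 0ℚ
  ... | yes q≡0 = q≡0
  ... | no q≢0 = trans (sym (ℚ.*-identityʳ q)) (trans (cong (q *_) (sym (*-recip q≢0)))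
    (trans (sym (ℚ.*-assoc q q (recip q))) (trans (cong (_* recip q) qq≡0) (ℚ.*-zeroˡ (recip q)))))

  module Gram {R : Set} {n : ℕ} (rs : List R) (ρ : R → Fin n → ℚ) (z : Kernel n)
              (z≡ : ∀ i j → z i j ≡ ∑ rs (λ r → ρ r i * ρ r j)) where

    gram-sym : ∀ i j → z i j ≡ z j i
    gram-sym i j = trans (z≡ i j) (trans (∑-cong rs (λ r → ℚ.*-comm (ρ r i) (ρ r j))) (sym (z≡ j i)))

    gram-squares : ∀ u → ⟨ u , z · u ⟩ ≡ ∑ rs (λ r → ⟨ ρ r , u ⟩ * ⟨ ρ r , u ⟩)
    gram-squares u = begin
      ∑ is (λ i → u i * ∑ is (λ j → z i j * u j))
        ≡⟨ ∑-cong is (λ i → *-distribˡ-∑ is (u i) _) ⟩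
      ∑ is (λ i → ∑ is (λ j → u i * (z i j * u j)))
        ≡⟨ ∑-cong is (λ i → ∑-cong is (λ j → trans (cong (λ q → u i * (q * u j)) (z≡ i j))
             (trans (middle (u i) _ (u j)) (*-distribˡ-∑ rs (u i * u j) _)))) ⟩
      ∑ is (λ i → ∑ is (λ j → ∑ rs (λ r → u i * u j * (ρ r i * ρ r j))))
        ≡⟨ ∑-cong is (λ i → ∑-swap is rs _) ⟩
      ∑ is (λ i → ∑ rs (λ r → ∑ is (λ j → u i * u j * (ρ r i * ρ r j))))
        ≡⟨ ∑-swap is rs _ ⟩
      ∑ rs (λ r → ∑ is (λ i → ∑ is (λ j → u i * u j * (ρ r i * ρ r j))))
        ≡⟨ ∑-cong rs (λ r → trans (∑-cong is (λ i → ∑-cong is (λ j → pair (u i) (u j) (ρ r i) (ρ r j))))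
             (sym (∑-*-∑ is is _ _))) ⟩
      ∑ rs (λ r → ⟨ ρ r , u ⟩ * ⟨ ρ r , u ⟩)
        ∎
      where
      open ≡-Reasoning
      is = allFin n
      middle : ∀ a q b → a * (q * b) ≡ a * b * q
      middle = solve 3 (λ a q b → a :* (q :* b) := a :* b :* q) refl
      pair : ∀ a b c d → a * b * (c * d) ≡ c * a * (d * b)
      pair = solve 4 (λ a b c d → a :* b :* (c :* d) := c :* a :* (d :* b)) refl

    gram-nonNegative : ∀ u → 0ℚ ℚ.≤ ⟨ u , z · u ⟩
    gram-nonNegative u = subst (0ℚ ℚ.≤_) (sym (gram-squares u)) (∑-nonNegative rs (λ {r} _ → 0≤q*q ⟨ ρ r , u ⟩))

    -- A sum of rational squares that vanishes has only zero terms.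
    gram-isotropic : ∀ u → ⟨ u , z · u ⟩ ≡ 0ℚ → ∀ {r} → r ∈ rs → ⟨ ρ r , u ⟩ ≡ 0ℚ
    gram-isotropic u h {r} r∈ = q*q≡0⇒q≡0 ⟨ ρ r , u ⟩ (ℚ.≤-antisym
      (subst (⟨ ρ r , u ⟩ * ⟨ ρ r , u ⟩ ℚ.≤_) (trans (sym (gram-squares u)) h) (≤-∑ (λ {s} _ → 0≤q*q ⟨ ρ s , u ⟩) r∈))
      (0≤q*q ⟨ ρ r , u ⟩))

  lookup-injective : ∀ {A : Set} {xs : List A} → Unique xs → ∀ i j → lookup xs i ≡ lookup xs j → i ≡ j
  lookup-injective {xs = x ∷ xs} (x∉ ∷ u) zero    zero    eq = refl
  lookup-injective {xs = x ∷ xs} (x∉ ∷ u) zero    (suc j) eq = ⊥-elim (All.lookup x∉ (∈-lookup j) eq)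
  lookup-injective {xs = x ∷ xs} (x∉ ∷ u) (suc i) zero    eq = ⊥-elim (All.lookup x∉ (∈-lookup i) (sym eq))
  lookup-injective {xs = x ∷ xs} (x∉ ∷ u) (suc i) (suc j) eq = cong suc (lookup-injective u i j eq)

  ∑-lookup : ∀ {A : Set} (xs : List A) (f : A → ℚ) → ∑ (allFin (length xs)) (f ∘ lookup xs) ≡ ∑ xs f
  ∑-lookup xs f = trans (∑-tabulate {n = length xs} id (f ∘ lookup xs))
    (trans (sym (∑-tabulate (lookup xs) f)) (cong (λ xs → ∑ xs f) (List.tabulate-lookup xs)))

  take-length-++ : ∀ {A : Set} {r} (u l : List A) → length u ≡ r → take r (u ++ l) ≡ u
  take-length-++ []      l refl = refl
  take-length-++ (x ∷ u) l refl = cong (x ∷_) (take-length-++ u l refl)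

  drop-length-++ : ∀ {A : Set} {r} (u l : List A) → length u ≡ r → drop r (u ++ l) ≡ l
  drop-length-++ []      l refl = refl
  drop-length-++ (x ∷ u) l refl = drop-length-++ u l refl

  length-++-≡ : ∀ {A : Set} {m n} (u v : List A) → length u ≡ m → length v ≡ n → length (u ++ v) ≡ m ℕ.+ n
  length-++-≡ u v p q = trans (List.length-++ u) (cong₂ ℕ._+_ p q)

  -- Coherence and positivity for colours of pairs of tuples

  module TupleKernel {ord E k} (B : BackAndForth ord E k) (r : ℕ) (3r≤k : r ℕ.+ (r ℕ.+ r) ≤ k) where
    open BackAndForth B
    open Colouring B
    open Weights B
    open Rearrangement using (op)

    2r≤k : r ℕ.+ r ≤ k
    2r≤k = ℕ.≤-trans (ℕ.m≤n+m (r ℕ.+ r) r) 3r≤k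

    T : ∀ s → List (List (Verts s))
    T s = tuples (ord s) r

    T² : ∀ s → List (List (Verts s))
    T² s = tuples (ord s) (r ℕ.+ r)

    N≢0 : ∀ u → len u ≡ r ℕ.+ r → N true u ≢ 0ℚ
    N≢0 u p = N-nonZero {u} (subst (_≤ k) (sym p) 2r≤k)

    -- On each class `W` is an all-ones block divided by its size, hence a projection. This later
    -- factors `Z` without taking a root.
    ∑-W-W : ∀ u v → len u ≡ r ℕ.+ r → ∑ (T² true) (λ w → W u (true , w) * W v (true , w)) ≡ W u v
    ∑-W-W u v u≡ with c u ≟ᴺ c v
    ... | no ¬p = trans (∑-zero (T² true) (λ {w} _ → term w)) (sym (ℚ.*-zeroˡ (recip (N true u))))
      where
      term : ∀ w → W u (true , w) * W v (true , w) ≡ 0ℚ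
      term w with c u ≟ᴺ c (true , w)
      ... | no _  = trans (cong (_* W v (true , w)) (ℚ.*-zeroˡ (recip (N true u)))) (ℚ.*-zeroˡ (W v (true , w)))
      ... | yes q = trans (cong (1ℚ * recip (N true u) *_) (W-≢ {v} {true , w} (λ p → ¬p (trans q (sym p)))))
                          (ℚ.*-zeroʳ (1ℚ * recip (N true u)))
    ... | yes p = begin
      ∑ (T² true) (λ w → W u (true , w) * W v (true , w))
        ≡⟨ ∑-cong (T² true) term ⟩
      ∑ (T² true) (λ w → class u (true , w) * (ω * ω))
        ≡⟨ *-distribʳ-∑ (T² true) (ω * ω) _ ⟨
      ∑ (T² true) (λ w → class u (true , w)) * (ω * ω)
        ≡⟨ cong (λ m → ∑ (tuples (ord true) m) (λ w → class u (true , w)) * (ω * ω)) (sym u≡) ⟩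
      N true u * (ω * ω)
        ≡⟨ ℚ.*-assoc (N true u) ω ω ⟨
      N true u * ω * ω
        ≡⟨ cong (_* ω) (*-recip (N≢0 u u≡)) ⟩
      1ℚ * ω
        ∎
      where
      open ≡-Reasoning
      ω = recip (N true u)
      term : ∀ w → W u (true , w) * W v (true , w) ≡ class u (true , w) * (ω * ω)
      term w with c (true , w) ≟ᴺ c u
      ... | yes q = trans (cong₂ _*_ (W-≡ {u} (sym q)) (trans (W-≡ {v} {true , w} (sym (trans q p))) (cong recip (N-cong true {v} {u} (sym p)))))
                          (sym (ℚ.*-identityˡ (ω * ω)))
      ... | no ¬q = trans (cong (_* W v (true , w)) (W-≢ {u} {true , w} (¬q ∘ sym)))
                          (trans (ℚ.*-zeroˡ (W v (true , w))) (sym (ℚ.*-zeroˡ (ω * ω))))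

    c-++-swap : ∀ {s s′} u u′ {v v′} → length u ≡ length u′ →
                c (s , u ++ v) ≡ c (s′ , u′ ++ v′) → c (s , v ++ u) ≡ c (s′ , v′ ++ u′)
    c-++-swap {s} {s′} u u′ {v} {v′} p eq = subst₂ (λ a b → c (s , a) ≡ c (s′ , b))
      (cong₂ _++_ (drop-length-++ u v p) (take-length-++ u v p))
      (cong₂ _++_ (drop-length-++ u′ v′ refl) (take-length-++ u′ v′ refl))
      (c-apply (dropᴿ n ++ᴿ takeᴿ n) {s , u ++ v} {s′ , u′ ++ v′}
        (λ l _ l≤k → subst (_≤ k) (sym (trans (List.length-++-comm (drop n l) (take n l)) (cong length (List.take++drop≡id n l)))) l≤k) eq)
      where n = length u′

    W-++-swap : ∀ {s s′} u u′ v v′ → length u ≡ length u′ → length v ≡ length v′ → length (u ++ v) ≤ k →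
                W (s , u ++ v) (s′ , u′ ++ v′) ≡ W (s , v ++ u) (s′ , v′ ++ u′)
    W-++-swap {s} {s′} u u′ v v′ p q uv≤k = cong₂ _*_
      (𝟙-cong (_ ≟ᴺ _) (_ ≟ᴺ _) (c-++-swap u u′ p) (c-++-swap v v′ q))
      (cong recip (N-↭ true s (Perm.++-comm u v) uv≤k))

    -- Entry by entry this is `c-∷-injective`: the rest of the prefix is dropped by a rearrangement,
    -- so that the head stands directly before `a`.
    c-++-injective : ∀ {s} (u v a : List (Verts s)) → length u ≡ length v → v ⊆ a → length v ℕ.+ length a ≤ k →
                     c (s , u ++ a) ≡ c (s , v ++ a) → u ≡ v
    c-++-injective []      []      a _ _ _ _ = refl
    c-++-injective {s} (x ∷ u) (y ∷ v) a p sub bound eq = cong₂ _∷_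
      (c-∷-injective (sub (here refl)) (subst₂ (λ b b′ → c (s , x ∷ b) ≡ c (s , y ∷ b′))
        (drop-length-++ u a (ℕ.suc-injective p)) (drop-length-++ v a refl)
        (c-apply (takeᴿ 1 ++ᴿ dropᴿ (suc (length v))) {s , x ∷ u ++ a} {s , y ∷ v ++ a} shorter eq)))
      (c-++-injective u v a (ℕ.suc-injective p) (sub ∘ there) (ℕ.<⇒≤ bound) (c-tail eq))
      where
      shorter : ∀ (l : List Pair) → length l ≡ suc (length (u ++ a)) → length l ≤ k → length (take 1 l ++ drop (suc (length v)) l) ≤ k
      shorter (q ∷ l) _ l≤k = ℕ.≤-trans (s≤s (subst (_≤ length l) (sym (List.length-drop (length v) l)) (ℕ.m∸n≤m (length l) (length v)))) l≤k

    -- For invariant `ψ`, the sum over the first block depends only on the colour of the remaining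
    -- two, so it is constant over the class of `e`.
    Fubini : ∀ s ψ e → len e ≡ r ℕ.+ r → Invariant (r ℕ.+ (r ℕ.+ r)) ψ →
             ∑ (T s) (λ u → ∑ (T² s) (λ v → ψ (s , u ++ v) * class e (s , v))) ≡ N s e * Σexts ψ r e
    Fubini s ψ e e≡ inv = begin
      ∑ (T s) (λ u → ∑ (T² s) (λ v → ψ (s , u ++ v) * class e (s , v)))
        ≡⟨ ∑-swap (T s) (T² s) _ ⟩
      ∑ (T² s) (λ v → ∑ (T s) (λ u → ψ (s , u ++ v) * class e (s , v)))
        ≡⟨ ∑-cong∈ (T² s) (λ {v} v∈ → trans (sym (*-distribʳ-∑ (T s) (class e (s , v)) _)) (term v (length-tuples (ord s) (r ℕ.+ r) v∈))) ⟩
      ∑ (T² s) (λ v → class e (s , v) * Σexts ψ r e)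
        ≡⟨ *-distribʳ-∑ (T² s) (Σexts ψ r e) _ ⟨
      ∑ (T² s) (λ v → class e (s , v)) * Σexts ψ r e
        ≡⟨ cong (λ m → ∑ (tuples (ord s) m) (λ v → class e (s , v)) * Σexts ψ r e) (sym e≡) ⟩
      N s e * Σexts ψ r e
        ∎
      where
      open ≡-Reasoning
      term : ∀ v → length v ≡ r ℕ.+ r → Σexts ψ r (s , v) * class e (s , v) ≡ class e (s , v) * Σexts ψ r e
      term v v≡ with c (s , v) ≟ᴺ c e
      ... | yes p = trans (ℚ.*-comm (Σexts ψ r (s , v)) 1ℚ) (cong (1ℚ *_) (Σexts-invariant ψ r 3r≤k inv v≡ p))
      ... | no _  = trans (ℚ.*-zeroʳ (Σexts ψ r (s , v))) (sym (ℚ.*-zeroˡ (Σexts ψ r e)))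

    ρ₁ ρ₂ ρ₂₃ : Rearrangement
    ρ₁  = takeᴿ r
    ρ₂  = takeᴿ r ∘ᴿ dropᴿ r
    ρ₂₃ = dropᴿ r

    ρ₃ : Rearrangement
    ρ₃ = dropᴿ r ∘ᴿ dropᴿ r

    module _ {A : Set} (u₁ u₂ u₃ : List A) (p : length u₁ ≡ r) (q : length u₂ ≡ r) where
      op₁ : op ρ₁ (u₁ ++ u₂ ++ u₃) ≡ u₁
      op₁ = take-length-++ u₁ (u₂ ++ u₃) p
      op₂₃ : op ρ₂₃ (u₁ ++ u₂ ++ u₃) ≡ u₂ ++ u₃
      op₂₃ = drop-length-++ u₁ (u₂ ++ u₃) p
      op₂ : op ρ₂ (u₁ ++ u₂ ++ u₃) ≡ u₂
      op₂ = trans (cong (take r) op₂₃) (take-length-++ u₂ u₃ q)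
      op₃ : op ρ₃ (u₁ ++ u₂ ++ u₃) ≡ u₃
      op₃ = trans (cong (drop r) op₂₃) (drop-length-++ u₂ u₃ q)

    length-ρ₁ : ∀ {A : Set} (l : List A) → length (take r l) ≤ r
    length-ρ₁ l = subst (_≤ r) (sym (List.length-take r l)) (ℕ.m⊓n≤m r (length l))

    length-ρ₃ : ∀ {A : Set} (l : List A) → length l ≡ r ℕ.+ (r ℕ.+ r) → length (drop r (drop r l)) ≤ r
    length-ρ₃ l p = ℕ.≤-reflexive (trans (List.length-drop r (drop r l)) (trans (cong (ℕ._∸ r) (trans (List.length-drop r l)
      (trans (cong (ℕ._∸ r) p) (ℕ.m+n∸m≡n r (r ℕ.+ r))))) (ℕ.m+n∸m≡n r r)))

    class-invariant : ∀ d ρ → (∀ (l : List Pair) → length l ≡ r ℕ.+ (r ℕ.+ r) → length (op ρ l) ≤ r ℕ.+ r) →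
                      Invariant (r ℕ.+ (r ℕ.+ r)) (class d ∘ apply ρ)
    class-invariant d ρ h {u} {v} u≡ eq = class-cong d {apply ρ u} {apply ρ v}
      (c-apply ρ {u} {v} (λ l l≡ _ → ℕ.≤-trans (h l (trans l≡ u≡)) 2r≤k) eq)

    length-++≤ : ∀ {A : Set} (u v : List A) → length u ≤ r → length v ≤ r → length (u ++ v) ≤ r ℕ.+ r
    length-++≤ u v p q = subst (_≤ r ℕ.+ r) (sym (List.length-++ u)) (ℕ.+-mono-≤ p q)

    *-invariant : ∀ {j φ ψ} → Invariant j φ → Invariant j ψ → Invariant j (λ u → φ u * ψ u)
    *-invariant f g {u} {v} p eq = cong₂ _*_ (f {u} {v} p eq) (g {u} {v} p eq)

    module Triangles (d e f : Node) (e≡ : len e ≡ r ℕ.+ r) (f≡ : len f ≡ r ℕ.+ r) where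

      -- With corners 1, 2, 3, `φ` reads a tuple in the order 1, 2, 3 and `ψ` in the order 2, 1, 3.
      -- The corner to be summed out thus always comes first, as `Σexts` requires.
      φ ψ : Node → ℚ
      φ w = class d (apply (ρ₁ ++ᴿ ρ₂) w) * class f (apply (ρ₁ ++ᴿ ρ₃) w)
      ψ w = class d (apply (ρ₂ ++ᴿ ρ₁) w) * class e (apply (ρ₁ ++ᴿ ρ₃) w)

      φ-++ : ∀ s u₁ u₂ u₃ → length u₁ ≡ r → length u₂ ≡ r →
             φ (s , u₁ ++ u₂ ++ u₃) ≡ class d (s , u₁ ++ u₂) * class f (s , u₁ ++ u₃)
      φ-++ s u₁ u₂ u₃ p q = cong₂ (λ a b → class d (s , a) * class f (s , b))
        (cong₂ _++_ (op₁ u₁ u₂ u₃ p q) (op₂ u₁ u₂ u₃ p q)) (cong₂ _++_ (op₁ u₁ u₂ u₃ p q) (op₃ u₁ u₂ u₃ p q))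

      ψ-++ : ∀ s u₂ u₁ u₃ → length u₂ ≡ r → length u₁ ≡ r →
             ψ (s , u₂ ++ u₁ ++ u₃) ≡ class d (s , u₁ ++ u₂) * class e (s , u₂ ++ u₃)
      ψ-++ s u₂ u₁ u₃ p q = cong₂ (λ a b → class d (s , a) * class e (s , b))
        (cong₂ _++_ (op₂ u₂ u₁ u₃ p q) (op₁ u₂ u₁ u₃ p q)) (cong₂ _++_ (op₁ u₂ u₁ u₃ p q) (op₃ u₂ u₁ u₃ p q))

      φ-invariant : Invariant (r ℕ.+ (r ℕ.+ r)) φ
      φ-invariant = *-invariant {φ = class d ∘ apply (ρ₁ ++ᴿ ρ₂)} {class f ∘ apply (ρ₁ ++ᴿ ρ₃)}
        (class-invariant d (ρ₁ ++ᴿ ρ₂) (λ l _ → length-++≤ (op ρ₁ l) (op ρ₂ l) (length-ρ₁ l) (length-ρ₁ (drop r l))))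
        (class-invariant f (ρ₁ ++ᴿ ρ₃) (λ l l≡ → length-++≤ (op ρ₁ l) (op ρ₃ l) (length-ρ₁ l) (length-ρ₃ l l≡)))

      ψ-invariant : Invariant (r ℕ.+ (r ℕ.+ r)) ψ
      ψ-invariant = *-invariant {φ = class d ∘ apply (ρ₂ ++ᴿ ρ₁)} {class e ∘ apply (ρ₁ ++ᴿ ρ₃)}
        (class-invariant d (ρ₂ ++ᴿ ρ₁) (λ l _ → length-++≤ (op ρ₂ l) (op ρ₁ l) (length-ρ₁ (drop r l)) (length-ρ₁ l)))
        (class-invariant e (ρ₁ ++ᴿ ρ₃) (λ l l≡ → length-++≤ (op ρ₁ l) (op ρ₃ l) (length-ρ₁ l) (length-ρ₃ l l≡)))

      -- Number of triples coloured d, e, f on the pairs (1,2), (2,3), (1,3).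
      τ : Bool → ℚ
      τ s = ∑ (T s) (λ u → ∑ (T² s) (λ v → φ (s , u ++ v) * class e (s , v)))

      -- The colours of all three sides are functions of the colour of the whole triple, which has
      -- 3r entries; summing over all triples is an iterated extension of the empty tuple.
      τ-sides : τ true ≡ τ false
      τ-sides = trans (flat true) (trans (Σexts-invariant χ (r ℕ.+ (r ℕ.+ r))
        (subst (_≤ k) (sym (ℕ.+-identityʳ _)) 3r≤k) (λ {u} {v} p → χ-invariant {u} {v} (trans p (ℕ.+-identityʳ _)))
        refl (c-edge [] z≤n S-[])) (sym (flat false)))
        where
        χ : Node → ℚ
        χ w = φ w * class e (apply ρ₂₃ w)
        χ-invariant : Invariant (r ℕ.+ (r ℕ.+ r)) χ
        χ-invariant = *-invariant {φ = φ} {class e ∘ apply ρ₂₃} φ-invariant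
          (class-invariant e ρ₂₃ (λ l l≡ → ℕ.≤-reflexive (trans (List.length-drop r l) (trans (cong (ℕ._∸ r) l≡) (ℕ.m+n∸m≡n r (r ℕ.+ r))))))
        flat : ∀ s → τ s ≡ Σexts χ (r ℕ.+ (r ℕ.+ r)) (s , [])
        flat s = trans (∑-cong∈ (T s) λ {u} u∈ → ∑-cong (T² s) λ v →
            trans (cong (λ a → φ (s , u ++ v) * class e (s , a)) (sym (drop-length-++ u v (length-tuples (ord s) r u∈))))
                  (cong (λ l → χ (s , l)) (sym (List.++-identityʳ (u ++ v)))))
          (sym (∑-listsOf-+ ℚ.+-*-commutativeRing (allFin (ord s)) r (r ℕ.+ r) _))

      τ-transpose : ∀ s → τ s ≡ ∑ (T s) (λ u → ∑ (T² s) (λ v → ψ (s , u ++ v) * class f (s , v)))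
      τ-transpose s = begin
        τ s
          ≡⟨ ∑-cong (T s) (λ u → ∑-listsOf-+ ℚ.+-*-commutativeRing (allFin (ord s)) r r _) ⟩
        ∑ (T s) (λ u₁ → ∑ (T s) (λ u₂ → ∑ (T s) (λ u₃ → φ (s , u₁ ++ u₂ ++ u₃) * class e (s , u₂ ++ u₃))))
          ≡⟨ ∑-swap (T s) (T s) _ ⟩
        ∑ (T s) (λ u₂ → ∑ (T s) (λ u₁ → ∑ (T s) (λ u₃ → φ (s , u₁ ++ u₂ ++ u₃) * class e (s , u₂ ++ u₃))))
          ≡⟨ ∑-cong∈ (T s) (λ {u₂} u₂∈ → ∑-cong∈ (T s) (λ {u₁} u₁∈ → ∑-cong (T s) (λ u₃ →
               term u₁ u₂ u₃ (length-tuples (ord s) r u₁∈) (length-tuples (ord s) r u₂∈)))) ⟩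
        ∑ (T s) (λ u₂ → ∑ (T s) (λ u₁ → ∑ (T s) (λ u₃ → ψ (s , u₂ ++ u₁ ++ u₃) * class f (s , u₁ ++ u₃))))
          ≡⟨ ∑-cong (T s) (λ u → ∑-listsOf-+ ℚ.+-*-commutativeRing (allFin (ord s)) r r _) ⟨
        ∑ (T s) (λ u → ∑ (T² s) (λ v → ψ (s , u ++ v) * class f (s , v)))
          ∎
        where
        open ≡-Reasoning
        term : ∀ u₁ u₂ u₃ → length u₁ ≡ r → length u₂ ≡ r →
               φ (s , u₁ ++ u₂ ++ u₃) * class e (s , u₂ ++ u₃) ≡ ψ (s , u₂ ++ u₁ ++ u₃) * class f (s , u₁ ++ u₃)
        term u₁ u₂ u₃ p q = trans (cong (_* class e (s , u₂ ++ u₃)) (φ-++ s u₁ u₂ u₃ p q))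
          (trans (exchange (class d (s , u₁ ++ u₂)) (class f (s , u₁ ++ u₃)) (class e (s , u₂ ++ u₃)))
                 (cong (_* class f (s , u₁ ++ u₃)) (sym (ψ-++ s u₂ u₁ u₃ q p))))
          where
          exchange : ∀ a b c → a * b * c ≡ a * c * b
          exchange = solve 3 (λ a b c → a :* b :* c := a :* c :* b) refl

      -- The identity between intersection numbers of a coherent configuration: the same triangles
      -- are counted from side `e` and from side `f`. The count on the left is made in the first
      -- graph and that on the right in the second.
      N-triangles : N true e * Σexts φ r e ≡ N true f * Σexts ψ r f
      N-triangles = begin
        N true e * Σexts φ r e   ≡⟨ Fubini true φ e e≡ φ-invariant ⟨
        τ true                   ≡⟨ τ-sides ⟩
        τ false                  ≡⟨ τ-transpose false ⟩
        _                        ≡⟨ Fubini false ψ f f≡ ψ-invariant ⟩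
        N false f * Σexts ψ r f  ≡⟨ cong (_* Σexts ψ r f) (N-sides {f} (subst (_≤ k) (sym f≡) 2r≤k)) ⟨
        N true f * Σexts ψ r f   ∎
        where open ≡-Reasoning

      triangles : recip (N true f) * Σexts φ r e ≡ recip (N true e) * Σexts ψ r f
      triangles = begin
        ωf * P                        ≡⟨ ℚ.*-identityˡ (ωf * P) ⟨
        1ℚ * (ωf * P)                 ≡⟨ cong (_* (ωf * P)) (*-recip (N≢0 e e≡)) ⟨
        N true e * ωe * (ωf * P)      ≡⟨ regroup (N true e) ωe ωf P ⟩
        ωf * ωe * (N true e * P)      ≡⟨ cong (ωf * ωe *_) N-triangles ⟩
        ωf * ωe * (N true f * Q)      ≡⟨ regroup′ ωf ωe (N true f) Q ⟩
        N true f * ωf * (ωe * Q)      ≡⟨ cong (_* (ωe * Q)) (*-recip (N≢0 f f≡)) ⟩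
        1ℚ * (ωe * Q)                 ≡⟨ ℚ.*-identityˡ (ωe * Q) ⟩
        ωe * Q                        ∎
        where
        open ≡-Reasoning
        ωe = recip (N true e)
        ωf = recip (N true f)
        P = Σexts φ r e
        Q = Σexts ψ r f
        regroup : ∀ n a b p → n * a * (b * p) ≡ b * a * (n * p)
        regroup = solve 4 (λ n a b p → n :* a :* (b :* p) := b :* a :* (n :* p)) refl
        regroup′ : ∀ a b n p → a * b * (n * p) ≡ n * a * (b * p)
        regroup′ = solve 4 (λ a b n p → a :* b :* (n :* p) := n :* a :* (b :* p)) refl

    Point : Set
    Point = List (Verts true) × List (Verts false)

    points : List Point
    points = cartesianProduct (T true) (T false)

    ∑-points : ∀ (f : Point → ℚ) → ∑ points f ≡ ∑ (T true) (λ x → ∑ (T false) (λ y → f (x , y)))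
    ∑-points = ∑-cartesianProductWith _,_ (T true) (T false)

    points-length : ∀ {x y} → (x , y) ∈ points → length x ≡ r × length y ≡ r
    points-length p∈ with x∈ , y∈ ← ∈-cartesianProduct⁻ (T true) (T false) p∈ =
      length-tuples (ord true) r x∈ , length-tuples (ord false) r y∈

    points-unique : Unique points
    points-unique = Unique.cartesianProduct⁺ (tuples-unique (ord true) r) (tuples-unique (ord false) r)

    -- K is the moment matrix on t-tuples.  Z acts on the first component only, and Z K = K²
    -- amounts to counting coloured triangles in two ways.
    K Z : Point → Point → ℚ
    K (x , y) (x′ , y′) = W (true , x ++ x′) (false , y ++ y′)
    Z (x , y) (x′ , y′) = 𝟙 (List.≡-dec Fin._≟_ y y′) * ∑ (T true) (λ u → W (true , x ++ u) (true , x′ ++ u))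

    K-sym : ∀ {p q} → p ∈ points → q ∈ points → K p q ≡ K q p
    K-sym {x , y} {x′ , y′} p∈ q∈ = W-++-swap x y x′ y′ (trans (proj₁ lp) (sym (proj₂ lp))) (trans (proj₁ lq) (sym (proj₂ lq)))
      (subst (_≤ k) (sym (length-++-≡ x x′ (proj₁ lp) (proj₁ lq))) 2r≤k)
      where
      lp = points-length p∈
      lq = points-length q∈

    -- The indicator in `Z` removes the sum over the second component. The remaining double sum and
    -- the one for K² then agree already for each fixed middle block `u`.
    Z-K : ∀ {p q} → p ∈ points → q ∈ points →
          ∑ points (λ o → Z p o * K o q) ≡ ∑ points (λ o → K p o * K o q)
    Z-K {x , y} {x″ , y″} p∈ q∈ = begin
      ∑ points (λ o → Z (x , y) o * K o (x″ , y″))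
        ≡⟨ ∑-points _ ⟩
      ∑ (T true) (λ x̂ → ∑ (T false) (λ ŷ → 𝟙 (y ≟ᴸ ŷ) * A x̂ * W (true , x̂ ++ x″) (false , ŷ ++ y″)))
        ≡⟨ ∑-cong (T true) (λ x̂ → trans (∑-cong (T false) (λ ŷ →
             trans (ℚ.*-assoc (𝟙 (y ≟ᴸ ŷ)) (A x̂) _) (cong (_* (A x̂ * W (true , x̂ ++ x″) (false , ŷ ++ y″))) (𝟙-cong (y ≟ᴸ ŷ) (ŷ ≟ᴸ y) sym sym))))
             (∑-δ _≟ᴸ_ (λ ŷ → A x̂ * W (true , x̂ ++ x″) (false , ŷ ++ y″)) (tuples-unique (ord false) r) y∈)) ⟩
      ∑ (T true) (λ x̂ → A x̂ * W (true , x̂ ++ x″) f)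
        ≡⟨ ∑-cong (T true) (λ x̂ → *-distribʳ-∑ (T true) _ _) ⟩
      ∑ (T true) (λ x̂ → ∑ (T true) (λ u → W (true , x ++ u) (true , x̂ ++ u) * W (true , x̂ ++ x″) f))
        ≡⟨ ∑-swap (T true) (T true) _ ⟩
      ∑ (T true) (λ u → ∑ (T true) (λ x̂ → W (true , x ++ u) (true , x̂ ++ u) * W (true , x̂ ++ x″) f))
        ≡⟨ ∑-cong∈ (T true) (λ {u} u∈ → middle u (length-tuples (ord true) r u∈)) ⟩
      ∑ (T true) (λ u → ∑ (T false) (λ y′ → W (true , x ++ u) (false , y ++ y′) * W (true , u ++ x″) (false , y′ ++ y″)))
        ≡⟨ ∑-points _ ⟨
      ∑ points (λ o → K (x , y) o * K o (x″ , y″))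
        ∎
      where
      open ≡-Reasoning
      _≟ᴸ_ = List.≡-dec (Fin._≟_ {n = ord false})
      y∈ = proj₂ (∈-cartesianProduct⁻ (T true) (T false) p∈)
      lx = proj₁ (points-length p∈)
      ly = proj₂ (points-length p∈)
      lx″ = proj₁ (points-length q∈)
      ly″ = proj₂ (points-length q∈)
      A : List (Verts true) → ℚ
      A x̂ = ∑ (T true) (λ u → W (true , x ++ u) (true , x̂ ++ u))
      f : Node
      f = false , y ++ y″
      W-class : ∀ u v → W u v ≡ recip (N true u) * class u v
      W-class u v = trans (cong (_* recip (N true u)) (𝟙-cong (c u ≟ᴺ c v) (c v ≟ᴺ c u) sym sym)) (ℚ.*-comm (class u v) (recip (N true u)))
      pull : ∀ a b p q → a * p * (b * q) ≡ a * (b * (p * q))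
      pull = solve 4 (λ a b p q → a :* p :* (b :* q) := a :* (b :* (p :* q))) refl
      -- On the left, `x̂` completes the fixed side `u ++ x″` to a triangle in the first graph; on
      -- the right, `y′` completes the fixed side `y ++ y″` in the second. `triangles` compares the
      -- two counts, including the class sizes.
      middle : ∀ u → length u ≡ r →
        ∑ (T true) (λ x̂ → W (true , x ++ u) (true , x̂ ++ u) * W (true , x̂ ++ x″) f) ≡
        ∑ (T false) (λ y′ → W (true , x ++ u) (false , y ++ y′) * W (true , u ++ x″) (false , y′ ++ y″))
      middle u lu = begin
        ∑ (T true) (λ x̂ → W d (true , x̂ ++ u) * W (true , x̂ ++ x″) f)
          ≡⟨ ∑-cong∈ (T true) (λ {x̂} x̂∈ → trans (cong₂ _*_ (W-class d (true , x̂ ++ u))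
               (trans (W-sym (true , x̂ ++ x″) f) (W-class f (true , x̂ ++ x″))))
               (trans (pull ωd ωf _ _) (cong (λ q → ωd * (ωf * q)) (sym (φ-++ true x̂ u x″ (length-tuples (ord true) r x̂∈) lu))))) ⟩
        ∑ (T true) (λ x̂ → ωd * (ωf * φ (true , x̂ ++ u ++ x″)))
          ≡⟨ trans (sym (*-distribˡ-∑ (T true) ωd _)) (cong (ωd *_) (sym (*-distribˡ-∑ (T true) ωf _))) ⟩
        ωd * (ωf * Σexts φ r e)
          ≡⟨ cong (ωd *_) triangles ⟩
        ωd * (ωe * Σexts ψ r f)
          ≡⟨ trans (cong (ωd *_) (*-distribˡ-∑ (T false) ωe _)) (*-distribˡ-∑ (T false) ωd _) ⟩
        ∑ (T false) (λ y′ → ωd * (ωe * ψ (false , y′ ++ y ++ y″)))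
          ≡⟨ ∑-cong∈ (T false) (λ {y′} y′∈ → trans (cong (λ q → ωd * (ωe * q)) (ψ-++ false y′ y y″ (length-tuples (ord false) r y′∈) ly))
               (trans (sym (pull ωd ωe _ _)) (cong₂ _*_ (sym (W-class d (false , y ++ y′))) (sym (W-class e (false , y′ ++ y″)))))) ⟩
        ∑ (T false) (λ y′ → W d (false , y ++ y′) * W e (false , y′ ++ y″))
          ∎
        where
        d e : Node
        d = true , x ++ u
        e = true , u ++ x″
        open Triangles d e f (length-++-≡ u x″ lu lx″) (length-++-≡ y y″ ly ly″)
        ωd = recip (N true d)
        ωe = recip (N true e)
        ωf = recip (N true f)

    Frame : Set
    Frame = List (Verts false) × List (Verts true) × List (Verts true)

    frames : List Frame
    frames = cartesianProduct (T false) (cartesianProduct (T true) (T² true))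

    ∑-frames : ∀ (f : Frame → ℚ) → ∑ frames f ≡ ∑ (T false) (λ y → ∑ (T true) (λ u → ∑ (T² true) (λ w → f (y , u , w))))
    ∑-frames f = trans (∑-cartesianProductWith _,_ (T false) (cartesianProduct (T true) (T² true)) f)
      (∑-cong (T false) (λ y → ∑-cartesianProductWith _,_ (T true) (T² true) _))

    -- A factor of `Z`: as `W` is a projection, summing over `w` merges two copies of it into
    -- `W (true , x ++ u) (true , x′ ++ u)`.
    ρ : Frame → Point → ℚ
    ρ (y₀ , u , w) (x , y) = 𝟙 (List.≡-dec Fin._≟_ y₀ y) * W (true , x ++ u) (true , w)

    Z-gram : ∀ {p q} → p ∈ points → q ∈ points → Z p q ≡ ∑ frames (λ t → ρ t p * ρ t q)
    Z-gram {x , y} {x′ , y′} p∈ q∈ = sym (begin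
      ∑ frames (λ t → ρ t (x , y) * ρ t (x′ , y′))
        ≡⟨ ∑-frames _ ⟩
      ∑ (T false) (λ y₀ → ∑ (T true) (λ u → ∑ (T² true) (λ w →
        𝟙 (y₀ ≟ᴸ y) * W (true , x ++ u) (true , w) * (𝟙 (y₀ ≟ᴸ y′) * W (true , x′ ++ u) (true , w)))))
        ≡⟨ ∑-cong (T false) (λ y₀ → trans (∑-cong∈ (T true) (λ {u} u∈ → trans
             (∑-cong (T² true) (λ w → pull (𝟙 (y₀ ≟ᴸ y)) (W (true , x ++ u) (true , w)) (𝟙 (y₀ ≟ᴸ y′)) (W (true , x′ ++ u) (true , w))))
             (trans (sym (*-distribˡ-∑ (T² true) (𝟙 (y₀ ≟ᴸ y) * 𝟙 (y₀ ≟ᴸ y′)) _))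
                    (cong (𝟙 (y₀ ≟ᴸ y) * 𝟙 (y₀ ≟ᴸ y′) *_) (∑-W-W (true , x ++ u) (true , x′ ++ u)
                      (length-++-≡ x u (proj₁ (points-length p∈)) (length-tuples (ord true) r u∈)))))))
             (trans (sym (*-distribˡ-∑ (T true) (𝟙 (y₀ ≟ᴸ y) * 𝟙 (y₀ ≟ᴸ y′)) _)) (ℚ.*-assoc (𝟙 (y₀ ≟ᴸ y)) (𝟙 (y₀ ≟ᴸ y′)) A))) ⟩
      ∑ (T false) (λ y₀ → 𝟙 (y₀ ≟ᴸ y) * (𝟙 (y₀ ≟ᴸ y′) * A))
        ≡⟨ ∑-δ _≟ᴸ_ (λ y₀ → 𝟙 (y₀ ≟ᴸ y′) * A) (tuples-unique (ord false) r) (proj₂ (∈-cartesianProduct⁻ (T true) (T false) p∈)) ⟩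
      𝟙 (y ≟ᴸ y′) * A
        ∎)
      where
      open ≡-Reasoning
      _≟ᴸ_ = List.≡-dec (Fin._≟_ {n = ord false})
      A = ∑ (T true) (λ u → W (true , x ++ u) (true , x′ ++ u))
      pull : ∀ a p b q → a * p * (b * q) ≡ a * b * (p * q)
      pull = solve 4 (λ a p b q → a :* p :* (b :* q) := a :* b :* (p :* q)) refl

    L : ℕ
    L = length points

    at : Fin L → Point
    at = lookup points

    at∈ : ∀ i → at i ∈ points
    at∈ i = ∈-lookup i

    open Gram {n = L} frames (λ t i → ρ t (at i)) (λ i j → Z (at i) (at j)) (λ i j → Z-gram (at∈ i) (at∈ j))

    -- The row of `ρ` at this frame vanishes at every other point, because `x′ ++ x` and `x ++ x`
    -- share a colour only if `x′ ≡ x`. Pairing with it isolates one coordinate, which makes `Z`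
    -- definite.
    frame : Point → Frame
    frame (x , y) = y , x , x ++ x

    frame∈ : ∀ {p} → p ∈ points → frame p ∈ frames
    frame∈ {x , y} p∈ with x∈ , y∈ ← ∈-cartesianProduct⁻ (T true) (T false) p∈ =
      ∈-cartesianProduct⁺ y∈ (∈-cartesianProduct⁺ x∈ (subst (λ m → x ++ x ∈ tuples (ord true) m)
        (length-++-≡ x x (length-tuples (ord true) r x∈) (length-tuples (ord true) r x∈)) (∈-tuples (x ++ x))))

    ρ-frame-≢ : ∀ {p q} → p ∈ points → q ∈ points → q ≢ p → ρ (frame p) q ≡ 0ℚ
    ρ-frame-≢ {x , y} {x′ , y′} p∈ q∈ q≢p with List.≡-dec Fin._≟_ y y′
    ... | no _     = ℚ.*-zeroˡ (W (true , x′ ++ x) (true , x ++ x))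
    ... | yes refl = trans (ℚ.*-identityˡ _) (W-≢ {true , x′ ++ x} {true , x ++ x} (λ eq → q≢p (cong (_, y)
      (c-++-injective x′ x x (trans (proj₁ (points-length q∈)) (sym lx)) id
        (subst (_≤ k) (sym (cong₂ ℕ._+_ lx lx)) 2r≤k) eq))))
      where lx = proj₁ (points-length p∈)

    Z-anisotropic : Anisotropic {L} (λ i j → Z (at i) (at j))
    Z-anisotropic u h i = begin
      u i                     ≡⟨ ℚ.*-identityˡ (u i) ⟨
      1ℚ * u i                ≡⟨ cong (_* u i) (*-recip (N≢0 n n≡)) ⟨
      N true n * recip (N true n) * u i  ≡⟨ ℚ.*-assoc (N true n) (recip (N true n)) (u i) ⟩
      N true n * (recip (N true n) * u i)  ≡⟨ cong (λ q → N true n * (q * u i)) own ⟨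
      N true n * (ρ (frame (at i)) (at i) * u i)  ≡⟨ cong (N true n *_) (∑-pick (λ j → ρ (frame (at i)) (at j) * u j) (Unique.allFin⁺ L) (∈-allFin i)
        (λ {j} _ j≢i → trans (cong (_* u j) (ρ-frame-≢ (at∈ i) (at∈ j) (j≢i ∘ lookup-injective points-unique j i))) (ℚ.*-zeroˡ (u j)))) ⟨
      N true n * ⟨ (λ j → ρ (frame (at i)) (at j)) , u ⟩  ≡⟨ cong (N true n *_) (gram-isotropic u h (frame∈ (at∈ i))) ⟩
      N true n * 0ℚ           ≡⟨ ℚ.*-zeroʳ (N true n) ⟩
      0ℚ                      ∎
      where
      open ≡-Reasoning
      x = proj₁ (at i)
      y = proj₂ (at i)
      n : Node
      n = true , x ++ x
      n≡ : len n ≡ r ℕ.+ r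
      n≡ = length-++-≡ x x (proj₁ (points-length (at∈ i))) (proj₁ (points-length (at∈ i)))
      own : ρ (frame (at i)) (at i) ≡ recip (N true n)
      own = trans (cong₂ _*_ (𝟙-yes (List.≡-dec Fin._≟_ y y) refl) (W-≡ {n} {n} refl)) (ℚ.*-identityˡ (recip (N true n)))

    K-positive : ∀ ξ → 0ℚ ℚ.≤ ∑ points (λ p → ξ p * ∑ points (λ q → K p q * ξ q))
    K-positive ξ = subst (0ℚ ℚ.≤_) (trans (∑-cong (allFin L) (λ i → cong (ξ (at i) *_) (∑-lookup points (λ q → K (at i) q * ξ q))))
                                          (∑-lookup points (λ p → ξ p * ∑ points (λ q → K p q * ξ q))))
      (absorbing⇒positive {L} (λ i j → Z (at i) (at j)) (λ i j → K (at i) (at j))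
        gram-sym (λ i j → K-sym (at∈ i) (at∈ j)) Z-anisotropic gram-nonNegative
        (λ i l → trans (∑-lookup points (λ o → Z (at i) o * K o (at l)))
          (trans (Z-K (at∈ i) (at∈ l)) (sym (∑-lookup points (λ o → K (at i) o * K o (at l))))))
        (ξ ∘ at))

    _≟ᴾ_ : DecidableEquality Point
    _≟ᴾ_ = Product.≡-dec (List.≡-dec Fin._≟_) (List.≡-dec Fin._≟_)

    -- The same point may occur several times with different coefficients; `ξ` collects them into
    -- one vector.
    K-positive-combination : ∀ (ps : List (ℚ × Point)) → (∀ {q p} → (q , p) ∈ ps → p ∈ points) →
      0ℚ ℚ.≤ ∑ ps (λ { (a , p) → a * ∑ ps (λ { (b , q) → K p q * b }) })
    K-positive-combination ps ps∈ = subst (0ℚ ℚ.≤_) eq (K-positive ξ)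
      where
      open ≡-Reasoning
      ξ : Point → ℚ
      ξ p = ∑ ps (λ { (a , q) → a * 𝟙 (p ≟ᴾ q) })
      push : ∀ (f : Point → ℚ) → ∑ points (λ p → ξ p * f p) ≡ ∑ ps (λ { (a , p) → a * f p })
      push f = begin
        ∑ points (λ p → ξ p * f p)
          ≡⟨ ∑-cong points (λ p → *-distribʳ-∑ ps (f p) _) ⟩
        ∑ points (λ p → ∑ ps (λ { (a , q) → a * 𝟙 (p ≟ᴾ q) * f p }))
          ≡⟨ ∑-swap points ps _ ⟩
        ∑ ps (λ { (a , q) → ∑ points (λ p → a * 𝟙 (p ≟ᴾ q) * f p) })
          ≡⟨ ∑-cong∈ ps (λ { {a , q} aq∈ → trans (∑-cong points (λ p → ℚ.*-assoc a (𝟙 (p ≟ᴾ q)) (f p)))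
               (trans (sym (*-distribˡ-∑ points a _)) (cong (a *_) (∑-δ _≟ᴾ_ f points-unique (ps∈ aq∈)))) }) ⟩
        ∑ ps (λ { (a , p) → a * f p })
          ∎
      eq : ∑ points (λ p → ξ p * ∑ points (λ q → K p q * ξ q)) ≡ ∑ ps (λ { (a , p) → a * ∑ ps (λ { (b , q) → K p q * b }) })
      eq = trans (push _) (∑-cong ps (λ { (a , p) → cong (a *_) (trans (∑-cong points (λ q → ℚ.*-comm (K p q) (ξ q)))
        (trans (push (K p)) (∑-cong ps (λ { (b , q) → ℚ.*-comm b (K p q) })))) }))

    -- The padding `γ` stays fixed in the first graph while its images run over the second, so `∑-W`
    -- strips it one entry at a time.
    ∑-pad : ∀ γ {a b} → length (γ ++ a) ≤ k →
            ∑ (tuples (ord false) (length γ)) (λ z → W (true , γ ++ a) (false , z ++ b)) ≡ W (true , a) (false , b)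
    ∑-pad []      {a} {b} _   = ℚ.+-identityʳ (W (true , a) (false , b))
    ∑-pad (g ∷ γ) {a} {b} γ≤k = begin
      ∑ (tuples (ord false) (suc (length γ))) (λ z → W (true , g ∷ γ ++ a) (false , z ++ b))
        ≡⟨ ∑-cartesianProductWith _∷_ (allFin (ord false)) ts _ ⟩
      ∑ (allFin (ord false)) (λ h → ∑ ts (λ z → W (true , g ∷ γ ++ a) (false , h ∷ z ++ b)))
        ≡⟨ ∑-swap (allFin (ord false)) ts _ ⟩
      ∑ ts (λ z → ∑ (allFin (ord false)) (λ h → W (true , g ∷ γ ++ a) (false , h ∷ z ++ b)))
        ≡⟨ ∑-cong ts (λ z → ∑-W γ≤k) ⟩
      ∑ ts (λ z → W (true , γ ++ a) (false , z ++ b))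
        ≡⟨ ∑-pad γ (ℕ.<⇒≤ γ≤k) ⟩
      W (true , a) (false , b)
        ∎
      where
      open ≡-Reasoning
      ts = tuples (ord false) (length γ)

  -- Moments of sets with fewer than r pairs are recovered from tuples of length exactly r: add
  -- vertices from Γ on the side of G and sum over their images in H.
  module Moment {G H k} (B : BackAndForth (orders G H) (adjacency G H) k) (r : ℕ) (3r≤k : r ℕ.+ (r ℕ.+ r) ≤ k)
                (Γ : List (Fin (order G))) (Γ≡r : length Γ ≡ r) where
    open Colouring B
    open Weights B
    open Uniform B
    open TupleKernel B r 3r≤k

    fill : Pairs G H → List (Fin (order G))
    fill l = take (r ℕ.∸ length l) Γ

    images : Pairs G H → List (List (Fin (order H)))
    images l = tuples (order H) (length (fill l))

    point : Pairs G H → List (Fin (order H)) → Point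
    point l z = fill l ++ map proj₁ l , z ++ map proj₂ l

    length-fill : ∀ l → length (fill l) ≡ r ℕ.∸ length l
    length-fill l = trans (List.length-take (r ℕ.∸ length l) Γ)
      (ℕ.m≤n⇒m⊓n≡m (subst (r ℕ.∸ length l ≤_) (sym Γ≡r) (ℕ.m∸n≤m r (length l))))

    filled : ∀ {A : Set} l (u : List A) (f : Fin (order G) × Fin (order H) → A) → length l ≤ r → length u ≡ length (fill l) → length (u ++ map f l) ≡ r
    filled l u f l≤r u≡ = trans (length-++-≡ u (map f l) (trans u≡ (length-fill l)) (List.length-map f l)) (ℕ.m∸n+n≡m l≤r)

    point∈ : ∀ l {z} → length l ≤ r → z ∈ images l → point l z ∈ points
    point∈ l {z} l≤r z∈ = ∈-cartesianProduct⁺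
      (subst (λ m → fill l ++ map proj₁ l ∈ tuples (order G) m) (filled l (fill l) proj₁ l≤r refl) (∈-tuples _))
      (subst (λ m → z ++ map proj₂ l ∈ tuples (order H) m) (filled l z proj₂ l≤r (length-tuples (order H) _ z∈)) (∈-tuples _))

    -- `∑-pad` strips only a prefix, so after the first padding is gone the blocks are exchanged to
    -- bring the second one to the front, and exchanged back at the end.
    K-images : ∀ l l′ → length l ≤ r → length l′ ≤ r →
               ∑ (images l) (λ z → ∑ (images l′) (λ z′ → K (point l z) (point l′ z′))) ≡ val (l ++ l′)
    K-images l l′ l≤r l′≤r = begin
      ∑ (images l) (λ z → ∑ (images l′) (λ z′ → W (true , (fill l ++ a) ++ fill l′ ++ a′) (false , (z ++ b) ++ z′ ++ b′)))
        ≡⟨ ∑-swap (images l) (images l′) _ ⟩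
      ∑ (images l′) (λ z′ → ∑ (images l) (λ z → W (true , (fill l ++ a) ++ fill l′ ++ a′) (false , (z ++ b) ++ z′ ++ b′)))
        ≡⟨ ∑-cong∈ (images l′) (λ {z′} z′∈ → trans (∑-cong (images l) (λ z → cong₂ (λ u v → W (true , u) (false , v))
             (List.++-assoc (fill l) a _) (List.++-assoc z b _))) (trans (∑-pad (fill l) (≤k₁ z′))
             (trans (W-++-swap a b (fill l′ ++ a′) (z′ ++ b′) lab (trans (filled l′ (fill l′) proj₁ l′≤r refl)
               (sym (filled l′ z′ proj₂ l′≤r (length-tuples (order H) _ z′∈)))) ≤k₂)
             (cong₂ (λ u v → W (true , u) (false , v)) (List.++-assoc (fill l′) a′ a) (List.++-assoc z′ b′ b))))) ⟩
      ∑ (images l′) (λ z′ → W (true , fill l′ ++ a′ ++ a) (false , z′ ++ b′ ++ b))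
        ≡⟨ ∑-pad (fill l′) ≤k₃ ⟩
      W (true , a′ ++ a) (false , b′ ++ b)
        ≡⟨ W-++-swap a′ b′ a b lab′ lab ≤k₄ ⟩
      W (true , a ++ a′) (false , b ++ b′)
        ≡⟨ cong₂ (λ u v → W (true , u) (false , v)) (List.map-++ proj₁ l l′) (List.map-++ proj₂ l l′) ⟨
      val (l ++ l′)
        ∎
      where
      open ≡-Reasoning
      a = map proj₁ l
      b = map proj₂ l
      a′ = map proj₁ l′
      b′ = map proj₂ l′
      lab : length a ≡ length b
      lab = trans (List.length-map proj₁ l) (sym (List.length-map proj₂ l))
      lab′ : length a′ ≡ length b′
      lab′ = trans (List.length-map proj₁ l′) (sym (List.length-map proj₂ l′))
      full : length (fill l ++ a) ≡ r
      full = filled l (fill l) proj₁ l≤r refl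
      full′ : length (fill l′ ++ a′) ≡ r
      full′ = filled l′ (fill l′) proj₁ l′≤r refl
      a≤r : length a ≤ r
      a≤r = subst (_≤ r) (sym (List.length-map proj₁ l)) l≤r
      a′≤r : length a′ ≤ r
      a′≤r = subst (_≤ r) (sym (List.length-map proj₁ l′)) l′≤r
      bound : ∀ {A : Set} (u v : List A) → length u ≤ r → length v ≤ r → length (u ++ v) ≤ k
      bound u v p q = ℕ.≤-trans (length-++≤ u v p q) 2r≤k
      ≤k₁ : ∀ (z′ : List (Fin (order H))) → length (fill l ++ a ++ fill l′ ++ a′) ≤ k
      ≤k₁ z′ = subst (λ u → length u ≤ k) (List.++-assoc (fill l) a (fill l′ ++ a′))
        (bound (fill l ++ a) (fill l′ ++ a′) (ℕ.≤-reflexive full) (ℕ.≤-reflexive full′))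
      ≤k₂ : length (a ++ fill l′ ++ a′) ≤ k
      ≤k₂ = bound a (fill l′ ++ a′) a≤r (ℕ.≤-reflexive full′)
      ≤k₃ : length (fill l′ ++ a′ ++ a) ≤ k
      ≤k₃ = subst (λ u → length u ≤ k) (List.++-assoc (fill l′) a′ a) (bound (fill l′ ++ a′) a (ℕ.≤-reflexive full′) a≤r)
      ≤k₄ : length (a′ ++ a) ≤ k
      ≤k₄ = bound a′ a a′≤r a≤r

    val-positive : ∀ {n} (l : Fin n → Pairs G H) → (∀ i → length (l i) ≤ r) → ∀ (x : Fin n → ℚ) →
                   0ℚ ℚ.≤ ∑ (allFin n) (λ i → ∑ (allFin n) (λ j → x i * val (l i ++ l j) * x j))
    val-positive {n} l l≤r x = subst (0ℚ ℚ.≤_) eq (K-positive-combination ps λ qp∈ → ps∈ (find (∈-concatMap⁻ _ {xs = allFin n} qp∈)))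
      where
      open ≡-Reasoning
      is = allFin n
      -- The coefficient of a short list is copied to each of its padded points; by `K-images` the
      -- form on these points collapses to the form on the lists.
      block : Fin n → List (ℚ × Point)
      block i = map (λ z → x i , point (l i) z) (images (l i))
      ps : List (ℚ × Point)
      ps = concatMap block is
      ps∈ : ∀ {q p} → (∃ λ i → i ∈ is × (q , p) ∈ block i) → p ∈ points
      ps∈ (i , _ , qp∈) with z , z∈ , refl ← ∈-map⁻ (λ z → x i , point (l i) z) qp∈ = point∈ (l i) (l≤r i) z∈
      ∑-ps : ∀ (F : ℚ × Point → ℚ) → ∑ ps F ≡ ∑ is (λ i → ∑ (images (l i)) (λ z → F (x i , point (l i) z)))
      ∑-ps F = trans (∑-concatMap block is F) (∑-cong is (λ i → ∑-map (images (l i)) _ F))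
      eq : ∑ ps (λ { (a , p) → a * ∑ ps (λ { (b , q) → K p q * b }) }) ≡ ∑ is (λ i → ∑ is (λ j → x i * val (l i ++ l j) * x j))
      eq = begin
        ∑ ps (λ { (a , p) → a * ∑ ps (λ { (b , q) → K p q * b }) })
          ≡⟨ ∑-ps _ ⟩
        ∑ is (λ i → ∑ (images (l i)) (λ z → x i * ∑ ps (λ { (b , q) → K (point (l i) z) q * b })))
          ≡⟨ ∑-cong is (λ i → trans (sym (*-distribˡ-∑ (images (l i)) (x i) _)) (cong (x i *_) (trans
               (∑-cong (images (l i)) (λ z → ∑-ps (λ { (b , q) → K (point (l i) z) q * b })))
               (∑-swap (images (l i)) is _)))) ⟩
        ∑ is (λ i → x i * ∑ is (λ j → ∑ (images (l i)) (λ z → ∑ (images (l j)) (λ z′ → K (point (l i) z) (point (l j) z′) * x j))))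
          ≡⟨ ∑-cong is (λ i → trans (*-distribˡ-∑ is (x i) _) (∑-cong is (λ j → trans (cong (x i *_) (trans
               (∑-cong (images (l i)) (λ z → sym (*-distribʳ-∑ (images (l j)) (x j) _)))
               (trans (sym (*-distribʳ-∑ (images (l i)) (x j) _)) (cong (_* x j) (K-images (l i) (l j) (l≤r i) (l≤r j))))))
               (sym (ℚ.*-assoc (x i) _ (x j)))))) ⟩
        ∑ is (λ i → ∑ is (λ j → x i * val (l i ++ l j) * x j))
          ∎

    y-∪ : ∀ I J → ∣ I ∣ ≤ r → ∣ J ∣ ≤ r → y (I ∪ J) ≡ val (pairs G H I ++ pairs G H J)
    y-∪ I J I≤r J≤r = val-set
      (pairs≤k (I ∪ J) (ℕ.≤-trans (∣∪∣≤ I J) (ℕ.≤-trans (ℕ.+-mono-≤ I≤r J≤r) 2r≤k)))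
      (ℕ.≤-trans (length-++≤ (pairs G H I) (pairs G H J) (subst (_≤ r) (sym (length-pairs G H I)) I≤r) (subst (_≤ r) (sym (length-pairs G H J)) J≤r)) 2r≤k)
      to from
      where
      to : pairs G H (I ∪ J) ⊆ pairs G H I ++ pairs G H J
      to p∈ with Subset.x∈p∪q⁻ I J (∈-pairs⁻ G H p∈)
      ... | inj₁ p∈I = ∈-++⁺ˡ (∈-pairs⁺ G H p∈I)
      ... | inj₂ p∈J = ∈-++⁺ʳ (pairs G H I) (∈-pairs⁺ G H p∈J)
      from : pairs G H I ++ pairs G H J ⊆ pairs G H (I ∪ J)
      from p∈ with ∈-++⁻ (pairs G H I) p∈
      ... | inj₁ p∈I = ∈-pairs⁺ G H {I ∪ J} (Subset.x∈p∪q⁺ {p = I} (inj₁ (∈-pairs⁻ G H {I} p∈I)))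
      ... | inj₂ p∈J = ∈-pairs⁺ G H {I ∪ J} (Subset.x∈p∪q⁺ {p = I} (inj₂ (∈-pairs⁻ G H {J} p∈J)))

    y-positive : ∀ {n} (I : Fin n → PairSet G H) → (∀ i → ∣ I i ∣ ≤ r) → ∀ (x : Fin n → ℚ) →
                 0ℚ ℚ.≤ sumℚ (λ i → sumℚ (λ j → x i * y (I i ∪ I j) * x j))
    y-positive {n} I I≤r x = subst (0ℚ ℚ.≤_) (sym eq)
      (val-positive (pairs G H ∘ I) (λ i → subst (_≤ r) (sym (length-pairs G H (I i))) (I≤r i)) x)
      where
      eq : sumℚ (λ i → sumℚ (λ j → x i * y (I i ∪ I j) * x j)) ≡
           ∑ (allFin n) (λ i → ∑ (allFin n) (λ j → x i * val (pairs G H (I i) ++ pairs G H (I j)) * x j))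
      eq = trans (sum≡∑ {n} _) (∑-cong (allFin n) (λ i → trans (sum≡∑ {n} _) (∑-cong (allFin n) (λ j →
        cong (λ q → x i * q * x j) (y-∪ (I i) (I j) (I≤r i) (I≤r j))))))

  -- The uniform solution as a Lasserre solution

  ≡⇒≃ : ∀ {x y} → (∀ n → seq x n ≡ seq y n) → x ≃ y
  ≡⇒≃ {x} {y} h ε ε>0 = 0 , λ n _ → subst (ℚ._≤ ε) (sym (cong ℚ.∣_∣ (trans (cong (seq x n +_) (cong -_ (sym (h n)))) (ℚ.+-inverseʳ (seq x n))))) (ℚ.<⇒≤ ε>0)

  seq-sumℝ : ∀ {m} (f : Fin m → ℝ) n → seq (sumℝ f) n ≡ sumℚ (λ i → seq (f i) n)
  seq-sumℝ {zero}  f n = refl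
  seq-sumℝ {suc m} f n = cong (seq (f zero) n +_) (seq-sumℝ (f ∘ suc) n)

  ≤-+ : ∀ p {ε} → 0ℚ ℚ.≤ ε → p ℚ.≤ p + ε
  ≤-+ p {ε} 0≤ε = subst (ℚ._≤ p + ε) (ℚ.+-identityʳ p) (ℚ.+-monoʳ-≤ p 0≤ε)

  sumℚ-cong : ∀ {m} {f g : Fin m → ℚ} → (∀ i → f i ≡ g i) → sumℚ f ≡ sumℚ g
  sumℚ-cong {zero}  h = refl
  sumℚ-cong {suc m} h = cong₂ _+_ (h zero) (sumℚ-cong (h ∘ suc))

  ∣subsets≤∣ : ∀ n t i → ∣ lookup (subsets≤ n t) i ∣ ≤ t
  ∣subsets≤∣ n t i = proj₂ (∈-filter⁻ (λ I → ∣ I ∣ ℕ.≤? t) {xs = allSubsets n} (∈-lookup i))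

  module _ {G H t} (1≤t : 1 ≤ t) (B : BackAndForth (orders G H) (adjacency G H) (3 ℕ.* t)) where
    open Uniform B

    private
      <3t : ∀ {m} → m ≤ 2 ℕ.* t ℕ.∸ 2 → m < 3 ℕ.* t
      <3t m≤ = ℕ.≤-<-trans (ℕ.≤-trans m≤ (ℕ.m∸n≤m (2 ℕ.* t) 2)) (ℕ.m<n+m (2 ℕ.* t) 1≤t)

    y-psd : ∀ {n} (I : Fin n → PairSet G H) → (∀ i → ∣ I i ∣ ≤ t) → ∀ (x : Fin n → ℚ) →
            0ℚ ℚ.≤ sumℚ (λ i → sumℚ (λ j → x i * y (I i ∪ I j) * x j))
    y-psd I I≤t with order G ℕ.≟ 0
    ... | yes G≡0 = Moment.y-positive B 0 z≤n [] refl I (λ i → subst (∣ I i ∣ ≤_) (cong (ℕ._* order H) G≡0) (Subset.∣p∣≤n (I i)))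
    ... | no  G≢0 = Moment.y-positive B t (ℕ.≤-reflexive (cong (λ m → t ℕ.+ (t ℕ.+ m)) (sym (ℕ.+-identityʳ t))))
      -- The padding entries need not be distinct: one vertex repeated t times suffices.
      (replicate t (fromℕ< (ℕ.n≢0⇒n>0 G≢0))) (List.length-replicate t) I I≤t

    isLasserre : IsLasserreSolution t G H (fromℚ ∘ y)
    isLasserre = record
      { psd = record
        { symmetric   = λ i j → ≡⇒≃ {fromℚ (y (Ls i ∪ Ls j))} {fromℚ (y (Ls j ∪ Ls i))} (λ _ → cong y (Subset.∪-comm (Ls i) (Ls j)))
        -- The moments are constant rational sequences, so each term of the sequence of the form is
        -- a rational form at the vector of n-th terms and is nonnegative outright.
        ; nonNegative = λ x ε ε>0 → 0 , λ n _ → ℚ.≤-trans (subst (0ℚ ℚ.≤_) (sym (quadratic x n)) (y-psd Ls Ls≤ (λ i → seq (x i) n)))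
            (≤-+ _ (ℚ.<⇒≤ ε>0))
        }
      ; sumH   = λ I I≤ g → ≡⇒≃ {sumℝ {order H} (λ h → fromℚ (y (I ∪ ⁅ combine g h ⁆)))} {fromℚ (y I)} (λ n → trans (seq-sumℝ {order H} (λ h → fromℚ (y (I ∪ ⁅ combine g h ⁆))) n) (∑-yʰ I (<3t I≤) g))
      ; sumG   = λ I I≤ h → ≡⇒≃ {sumℝ {order G} (λ g → fromℚ (y (I ∪ ⁅ combine g h ⁆)))} {fromℚ (y I)} (λ n → trans (seq-sumℝ {order G} (λ g → fromℚ (y (I ∪ ⁅ combine g h ⁆))) n) (∑-yᵍ I (<3t I≤) h))
      ; vanish = λ I _ ¬PI → ≡⇒≃ {fromℚ (y I)} {0ℝ} (λ _ → y-vanish I ¬PI)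
      ; empty  = ≡⇒≃ {fromℚ (y Subset.⊥)} {1ℝ} (λ _ → y-⊥)
      }
      where
      Ls : Fin (length (subsets≤ (order G ℕ.* order H) t)) → PairSet G H
      Ls = lookup (subsets≤ (order G ℕ.* order H) t)
      Ls≤ : ∀ i → ∣ Ls i ∣ ≤ t
      Ls≤ = ∣subsets≤∣ (order G ℕ.* order H) t
      quadratic : ∀ (x : Fin _ → ℝ) n → seq (sumℝ (λ i → sumℝ (λ j → x i *ʳ fromℚ (y (Ls i ∪ Ls j)) *ʳ x j))) n ≡
                  sumℚ (λ i → sumℚ (λ j → seq (x i) n * y (Ls i ∪ Ls j) * seq (x j) n))
      quadratic x n = trans (seq-sumℝ (λ i → sumℝ (entry i)) n) (sumℚ-cong (λ i → seq-sumℝ (entry i) n))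
        where
        entry : ∀ i j → ℝ
        entry i j = x i *ʳ fromℚ (y (Ls i ∪ Ls j)) *ʳ x j

-- Real numbers

module _ where
  open import Data.Rational using (_+_; _*_; -_; _-_; ∣_∣)
  open +-*-Solver using (solve; _:=_; _:+_; _:*_; :-_; _:-_; con)

  p≤∣p∣ : ∀ p → p ℚ.≤ ∣ p ∣
  p≤∣p∣ p with ℚ.≤-total 0ℚ p
  ... | inj₁ 0≤p = ℚ.≤-reflexive (sym (ℚ.0≤p⇒∣p∣≡p 0≤p))
  ... | inj₂ p≤0 = ℚ.≤-trans p≤0 (ℚ.0≤∣p∣ p)

  ½ε>0 : ∀ {ε} → 0ℚ ℚ.< ε → 0ℚ ℚ.< ½ * ε
  ½ε>0 {ε} ε>0 = subst (ℚ._< ½ * ε) (ℚ.*-zeroʳ ½) (ℚ.*-monoʳ-<-pos ½ ε>0)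

  ½ε+½ε : ∀ ε → ½ * ε + ½ * ε ≡ ε
  ½ε+½ε = solve 1 (λ ε → con ½ :* ε :+ con ½ :* ε := ε) refl

  Eventually : (ℕ → Set) → Set
  Eventually P = ∃ λ N → ∀ n → N ℕ.≤ n → P n

  eventually-map : ∀ {P Q} → (∀ n → P n → Q n) → Eventually P → Eventually Q
  eventually-map f (N , p) = N , λ n n≥ → f n (p n n≥)

  eventually-zip : ∀ {P Q R} → (∀ n → P n → Q n → R n) → Eventually P → Eventually Q → Eventually R
  eventually-zip f (M , p) (N , q) = M ℕ.⊔ N , λ n n≥ → f n (p n (ℕ.m⊔n≤o⇒m≤o M N n≥)) (q n (ℕ.m⊔n≤o⇒n≤o M N n≥))

  pos⇒≢0 : ∀ {q} → 0ℚ ℚ.< q → q ≢ 0ℚ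
  pos⇒≢0 q>0 q≡0 = ℚ.<⇒≢ q>0 (sym q≡0)

  recip-pos : ∀ {q} → 0ℚ ℚ.< q → 0ℚ ℚ.< recip q
  recip-pos {q} q>0 = ℚ.≰⇒> λ r≤0 → ℚ.<⇒≢ (ℚ.positive⁻¹ 1ℚ)
    (trans (sym (ℚ.*-zeroʳ q)) (trans (cong (q *_) (ℚ.≤-antisym (recip-nonNegative (ℚ.<⇒≤ q>0)) r≤0)) (*-recip (pos⇒≢0 q>0))))

  *-pos : ∀ {p q} → 0ℚ ℚ.< p → 0ℚ ℚ.< q → 0ℚ ℚ.< p * q
  *-pos {p} {q} p>0 q>0 = subst (ℚ._< p * q) (ℚ.*-zeroʳ p) (ℚ.*-monoʳ-<-pos p {{ℚ.positive p>0}} q>0)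

  ≃-refl : ∀ {x} → x ≃ x
  ≃-refl {x} = ≡⇒≃ {x} {x} (λ _ → refl)

  ≃-sym : ∀ {x y} → x ≃ y → y ≃ x
  ≃-sym {x} {y} p ε ε>0 = eventually-map (λ n → subst (ℚ._≤ ε) (trans (sym (ℚ.∣-p∣≡∣p∣ (seq x n - seq y n))) (cong ∣_∣ (flip (seq x n) (seq y n))))) (p ε ε>0)
    where
    flip : ∀ a b → - (a - b) ≡ b - a
    flip = solve 2 (λ a b → :- (a :- b) := b :- a) refl

  ∣∣-add : ∀ a b {ε} → ∣ a ∣ ℚ.≤ ½ * ε → ∣ b ∣ ℚ.≤ ½ * ε → ∣ a + b ∣ ℚ.≤ ε
  ∣∣-add a b {ε} p q = ℚ.≤-trans (ℚ.∣p+q∣≤∣p∣+∣q∣ a b) (subst (∣ a ∣ + ∣ b ∣ ℚ.≤_) (½ε+½ε ε) (ℚ.+-mono-≤ p q))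

  ≃-trans : ∀ {x y z} → x ≃ y → y ≃ z → x ≃ z
  ≃-trans {x} {y} {z} p q ε ε>0 = eventually-zip (λ n a b → subst (λ d → ∣ d ∣ ℚ.≤ ε) (telescope (seq x n) (seq y n) (seq z n)) (∣∣-add _ _ a b))
    (p (½ * ε) (½ε>0 ε>0)) (q (½ * ε) (½ε>0 ε>0))
    where
    telescope : ∀ a b c → (a - b) + (b - c) ≡ a - c
    telescope = solve 3 (λ a b c → (a :- b) :+ (b :- c) := a :- c) refl

  +ʳ-cong : ∀ {x x′ y y′} → x ≃ x′ → y ≃ y′ → x +ʳ y ≃ x′ +ʳ y′
  +ʳ-cong {x} {x′} {y} {y′} p q ε ε>0 = eventually-zip (λ n a b → subst (λ d → ∣ d ∣ ℚ.≤ ε) (pair (seq x n) (seq x′ n) (seq y n) (seq y′ n)) (∣∣-add _ _ a b))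
    (p (½ * ε) (½ε>0 ε>0)) (q (½ * ε) (½ε>0 ε>0))
    where
    pair : ∀ a b c d → (a - b) + (c - d) ≡ (a + c) - (b + d)
    pair = solve 4 (λ a b c d → (a :- b) :+ (c :- d) := (a :+ c) :- (b :+ d)) refl

  bounded : ∀ x → ∃ λ K → 0ℚ ℚ.< K × Eventually (λ n → ∣ seq x n ∣ ℚ.≤ K)
  bounded x with N , p ← cauchy x 1ℚ (ℚ.positive⁻¹ 1ℚ) =
    1ℚ + ∣ seq x N ∣ , ℚ.+-mono-<-≤ (ℚ.positive⁻¹ 1ℚ) (ℚ.0≤∣p∣ (seq x N)) , N , λ n n≥ →
      ℚ.≤-trans (subst (λ q → ∣ q ∣ ℚ.≤ ∣ seq x n - seq x N ∣ + ∣ seq x N ∣) (split (seq x n) (seq x N)) (ℚ.∣p+q∣≤∣p∣+∣q∣ (seq x n - seq x N) (seq x N)))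
                (ℚ.+-monoˡ-≤ ∣ seq x N ∣ (p n N n≥ ℕ.≤-refl))
    where
    split : ∀ a b → (a - b) + b ≡ a
    split = solve 2 (λ a b → (a :- b) :+ b := a) refl

  *-recip-cancel : ∀ {K} ε → 0ℚ ℚ.< K → K * (recip K * ε) ≡ ε
  *-recip-cancel {K} ε K>0 = trans (sym (ℚ.*-assoc K (recip K) ε)) (trans (cong (_* ε) (*-recip (pos⇒≢0 K>0))) (ℚ.*-identityˡ ε))

  ∣∣-*-mono : ∀ a b {K δ} → 0ℚ ℚ.< K → ∣ a ∣ ℚ.≤ K → ∣ b ∣ ℚ.≤ δ → ∣ a * b ∣ ℚ.≤ K * δ
  ∣∣-*-mono a b {K} {δ} K>0 a≤K b≤δ = begin
    ∣ a * b ∣      ≡⟨ ℚ.∣p*q∣≡∣p∣*∣q∣ a b ⟩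
    ∣ a ∣ * ∣ b ∣  ≤⟨ ℚ.*-monoʳ-≤-nonNeg ∣ b ∣ {{ℚ.nonNegative (ℚ.0≤∣p∣ b)}} a≤K ⟩
    K * ∣ b ∣      ≤⟨ ℚ.*-monoˡ-≤-nonNeg K {{ℚ.nonNegative (ℚ.<⇒≤ K>0)}} b≤δ ⟩
    K * δ          ∎
    where open ℚ.≤-Reasoning

  *ʳ-congˡ : ∀ x {y y′} → y ≃ y′ → x *ʳ y ≃ x *ʳ y′
  *ʳ-congˡ x {y} {y′} p ε ε>0 = eventually-zip close (proj₂ (proj₂ (bounded x))) (p (recip K * ε) (*-pos (recip-pos K>0) ε>0))
    where
    K = proj₁ (bounded x)
    K>0 = proj₁ (proj₂ (bounded x))
    factor : ∀ a b c → a * (b - c) ≡ a * b - a * c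
    factor = solve 3 (λ a b c → a :* (b :- c) := a :* b :- a :* c) refl
    close : ∀ n → ∣ seq x n ∣ ℚ.≤ K → ∣ seq y n - seq y′ n ∣ ℚ.≤ recip K * ε → ∣ seq x n * seq y n - seq x n * seq y′ n ∣ ℚ.≤ ε
    close n bx by = subst₂ ℚ._≤_ (cong ∣_∣ (factor (seq x n) (seq y n) (seq y′ n))) (*-recip-cancel ε K>0)
      (∣∣-*-mono (seq x n) (seq y n - seq y′ n) K>0 bx by)

  *ʳ-comm : ∀ x y → x *ʳ y ≃ y *ʳ x
  *ʳ-comm x y = ≡⇒≃ {x *ʳ y} {y *ʳ x} (λ n → ℚ.*-comm (seq x n) (seq y n))

  *ʳ-cong : ∀ {x x′ y y′} → x ≃ x′ → y ≃ y′ → x *ʳ y ≃ x′ *ʳ y′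
  *ʳ-cong {x} {x′} {y} {y′} p q = ≃-trans {x *ʳ y} {x *ʳ y′} {x′ *ʳ y′} (*ʳ-congˡ x {y} {y′} q)
    (≃-trans {x *ʳ y′} {y′ *ʳ x} {x′ *ʳ y′} (*ʳ-comm x y′) (≃-trans {y′ *ʳ x} {y′ *ʳ x′} {x′ *ʳ y′} (*ʳ-congˡ y′ {x} {x′} p) (*ʳ-comm y′ x′)))

  infix 8 -ʳ_
  -ʳ_ : ℝ → ℝ
  -ʳ x = fromℚ (- 1ℚ) *ʳ x

  -- A record, so that both sides of an equation can be inferred from its type.
  infix 4 _≋_
  record _≋_ (x y : ℝ) : Set where
    constructor wrap
    field unwrap : x ≃ y
  open _≋_ public

  ≡⇒≋ : ∀ {x y} → (∀ n → seq x n ≡ seq y n) → x ≋ y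
  ≡⇒≋ {x} {y} h = wrap (≡⇒≃ {x} {y} h)

  ℝ-commutativeRing : CommutativeRing 0ℓ 0ℓ
  ℝ-commutativeRing = record
    { Carrier = ℝ ; _≈_ = _≋_ ; _+_ = _+ʳ_ ; _*_ = _*ʳ_ ; -_ = -ʳ_ ; 0# = 0ℝ ; 1# = 1ℝ
    ; isCommutativeRing = record
      { isRing = record
        { +-isAbelianGroup = record
          { isGroup = record
            { isMonoid = record
              { isSemigroup = record
                { isMagma = record
                  { isEquivalence = record { refl = λ {x} → wrap (≃-refl {x}) ; sym = λ {x} {y} p → wrap (≃-sym {x} {y} (unwrap p))
                                           ; trans = λ {x} {y} {z} p q → wrap (≃-trans {x} {y} {z} (unwrap p) (unwrap q)) }
                  ; ∙-cong = λ {x} {x′} {y} {y′} p q → wrap (+ʳ-cong {x} {x′} {y} {y′} (unwrap p) (unwrap q))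
                  }
                ; assoc = λ x y z → ≡⇒≋ (λ n → ℚ.+-assoc (seq x n) (seq y n) (seq z n))
                }
              ; identity = (λ x → ≡⇒≋ (λ n → ℚ.+-identityˡ (seq x n))) , (λ x → ≡⇒≋ (λ n → ℚ.+-identityʳ (seq x n)))
              }
            ; inverse = (λ x → ≡⇒≋ (λ n → solve 1 (λ a → con (- 1ℚ) :* a :+ a := con 0ℚ) refl (seq x n)))
                      , (λ x → ≡⇒≋ (λ n → solve 1 (λ a → a :+ con (- 1ℚ) :* a := con 0ℚ) refl (seq x n)))
            ; ⁻¹-cong = λ {x} {y} p → wrap (*ʳ-congˡ (fromℚ (- 1ℚ)) {x} {y} (unwrap p))
            }
          ; comm = λ x y → ≡⇒≋ (λ n → ℚ.+-comm (seq x n) (seq y n))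
          }
        ; *-cong = λ {x} {x′} {y} {y′} p q → wrap (*ʳ-cong {x} {x′} {y} {y′} (unwrap p) (unwrap q))
        ; *-assoc = λ x y z → ≡⇒≋ (λ n → ℚ.*-assoc (seq x n) (seq y n) (seq z n))
        ; *-identity = (λ x → ≡⇒≋ (λ n → ℚ.*-identityˡ (seq x n))) , (λ x → ≡⇒≋ (λ n → ℚ.*-identityʳ (seq x n)))
        ; distrib = (λ x y z → ≡⇒≋ (λ n → ℚ.*-distribˡ-+ (seq x n) (seq y n) (seq z n)))
                  , (λ x y z → ≡⇒≋ (λ n → ℚ.*-distribʳ-+ (seq x n) (seq y n) (seq z n)))
        }
      ; *-comm = λ x y → wrap (*ʳ-comm x y)
      }
    }

  module ∑ℝ = ListSum ℝ-commutativeRing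

  0≤ʳ-resp : ∀ {x y} → x ≃ y → 0ℝ ≤ʳ x → 0ℝ ≤ʳ y
  0≤ʳ-resp {x} {y} p q ε ε>0 = eventually-zip
    (λ n a b → ℚ.≤-trans b (subst₂ ℚ._≤_ (shift (seq x n) (seq y n) ε) (halve (seq y n) ε)
      (ℚ.+-monoˡ-≤ (seq y n + ½ * ε) (ℚ.≤-trans (p≤∣p∣ (seq x n - seq y n)) a))))
    (p (½ * ε) (½ε>0 ε>0)) (q (½ * ε) (½ε>0 ε>0))
    where
    shift : ∀ a b e → (a - b) + (b + ½ * e) ≡ a + ½ * e
    shift = solve 3 (λ a b e → (a :- b) :+ (b :+ con ½ :* e) := a :+ con ½ :* e) refl
    halve : ∀ b e → ½ * e + (b + ½ * e) ≡ b + e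
    halve = solve 2 (λ b e → con ½ :* e :+ (b :+ con ½ :* e) := b :+ e) refl

  0≤ʳ-+ : ∀ {x y} → 0ℝ ≤ʳ x → 0ℝ ≤ʳ y → 0ℝ ≤ʳ x +ʳ y
  0≤ʳ-+ {x} {y} p q ε ε>0 = eventually-zip
    (λ n a b → subst (0ℚ ℚ.≤_) (collect (seq x n) (seq y n) ε) (ℚ.+-mono-≤ a b))
    (p (½ * ε) (½ε>0 ε>0)) (q (½ * ε) (½ε>0 ε>0))
    where
    collect : ∀ a b e → (a + ½ * e) + (b + ½ * e) ≡ (a + b) + e
    collect = solve 3 (λ a b e → (a :+ con ½ :* e) :+ (b :+ con ½ :* e) := (a :+ b) :+ e) refl

  ∣∣≤ : ∀ {q ε} → 0ℚ ℚ.≤ q + ε → 0ℚ ℚ.≤ ε - q → ∣ q ∣ ℚ.≤ ε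
  ∣∣≤ {q} {ε} p r with ℚ.∣p∣≡p∨∣p∣≡-p q
  ... | inj₁ eq = subst₂ ℚ._≤_ (trans (ℚ.+-identityˡ q) (sym eq)) (cancel ε q) (ℚ.+-monoˡ-≤ q r)
    where
    cancel : ∀ e q → e - q + q ≡ e
    cancel = solve 2 (λ e q → e :- q :+ q := e) refl
  ... | inj₂ eq = subst₂ ℚ._≤_ (trans (ℚ.+-identityˡ (- q)) (sym eq)) (cancel q ε) (ℚ.+-monoˡ-≤ (- q) p)
    where
    cancel : ∀ q e → q + e + - q ≡ e
    cancel = solve 2 (λ q e → q :+ e :+ :- q := e) refl

  sum≃0⇒≃0 : ∀ {x y} → 0ℝ ≤ʳ x → 0ℝ ≤ʳ y → x +ʳ y ≃ 0ℝ → x ≃ 0ℝ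
  sum≃0⇒≃0 {x} {y} p q s ε ε>0 = eventually-zip (λ n a bc → subst (λ d → ∣ d ∣ ℚ.≤ ε) (sym (ℚ.+-identityʳ (seq x n)))
      (∣∣≤ a (subst (0ℚ ℚ.≤_) (collect (seq x n) (seq y n) ε) (ℚ.+-mono-≤ (proj₁ bc) (below (proj₂ bc))))))
    (p ε ε>0) (eventually-zip (λ n b c → b , c) (q (½ * ε) (½ε>0 ε>0)) (s (½ * ε) (½ε>0 ε>0)))
    where
    below : ∀ {a e} → ∣ a + 0ℚ ∣ ℚ.≤ e → 0ℚ ℚ.≤ e - a
    below {a} {e} h = subst (ℚ._≤ e - a) (ℚ.+-inverseʳ a) (ℚ.+-monoˡ-≤ (- a) (ℚ.≤-trans (p≤∣p∣ a) (subst (λ d → ∣ d ∣ ℚ.≤ e) (ℚ.+-identityʳ a) h)))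
    collect : ∀ a b e → (b + ½ * e) + (½ * e - (a + b)) ≡ e - a
    collect = solve 3 (λ a b e → (b :+ con ½ :* e) :+ (con ½ :* e :- (a :+ b)) := e :- a) refl

  ≃0-unscale : ∀ {x y} → (∀ q → 0ℝ ≤ʳ x +ʳ fromℚ q *ʳ y) → y ≃ 0ℝ
  ≃0-unscale {x} {y} h ε ε>0 =
    eventually-zip (λ n bx lu → subst (λ d → ∣ d ∣ ℚ.≤ ε) (sym (ℚ.+-identityʳ (seq y n)))
      (∣∣≤ (estimate bx (proj₁ lu)) (subst (0ℚ ℚ.≤_) (ℚ.+-comm (- seq y n) ε) (estimate′ bx (proj₂ lu)))))
      (proj₂ (proj₂ (bounded x))) (eventually-zip (λ n l u → l , u) (h q 1ℚ (ℚ.positive⁻¹ 1ℚ)) (h (- q) 1ℚ (ℚ.positive⁻¹ 1ℚ)))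
    where
    K M q r : ℚ
    K = proj₁ (bounded x)
    M = K + 1ℚ
    -- With K bounding `x` and tolerance 1 in the hypothesis, 0 ≤ ± q y + K + 1 holds eventually.
    -- Dividing by q, that is multiplying by `r`, turns the constant M = K + 1 into ε and gives 0 ≤
    -- ± y + ε.
    q = M * recip ε
    r = ε * recip M
    K>0 : 0ℚ ℚ.< K
    K>0 = proj₁ (proj₂ (bounded x))
    M>0 : 0ℚ ℚ.< M
    M>0 = ℚ.+-mono-< K>0 (ℚ.positive⁻¹ 1ℚ)
    qr : r * M ≡ ε
    qr = trans (ℚ.*-assoc ε (recip M) M) (trans (cong (ε *_) (trans (ℚ.*-comm (recip M) M) (*-recip (pos⇒≢0 M>0)))) (ℚ.*-identityʳ ε))
    rq : r * q ≡ 1ℚ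
    rq = trans (swap ε (recip M) M (recip ε)) (trans (cong₂ _*_ (*-recip (pos⇒≢0 ε>0)) (*-recip (pos⇒≢0 M>0))) (ℚ.*-identityˡ 1ℚ))
      where
      swap : ∀ e m n f → e * m * (n * f) ≡ (e * f) * (n * m)
      swap = solve 4 (λ e m n f → e :* m :* (n :* f) := (e :* f) :* (n :* m)) refl
    0≤r : 0ℚ ℚ.≤ r
    0≤r = ℚ.<⇒≤ (*-pos ε>0 (recip-pos M>0))
    scale : ∀ {p} → 0ℚ ℚ.≤ p → 0ℚ ℚ.≤ r * p
    scale {p} 0≤p = subst (ℚ._≤ r * p) (ℚ.*-zeroʳ r) (ℚ.*-monoˡ-≤-nonNeg r {{ℚ.nonNegative 0≤r}} 0≤p)
    widen : ∀ {a s b} → ∣ a ∣ ℚ.≤ K → 0ℚ ℚ.≤ (a + s * b) + 1ℚ → 0ℚ ℚ.≤ s * b + M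
    widen {a} {s} {b} a≤K p = ℚ.≤-trans p (subst₂ ℚ._≤_ (l a (s * b)) (m K (s * b)) (ℚ.+-monoˡ-≤ (s * b + 1ℚ) (ℚ.≤-trans (p≤∣p∣ a) a≤K)))
      where
      l : ∀ a t → a + (t + 1ℚ) ≡ (a + t) + 1ℚ
      l = solve 2 (λ a t → a :+ (t :+ con 1ℚ) := (a :+ t) :+ con 1ℚ) refl
      m : ∀ k t → k + (t + 1ℚ) ≡ t + (k + 1ℚ)
      m = solve 2 (λ k t → k :+ (t :+ con 1ℚ) := t :+ (k :+ con 1ℚ)) refl
    estimate : ∀ {a b} → ∣ a ∣ ℚ.≤ K → 0ℚ ℚ.≤ (a + q * b) + 1ℚ → 0ℚ ℚ.≤ b + ε
    estimate {a} {b} a≤K p = subst (0ℚ ℚ.≤_) (trans (ℚ.*-distribˡ-+ r (q * b) M) (cong₂ _+_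
      (trans (sym (ℚ.*-assoc r q b)) (trans (cong (_* b) rq) (ℚ.*-identityˡ b))) qr)) (scale (widen {a} {q} {b} a≤K p))
    estimate′ : ∀ {a b} → ∣ a ∣ ℚ.≤ K → 0ℚ ℚ.≤ (a + - q * b) + 1ℚ → 0ℚ ℚ.≤ - b + ε
    estimate′ {a} {b} a≤K p = estimate {a} { - b} a≤K (subst (λ t → 0ℚ ℚ.≤ (a + t) + 1ℚ) (neg q b) p)
      where
      neg : ∀ q b → - q * b ≡ q * - b
      neg = solve 2 (λ q b → :- q :* b := q :* :- b) refl

  0≤ʳ-resp-≋ : ∀ {x y} → x ≋ y → 0ℝ ≤ʳ x → 0ℝ ≤ʳ y
  0≤ʳ-resp-≋ {x} {y} p = 0≤ʳ-resp {x} {y} (unwrap p)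

  0≤ʳ-refl : 0ℝ ≤ʳ 0ℝ
  0≤ʳ-refl ε ε>0 = 0 , λ _ _ → subst (0ℚ ℚ.≤_) (sym (ℚ.+-identityˡ ε)) (ℚ.<⇒≤ ε>0)

  0≤ʳ-∑ : ∀ {A : Set} (xs : List A) (f : A → ℝ) → (∀ x → 0ℝ ≤ʳ f x) → 0ℝ ≤ʳ ∑ℝ.∑ xs f
  0≤ʳ-∑ []       f f≥0 = 0≤ʳ-refl
  0≤ʳ-∑ (x ∷ xs) f f≥0 = 0≤ʳ-+ {f x} {∑ℝ.∑ xs f} (f≥0 x) (0≤ʳ-∑ xs f f≥0)

  ∑≋0⇒≋0 : ∀ {A : Set} (xs : List A) (f : A → ℝ) → (∀ x → 0ℝ ≤ʳ f x) → ∑ℝ.∑ xs f ≋ 0ℝ → ∀ {x} → x ∈ xs → f x ≋ 0ℝ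
  ∑≋0⇒≋0 (x ∷ xs) f f≥0 s (here refl) = wrap (sum≃0⇒≃0 {f x} {∑ℝ.∑ xs f} (f≥0 x) (0≤ʳ-∑ xs f f≥0) (unwrap s))
  ∑≋0⇒≋0 (x ∷ xs) f f≥0 s (there y∈)  = ∑≋0⇒≋0 xs f f≥0 (wrap (sum≃0⇒≃0 {∑ℝ.∑ xs f} {f x} (0≤ʳ-∑ xs f f≥0) (f≥0 x)
    (unwrap (CommutativeRing.trans ℝ-commutativeRing (CommutativeRing.+-comm ℝ-commutativeRing (∑ℝ.∑ xs f) (f x)) s)))) y∈

  1≉0 : ¬ 1ℝ ≋ 0ℝ
  1≉0 (wrap h) with N , p ← h ½ (ℚ.positive⁻¹ ½) with p N ℕ.≤-refl
  ... | ℚ.*≤* (ℤ.+≤+ (ℕ.s≤s ()))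

-- From real solutions to back-and-forth systems

module _ where
  open ListSum ℚ.+-*-commutativeRing
  open import Data.Fin.Subset using (∣_∣)
  open import Data.Rational using (_+_; _*_; -_; _-_)
  open +-*-Solver using (solve; _:=_; _:+_; _:*_; :-_; _:-_; con)

  -- A binary decision tree instead of a function, so that families can be searched exhaustively.
  Family : ℕ → Set
  Family zero    = Bool
  Family (suc n) = Family n × Family n

  member : ∀ {n} → Family n → Subset n → Bool
  member {zero}  b       Vec.[]             = b
  member {suc n} (f , g) (outside Vec.∷ I) = member f I
  member {suc n} (f , g) (inside  Vec.∷ I) = member g I

  anyFamily? : ∀ n {P : Family n → Set} → (∀ f → Dec (P f)) → Dec (∃ P)
  anyFamily? zero P? with P? true | P? false
  ... | yes p | _     = yes (true , p)
  ... | no _  | yes p = yes (false , p)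
  ... | no ¬p | no ¬q = no λ { (true , p) → ¬p p ; (false , q) → ¬q q }
  anyFamily? (suc n) P? = map′ (λ { (f , g , p) → (f , g) , p }) (λ { ((f , g) , p) → f , g , p })
    (anyFamily? n (λ f → anyFamily? n (λ g → P? (f , g))))

  -- Double negation commutes with finite conjunctions, and a tree of depth n is a finite iteration
  -- of pairs. It picks the support on all sets at once.
  ¬¬-choice : ∀ n (D : Subset n → Bool → Set) → (∀ I → ¬ ¬ ∃ (D I)) → ¬ ¬ ∃ λ f → ∀ I → D I (member f I)
  ¬¬-choice zero    D h ¬f = h Vec.[] λ { (b , d) → ¬f (b , λ { Vec.[] → d }) }
  ¬¬-choice (suc n) D h ¬f = ¬¬-choice n (D ∘ (outside Vec.∷_)) (h ∘ (outside Vec.∷_)) λ { (f , p) →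
    ¬¬-choice n (D ∘ (inside Vec.∷_)) (h ∘ (inside Vec.∷_)) λ { (g , q) →
    ¬f ((f , g) , λ { (outside Vec.∷ I) → p I ; (inside Vec.∷ I) → q I }) } }

  allSubset? : ∀ {n} {P : Subset n → Set} → (∀ I → Dec (P I)) → Dec (∀ I → P I)
  allSubset? P? = map′ (λ ¬∃ I → decidable-stable (P? I) (λ ¬p → ¬∃ (I , ¬p))) (λ all (I , ¬p) → ¬p (all I))
    (¬? (Subset.anySubset? (¬? ∘ P?)))

  _⇔?_ : ∀ {P Q : Set} → Dec P → Dec Q → Dec (P ⇔ Q)
  p? ⇔? q? = map′ (λ (f , g) → mk⇔ f g) (λ e → Equivalence.to e , Equivalence.from e) ((p? →-dec q?) ×-dec (q? →-dec p?))

  partialIsomorphism? : ∀ G H I → Dec (PartialIsomorphism G H I)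
  partialIsomorphism? G H I = Fin.all? λ g → Fin.all? λ g′ → Fin.all? λ h → Fin.all? λ h′ →
    (combine g h Subset.∈? I) →-dec ((combine g′ h′ Subset.∈? I) →-dec
    (((g Fin.≟ g′) ⇔? (h Fin.≟ h′)) ×-dec (SimpleGraph.adj? G g g′ ⇔? SimpleGraph.adj? H h h′)))

  ⇔⇒does-≡ : ∀ {P Q : Set} (d : Dec P) (e : Dec Q) → P ⇔ Q → does d ≡ does e
  ⇔⇒does-≡ (yes p) (yes q) _  = refl
  ⇔⇒does-≡ (yes p) (no ¬q) eq = ⊥-elim (¬q (Equivalence.to eq p))
  ⇔⇒does-≡ (no ¬p) (yes q) eq = ⊥-elim (¬p (Equivalence.from eq q))
  ⇔⇒does-≡ (no ¬p) (no ¬q) _  = refl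

  add : ∀ {n} → Subset n → List (Fin n) → Subset n
  add I []       = I
  add I (x ∷ xs) = add I xs ∪ ⁅ x ⁆

  ∈-add⁺ : ∀ {n} (I : Subset n) {xs x} → x ∈ˢ I ⊎ x ∈ xs → x ∈ˢ add I xs
  ∈-add⁺ I {[]}     (inj₁ p)           = p
  ∈-add⁺ I {y ∷ xs} (inj₁ p)           = Subset.x∈p∪q⁺ {p = add I xs} (inj₁ (∈-add⁺ I {xs} (inj₁ p)))
  ∈-add⁺ I {y ∷ xs} (inj₂ (here refl)) = Subset.x∈p∪q⁺ {p = add I xs} (inj₂ (Subset.x∈⁅x⁆ y))
  ∈-add⁺ I {y ∷ xs} (inj₂ (there p))   = Subset.x∈p∪q⁺ {p = add I xs} (inj₁ (∈-add⁺ I {xs} (inj₂ p)))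

  ∈-add⁻ : ∀ {n} (I : Subset n) xs {x} → x ∈ˢ add I xs → x ∈ˢ I ⊎ x ∈ xs
  ∈-add⁻ I []       p = inj₁ p
  ∈-add⁻ I (y ∷ xs) p with Subset.x∈p∪q⁻ (add I xs) ⁅ y ⁆ p
  ... | inj₂ q = inj₂ (here (Subset.x∈⁅y⁆⇒x≡y y q))
  ... | inj₁ q with ∈-add⁻ I xs q
  ...   | inj₁ r = inj₁ r
  ...   | inj₂ r = inj₂ (there r)

  ∣add∣≤ : ∀ {n} (I : Subset n) xs → ∣ add I xs ∣ ≤ ∣ I ∣ ℕ.+ length xs
  ∣add∣≤ I []       = ℕ.m≤m+n ∣ I ∣ 0
  ∣add∣≤ I (x ∷ xs) = ℕ.≤-trans (∣∪⁅⁆∣≤ (add I xs) x) (subst (suc ∣ add I xs ∣ ≤_) (sym (ℕ.+-suc ∣ I ∣ (length xs))) (s≤s (∣add∣≤ I xs)))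

  ⊆⇒add : ∀ {n} {I J : Subset n} → I ⊆ˢ J → add I (elements J) ≡ J
  ⊆⇒add {I = I} {J} I⊆J = Subset.⊆-antisym to (λ p → ∈-add⁺ I (inj₂ (∈-elements⁺ p)))
    where
    to : add I (elements J) ⊆ˢ J
    to p with ∈-add⁻ I (elements J) p
    ... | inj₁ q = I⊆J q
    ... | inj₂ q = ∈-elements⁻ J q

  module PairSets (G H : SimpleGraph) where

    set : Pairs G H → PairSet G H
    set l = add Subset.⊥ (map (code G H) l)

    ∈-set⁺ : ∀ {l p} → p ∈ l → code G H p ∈ˢ set l
    ∈-set⁺ {l} p∈ = ∈-add⁺ Subset.⊥ {map (code G H) l} (inj₂ (∈-map⁺ (code G H) p∈))

    ∈-set⁻ : ∀ l {x} → x ∈ˢ set l → ∃ λ p → p ∈ l × x ≡ code G H p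
    ∈-set⁻ l x∈ with ∈-add⁻ Subset.⊥ (map (code G H) l) x∈
    ... | inj₁ x∈⊥ = ⊥-elim (Subset.∉⊥ x∈⊥)
    ... | inj₂ x∈l = ∈-map⁻ (code G H) x∈l

    set-mono : ∀ {l m} → l ⊆ m → set l ⊆ˢ set m
    set-mono {l} {m} l⊆m x∈ with p , p∈ , refl ← ∈-set⁻ l x∈ = ∈-set⁺ {m} (l⊆m p∈)

    set-cong : ∀ {l m} → l ⊆ m → m ⊆ l → set l ≡ set m
    set-cong {l} {m} p q = Subset.⊆-antisym (set-mono {l} {m} p) (set-mono {m} {l} q)

    set-++ : ∀ l m → set l ∪ set m ≡ set (l ++ m)
    set-++ l m = Subset.⊆-antisym to from
      where
      to : set l ∪ set m ⊆ˢ set (l ++ m)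
      to x∈ with Subset.x∈p∪q⁻ (set l) (set m) x∈
      ... | inj₁ p = set-mono {l} {l ++ m} ∈-++⁺ˡ p
      ... | inj₂ p = set-mono {m} {l ++ m} (∈-++⁺ʳ l) p
      from : set (l ++ m) ⊆ˢ set l ∪ set m
      from x∈ with p , p∈ , refl ← ∈-set⁻ (l ++ m) x∈ with ∈-++⁻ l p∈
      ... | inj₁ p∈l = Subset.x∈p∪q⁺ {p = set l} (inj₁ (∈-set⁺ {l} p∈l))
      ... | inj₂ p∈m = Subset.x∈p∪q⁺ {p = set l} (inj₂ (∈-set⁺ {m} p∈m))

    ∣set∣≤ : ∀ l → ∣ set l ∣ ≤ length l
    ∣set∣≤ l = subst₂ (λ a b → ∣ set l ∣ ≤ a ℕ.+ b) (Subset.∣⊥∣≡0 (order G ℕ.* order H)) (List.length-map (code G H) l) (∣add∣≤ Subset.⊥ (map (code G H) l))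

  fromCount : ℕ → ℚ
  fromCount zero    = 0ℚ
  fromCount (suc n) = 1ℚ + fromCount n

  0≤fromCount : ∀ n → 0ℚ ℚ.≤ fromCount n
  0≤fromCount zero    = ℚ.≤-refl
  0≤fromCount (suc n) = ℚ.+-mono-≤ (ℚ.nonNegative⁻¹ 1ℚ) (0≤fromCount n)

  fromCount-suc≢0 : ∀ n → fromCount (suc n) ≢ 0ℚ
  fromCount-suc≢0 n = pos⇒≢0 (ℚ.+-mono-<-≤ (ℚ.positive⁻¹ 1ℚ) (0≤fromCount n))

  fromCount-injective : ∀ m n → fromCount m ≡ fromCount n → m ≡ n
  fromCount-injective zero    zero    _  = refl
  fromCount-injective zero    (suc n) eq = ⊥-elim (fromCount-suc≢0 n (sym eq))
  fromCount-injective (suc m) zero    eq = ⊥-elim (fromCount-suc≢0 m eq)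
  fromCount-injective (suc m) (suc n) eq = cong suc (fromCount-injective m n
    (trans (sym (cancel (fromCount m))) (trans (cong (- 1ℚ +_) eq) (cancel (fromCount n)))))
    where
    cancel : ∀ q → - 1ℚ + (1ℚ + q) ≡ q
    cancel = solve 1 (λ q → con (- 1ℚ) :+ (con 1ℚ :+ q) := q) refl

  ∣tabulate∣ : ∀ {n} {P : Fin n → Set} (P? : ∀ i → Dec (P i)) →
               fromCount ∣ Vec.tabulate (does ∘ P?) ∣ ≡ ∑ (allFin n) (λ i → 𝟙 (P? i))
  ∣tabulate∣ {n} P? = trans (go P?) (sum≡∑ {n} _)
    where
    go : ∀ {n} {P : Fin n → Set} (P? : ∀ i → Dec (P i)) → fromCount ∣ Vec.tabulate (does ∘ P?) ∣ ≡ sumℚ (λ i → 𝟙 (P? i))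
    go {zero}  P? = refl
    go {suc n} P? with P? zero
    ... | yes _ = cong (1ℚ +_) (go (P? ∘ suc))
    ... | no _  = trans (go (P? ∘ suc)) (sym (ℚ.+-identityˡ _))

  -- Both sums are grouped by value. This passes from cardinalities of level sets, which can be
  -- searched, to the arbitrary functions in `S-ext`.
  equal-fibres⇒equal-sums : ∀ {m n} (φ : Fin m → ℚ) (ψ : Fin n → ℚ) →
    (∀ v → ∑ (allFin m) (λ g → 𝟙 (v ℚ.≟ φ g)) ≡ ∑ (allFin n) (λ h → 𝟙 (v ℚ.≟ ψ h))) →
    ∑ (allFin m) φ ≡ ∑ (allFin n) ψ
  equal-fibres⇒equal-sums {m} {n} φ ψ h = trans (by-value φ (λ g → ∈-++⁺ˡ (∈-map⁺ φ (∈-allFin g))))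
    (trans (∑-cong R (λ v → cong (_* v) (h v))) (sym (by-value ψ (λ g → ∈-++⁺ʳ (map φ (allFin m)) (∈-map⁺ ψ (∈-allFin g))))))
    where
    values = map φ (allFin m) ++ map ψ (allFin n)
    R = deduplicate ℚ._≟_ values
    by-value : ∀ {l} (χ : Fin l → ℚ) → (∀ i → χ i ∈ values) → ∑ (allFin l) χ ≡ ∑ R (λ v → ∑ (allFin l) (λ i → 𝟙 (v ℚ.≟ χ i)) * v)
    by-value {l} χ χ∈ = trans (∑-cong (allFin l) (λ i → sym (∑-δ ℚ._≟_ id (DecUnique.deduplicate-! ℚ._≟_ values) (∈-deduplicate⁺ ℚ._≟_ (χ∈ i)))))
      (trans (∑-swap (allFin l) R _) (∑-cong R (λ v → sym (*-distribʳ-∑ (allFin l) v _))))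

  module _ (G H : SimpleGraph) (k : ℕ) where

    private
      n : ℕ
      n = order G ℕ.* order H

    -- A finite shadow of `BackAndForth`: `balanced` is `S-ext` for indicator functions. Quantifying
    -- over subsets instead of rational functions makes the record decidable.
    record Stable (f : PairSet G H → Bool) : Set where
      field
        contains-⊥ : f Subset.⊥ ≡ true
        downward   : ∀ I x → f (I ∪ ⁅ x ⁆) ≡ true → f I ≡ true
        partialIso : ∀ I → f I ≡ true → PartialIsomorphism G H I
        balanced   : ∀ I → f I ≡ true → ∣ I ∣ < k → ∀ (Q : Subset (order G)) (R : Subset (order H)) →
                     (∀ g h → f (I ∪ ⁅ combine g h ⁆) ≡ true → Vec.lookup Q g ≡ Vec.lookup R h) → ∣ Q ∣ ≡ ∣ R ∣

    stable? : ∀ f → Dec (Stable f)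
    stable? f = map′
      (λ (a , b , c , d) → record { contains-⊥ = a ; downward = b ; partialIso = c ; balanced = d })
      (λ s → Stable.contains-⊥ s , Stable.downward s , Stable.partialIso s , Stable.balanced s)
      (is Subset.⊥ ×-dec
       (allSubset? λ I → Fin.all? λ x → is (I ∪ ⁅ x ⁆) →-dec is I) ×-dec
       (allSubset? λ I → is I →-dec partialIsomorphism? G H I) ×-dec
       (allSubset? λ I → is I →-dec ((∣ I ∣ ℕ.<? k) →-dec (allSubset? λ Q → allSubset? λ R →
         (Fin.all? λ g → Fin.all? λ h → is (I ∪ ⁅ combine g h ⁆) →-dec (Vec.lookup Q g Bool.≟ Vec.lookup R h)) →-dec
         (∣ Q ∣ ℕ.≟ ∣ R ∣)))))
      where
      is : ∀ I → Dec (f I ≡ true)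
      is I = f I Bool.≟ true

    stable⇒backAndForth : ∀ f → Stable f → BackAndForth (orders G H) (adjacency G H) k
    stable⇒backAndForth f st = record
      { S     = λ l → f (set l) ≡ true
      ; S?    = λ l → f (set l) Bool.≟ true
      ; S-[]  = contains-⊥
      ; S-⊆   = λ {l} {l′} l′⊆l → downward* (set-mono {l′} {l} l′⊆l)
      ; S-≡   = λ {l} {p} {q} s p∈ q∈ → ⇔⇒does-≡ (proj₁ p Fin.≟ proj₁ q) (proj₂ p Fin.≟ proj₂ q) (proj₁ (partialIso (set l) s _ _ _ _ (∈-set⁺ {l} p∈) (∈-set⁺ {l} q∈)))
      ; S-E   = λ {l} {p} {q} s p∈ q∈ → ⇔⇒does-≡ (SimpleGraph.adj? G (proj₁ p) (proj₁ q)) (SimpleGraph.adj? H (proj₂ p) (proj₂ q)) (proj₂ (partialIso (set l) s _ _ _ _ (∈-set⁺ {l} p∈) (∈-set⁺ {l} q∈)))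
      ; S-ext = λ {l} s l<k φ ψ h → equal-fibres⇒equal-sums φ ψ λ v →
          trans (sym (∣tabulate∣ (λ g → v ℚ.≟ φ g))) (trans (cong fromCount
            (balanced (set l) s (ℕ.≤-<-trans (∣set∣≤ l) l<k) (Vec.tabulate (λ g → does (v ℚ.≟ φ g))) (Vec.tabulate (λ h → does (v ℚ.≟ ψ h))) λ g h′ s′ →
              trans (Vec.lookup∘tabulate _ g) (trans (cong (λ q → does (v ℚ.≟ q)) (h g h′ s′)) (sym (Vec.lookup∘tabulate _ h′)))))
            (∣tabulate∣ (λ h → v ℚ.≟ ψ h)))
      }
      where
      open Stable st
      open PairSets G H
      remove : ∀ I xs → f (add I xs) ≡ true → f I ≡ true
      remove I []       s = s
      remove I (x ∷ xs) s = remove I xs (downward (add I xs) x s)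
      downward* : ∀ {I J} → I ⊆ˢ J → f J ≡ true → f I ≡ true
      downward* {I} {J} I⊆J s = remove I (elements J) (subst (λ K → f K ≡ true) (sym (⊆⇒add I⊆J)) s)

    -- The consequences shared by both relaxations, of which only these enter the construction of
    -- the support: a Sherali-Adams solution gives them at its own level, a Lasserre solution at
    -- level t.
    record RealSolution (y : PairSet G H → ℝ) : Set where
      field
        nonNegative : ∀ I → ∣ I ∣ ≤ k → 0ℝ ≤ʳ y I
        sumH   : ∀ I → ∣ I ∣ < k → ∀ (g : V G) → ∑ℝ.∑ (allFin (order H)) (λ h → y (I ∪ ⁅ combine g h ⁆)) ≋ y I
        sumG   : ∀ I → ∣ I ∣ < k → ∀ (h : V H) → ∑ℝ.∑ (allFin (order G)) (λ g → y (I ∪ ⁅ combine g h ⁆)) ≋ y I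
        vanish : ∀ I → ∣ I ∣ ≤ k → ¬ PartialIsomorphism G H I → y I ≋ 0ℝ
        empty  : y Subset.⊥ ≋ 1ℝ

    module FromReal (y : PairSet G H → ℝ) (sol : RealSolution y) where
      open RealSolution sol
      open CommutativeRing ℝ-commutativeRing using (setoid) renaming (refl to ≈-refl; sym to ≈-sym; trans to ≈-trans)
      module R = CommutativeRing ℝ-commutativeRing
      open import Relation.Binary.Reasoning.Setoid setoid

      -- A bit together with evidence for it. Sets with more than k pairs can only carry `false`,
      -- with vacuous evidence.
      Supports : PairSet G H → Bool → Set
      Supports I true  = ∣ I ∣ ≤ k × ¬ y I ≋ 0ℝ
      Supports I false = ∣ I ∣ ≤ k → y I ≋ 0ℝ

      ¬¬supports : ∀ I → ¬ ¬ ∃ (Supports I)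
      ¬¬supports I h with ∣ I ∣ ℕ.≤? k
      ... | yes p = h (true , p , λ e → h (false , λ _ → e))
      ... | no ¬p = h (false , λ p → ⊥-elim (¬p p))

      bit : Bool → ℝ
      bit b = if b then 1ℝ else 0ℝ

      ∑-bits : ∀ {m} (Q : Subset m) → ∑ℝ.∑ (allFin m) (bit ∘ Vec.lookup Q) ≋ fromℚ (fromCount ∣ Q ∣)
      ∑-bits {m} Q = subst (_≋ fromℚ (fromCount ∣ Q ∣)) (∑ℝ.sum≡∑ {m} (bit ∘ Vec.lookup Q))
        (≡⇒≋ (λ i → trans (seq-sumℝ (bit ∘ Vec.lookup Q) i) (go Q i)))
        where
        go : ∀ {m} (Q : Subset m) i → sumℚ (λ j → seq (bit (Vec.lookup Q j)) i) ≡ fromCount ∣ Q ∣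
        go Vec.[]             i = refl
        go (inside  Vec.∷ Q) i = cong (1ℚ +_) (go Q i)
        go (outside Vec.∷ Q) i = trans (ℚ.+-identityˡ _) (go Q i)

      module _ (f : PairSet G H → Bool) (supports : ∀ I → Supports I (f I)) where

        f⇒ : ∀ I → f I ≡ true → ∣ I ∣ ≤ k × ¬ y I ≋ 0ℝ
        f⇒ I eq = subst (Supports I) eq (supports I)

        ⇒f : ∀ I → ∣ I ∣ ≤ k → ¬ y I ≋ 0ℝ → f I ≡ true
        ⇒f I I≤k ¬0 with f I in eq
        ... | true  = refl
        ... | false = ⊥-elim (¬0 (subst (Supports I) eq (supports I) I≤k))

        downward : ∀ I x → f (I ∪ ⁅ x ⁆) ≡ true → f I ≡ true
        downward I x s = ⇒f I (ℕ.≤-trans (Subset.p⊆q⇒∣p∣≤∣q∣ (Subset.p⊆p∪q {p = I} ⁅ x ⁆)) (proj₁ (f⇒ _ s))) λ y≋0 → contra y≋0 (x Subset.∈? I)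
          where
          contra : y I ≋ 0ℝ → ¬ Dec (x ∈ˢ I)
          contra y≋0 (yes x∈) = proj₂ (f⇒ _ s) (subst (λ J → y J ≋ 0ℝ) (sym (Subset.⊆-antisym to (Subset.p⊆p∪q {p = I} ⁅ x ⁆))) y≋0)
            where
            to : I ∪ ⁅ x ⁆ ⊆ˢ I
            to {z} z∈ with Subset.x∈p∪q⁻ I ⁅ x ⁆ z∈
            ... | inj₁ z∈I = z∈I
            ... | inj₂ z∈x = subst (_∈ˢ I) (sym (Subset.x∈⁅y⁆⇒x≡y x z∈x)) x∈
          -- Here the moment of the larger set is one of the nonnegative summands of `y I`, so it
          -- vanishes along with the sum.
          contra y≋0 (no x∉) = proj₂ (f⇒ _ s) (subst (λ z → y (I ∪ ⁅ z ⁆) ≋ 0ℝ) (Fin.combine-remQuot {order G} (order H) x)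
            (∑≋0⇒≋0 (allFin (order H)) (λ h → y (I ∪ ⁅ combine (proj₁ (remQuot {order G} (order H) x)) h ⁆))
              (λ h → nonNegative _ (ℕ.≤-trans (∣∪⁅⁆∣≤ I _) I<k)) (≈-trans (sumH I I<k _) y≋0) (∈-allFin (proj₂ (remQuot {order G} (order H) x)))))
            where
            I<k : ∣ I ∣ < k
            I<k = ℕ.<-≤-trans (Subset.p⊂q⇒∣p∣<∣q∣ ((Subset.p⊆p∪q {p = I} ⁅ x ⁆) , x , Subset.x∈p∪q⁺ {p = I} (inj₂ (Subset.x∈⁅x⁆ x)) , x∉)) (proj₁ (f⇒ _ s))

        -- The mass on pairs with g in `Q` is summed by rows and by columns. On supported pairs
        -- membership in `Q` and in `R` agrees, and elsewhere the moment is zero.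
        double-count : ∀ I → ∣ I ∣ < k → ∀ (Q : Subset (order G)) (R : Subset (order H)) →
          (∀ g h → f (I ∪ ⁅ combine g h ⁆) ≡ true → Vec.lookup Q g ≡ Vec.lookup R h) →
          fromℚ (fromCount ∣ Q ∣) *ʳ y I ≋ fromℚ (fromCount ∣ R ∣) *ʳ y I
        double-count I I<k Q R h = begin
          fromℚ (fromCount ∣ Q ∣) *ʳ y I
            ≈⟨ R.*-congʳ (≈-sym (∑-bits Q)) ⟩
          ∑ℝ.∑ gs (bit ∘ Vec.lookup Q) *ʳ y I
            ≈⟨ ∑ℝ.*-distribʳ-∑ gs (y I) _ ⟩
          ∑ℝ.∑ gs (λ g → bit (Vec.lookup Q g) *ʳ y I)
            ≈⟨ ∑ℝ.∑-cong gs (λ g → ≈-trans (R.*-congˡ (≈-sym (sumH I I<k g))) (∑ℝ.*-distribˡ-∑ hs _ _)) ⟩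
          ∑ℝ.∑ gs (λ g → ∑ℝ.∑ hs (λ h → bit (Vec.lookup Q g) *ʳ y (I ∪ ⁅ combine g h ⁆)))
            ≈⟨ ∑ℝ.∑-swap gs hs _ ⟩
          ∑ℝ.∑ hs (λ h → ∑ℝ.∑ gs (λ g → bit (Vec.lookup Q g) *ʳ y (I ∪ ⁅ combine g h ⁆)))
            ≈⟨ ∑ℝ.∑-cong hs (λ h → ∑ℝ.∑-cong gs (λ g → term g h (f (I ∪ ⁅ combine g h ⁆) Bool.≟ true))) ⟩
          ∑ℝ.∑ hs (λ h → ∑ℝ.∑ gs (λ g → bit (Vec.lookup R h) *ʳ y (I ∪ ⁅ combine g h ⁆)))
            ≈⟨ ∑ℝ.∑-cong hs (λ h → ≈-trans (≈-sym (∑ℝ.*-distribˡ-∑ gs _ _)) (R.*-congˡ (sumG I I<k h))) ⟩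
          ∑ℝ.∑ hs (λ h → bit (Vec.lookup R h) *ʳ y I)
            ≈⟨ ≈-sym (∑ℝ.*-distribʳ-∑ hs (y I) _) ⟩
          ∑ℝ.∑ hs (bit ∘ Vec.lookup R) *ʳ y I
            ≈⟨ R.*-congʳ (∑-bits R) ⟩
          fromℚ (fromCount ∣ R ∣) *ʳ y I
            ∎
          where
          gs = allFin (order G)
          hs = allFin (order H)
          term : ∀ g h → Dec (f (I ∪ ⁅ combine g h ⁆) ≡ true) →
                 bit (Vec.lookup Q g) *ʳ y (I ∪ ⁅ combine g h ⁆) ≋ bit (Vec.lookup R h) *ʳ y (I ∪ ⁅ combine g h ⁆)
          term g h′ (yes s) = R.reflexive (cong (λ b → bit b *ʳ y (I ∪ ⁅ combine g h′ ⁆)) (h g h′ s))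
          term g h′ (no ¬s) = ≈-trans (zero≋ (bit (Vec.lookup Q g))) (≈-sym (zero≋ (bit (Vec.lookup R h′))))
            where
            y≋0 : y (I ∪ ⁅ combine g h′ ⁆) ≋ 0ℝ
            y≋0 = subst (Supports _) (Bool.¬-not ¬s) (supports _) (ℕ.≤-trans (∣∪⁅⁆∣≤ I _) I<k)
            zero≋ : ∀ b → b *ʳ y (I ∪ ⁅ combine g h′ ⁆) ≋ 0ℝ
            zero≋ b = ≈-trans (R.*-congˡ y≋0) (R.zeroʳ b)

        cancel-scalar : ∀ {a b} z → a ≢ b → fromℚ a *ʳ z ≋ fromℚ b *ʳ z → z ≋ 0ℝ
        cancel-scalar {a} {b} z a≢b eq = begin
          z                                      ≈⟨ ≡⇒≋ (λ n → scalar (seq z n)) ⟩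
          fromℚ (recip d) *ʳ (fromℚ a *ʳ z +ʳ -ʳ (fromℚ b *ʳ z))  ≈⟨ R.*-congˡ (R.+-congʳ eq) ⟩
          fromℚ (recip d) *ʳ (fromℚ b *ʳ z +ʳ -ʳ (fromℚ b *ʳ z))  ≈⟨ R.*-congˡ (R.-‿inverseʳ (fromℚ b *ʳ z)) ⟩
          fromℚ (recip d) *ʳ 0ℝ                  ≈⟨ R.zeroʳ (fromℚ (recip d)) ⟩
          0ℝ                                     ∎
          where
          d : ℚ
          d = a - b
          d≢0 : d ≢ 0ℚ
          d≢0 d≡0 = a≢b (trans (sym (add-back a b)) (trans (cong (_+ b) d≡0) (ℚ.+-identityˡ b)))
            where
            add-back : ∀ a b → a - b + b ≡ a
            add-back = solve 2 (λ a b → a :- b :+ b := a) refl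
          scalar : ∀ q → q ≡ recip d * (a * q + - 1ℚ * (b * q))
          scalar q = sym (trans (rearrange (recip d) a b q) (trans (cong (_* q) (*-recip d≢0)) (ℚ.*-identityˡ q)))
            where
            rearrange : ∀ r a b q → r * (a * q + - 1ℚ * (b * q)) ≡ (a - b) * r * q
            rearrange = solve 4 (λ r a b q → r :* (a :* q :+ con (- 1ℚ) :* (b :* q)) := (a :- b) :* r :* q) refl

        stable : Stable f
        stable = record
          { contains-⊥ = ⇒f Subset.⊥ (subst (_≤ k) (sym (Subset.∣⊥∣≡0 n)) z≤n) (λ y≋0 → 1≉0 (≈-trans (≈-sym empty) y≋0))
          ; downward   = downward
          -- The support gives only refutations, but this condition and equality of cardinalities
          -- are decidable, so refuting the negation is enough.
          ; partialIso = λ I s → decidable-stable (partialIsomorphism? G H I) (λ ¬PI → proj₂ (f⇒ I s) (vanish I (proj₁ (f⇒ I s)) ¬PI))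
          ; balanced   = λ I s I<k Q R h → decidable-stable (∣ Q ∣ ℕ.≟ ∣ R ∣) (λ Q≢R →
              proj₂ (f⇒ I s) (cancel-scalar (y I) (Q≢R ∘ fromCount-injective ∣ Q ∣ ∣ R ∣) (double-count I I<k Q R h)))
          }

    -- Whether a stable family exists is decidable, so a classically chosen one suffices.
    real⇒backAndForth : ∀ {y} → RealSolution y → BackAndForth (orders G H) (adjacency G H) k
    real⇒backAndForth {y} sol with anyFamily? n (λ F → stable? (member F))
    ... | yes (F , st) = stable⇒backAndForth (member F) st
    ... | no ¬∃ = ⊥-elim (¬¬-choice n Supports ¬¬supports (λ (F , sup) → ¬∃ (F , stable (member F) sup)))
      where open FromReal y sol

-- Cai–Fürer–Immerman graphs

module ∑₂ = ListSum Bool.xor-∧-commutativeRing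
module ∑ℚ = ListSum ℚ.+-*-commutativeRing

free-index : ∀ {n} (xs : List (Fin n)) → length xs < n → ∃ λ i → i ∉ xs
free-index {n} xs xs<n with Fin.any? (λ i → ¬? (member? Fin._≟_ i xs))
... | yes p = p
... | no ¬p = ⊥-elim (ℕ.<⇒≱ xs<n (Fin.injective⇒≤ {f = Any.index ∘ ∈xs} (λ {i} {j} eq →
    trans (Any.lookup-index (∈xs i)) (trans (cong (lookup xs) eq) (sym (Any.lookup-index (∈xs j)))))))
  where
  ∈xs : ∀ i → i ∈ xs
  ∈xs i = decidable-stable (member? Fin._≟_ i xs) (λ i∉ → ¬p (i , i∉))

injective⇒surjective : ∀ {n} (f : Fin n → Fin n) → (∀ {i j} → f i ≡ f j → i ≡ j) → ∀ b → ∃ λ i → f i ≡ b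
injective⇒surjective {n} f inj b with member? Fin._≟_ b (map f (allFin n))
... | yes b∈ with i , _ , eq ← ∈-map⁻ f b∈ = i , sym eq
injective⇒surjective {n} f inj b | no b∉ = ⊥-elim (ℕ.1+n≰n (subst (λ m → suc m ≤ n)
  (trans (List.length-map f (allFin n)) (List.length-tabulate {n = n} id))
  (Fin.injective⇒≤ {f = lookup xs} (λ {i} {j} → lookup-injective xs! i j))))
  where
  xs = b ∷ map f (allFin n)
  xs! : Unique xs
  xs! = All.tabulate (λ y∈ b≡y → b∉ (subst (_∈ map f (allFin n)) (sym b≡y) y∈)) ∷ Unique.map⁺ inj (Unique.allFin⁺ n)

xor-cancelˡ : ∀ a b → a xor (a xor b) ≡ b
xor-cancelˡ true  true  = refl
xor-cancelˡ true  false = refl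
xor-cancelˡ false b     = refl

xor≡false⇒≡ : ∀ {a b} → a xor b ≡ false → a ≡ b
xor≡false⇒≡ {true}  {true}  _ = refl
xor≡false⇒≡ {false} {false} _ = refl

xor-transfer : ∀ {a a′ b b′} → a xor a′ ≡ b xor b′ → a ≡ b → a′ ≡ b′
xor-transfer {a} {a′} {b} {b′} eq refl = trans (sym (xor-cancelˡ a a′)) (trans (cong (a xor_) eq) (xor-cancelˡ a b′))

xor-transfer′ : ∀ {a a′ b b′} → a xor a′ ≡ b xor b′ → a′ ≡ b′ → a ≡ b
xor-transfer′ {a} {a′} {b} {b′} eq eq′ = xor-transfer (trans (Bool.xor-comm a′ a) (trans eq (Bool.xor-comm b b′))) eq′

module _ {n : ℕ} where

  parity : (Fin n → Bool) → Bool
  parity = ∑₂.∑ (allFin n)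

  parity-cong : ∀ {f g} → (∀ i → f i ≡ g i) → parity f ≡ parity g
  parity-cong = ∑₂.∑-cong (allFin n)

  parity-xor : ∀ f g → parity (λ i → f i xor g i) ≡ parity f xor parity g
  parity-xor = ∑₂.∑-distrib-+ (allFin n)

  parity-single : ∀ i b → parity (λ j → if does (j Fin.≟ i) then b else false) ≡ b
  parity-single i b = trans (∑₂.∑-pick (λ j → if does (j Fin.≟ i) then b else false) (Unique.allFin⁺ n) (∈-allFin i) off) on
    where
    off : ∀ {j} → j ∈ allFin n → j ≢ i → (if does (j Fin.≟ i) then b else false) ≡ false
    off {j} _ j≢i with j Fin.≟ i
    ... | yes p = ⊥-elim (j≢i p)
    ... | no _  = refl
    on : (if does (i Fin.≟ i) then b else false) ≡ b
    on with i Fin.≟ i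
    ... | yes _ = refl
    ... | no ¬p = ⊥-elim (¬p refl)

  -- Handshaking: with `u` the part strictly above the diagonal, the matrix is the sum of `u` and
  -- its transpose, and these two have equal parity.
  symmetric-parity : ∀ (x : Fin n → Fin n → Bool) → (∀ i j → i ≢ j → x i j ≡ x j i) → (∀ i → x i i ≡ false) →
                     parity (λ i → parity (x i)) ≡ false
  symmetric-parity x x-sym x-diag = begin
    parity (λ i → parity (x i))
      ≡⟨ parity-cong (λ i → trans (parity-cong (split i)) (parity-xor (u i) (λ j → u j i))) ⟩
    parity (λ i → parity (u i) xor parity (λ j → u j i))
      ≡⟨ parity-xor (λ i → parity (u i)) (λ i → parity (λ j → u j i)) ⟩
    parity (λ i → parity (u i)) xor parity (λ i → parity (λ j → u j i))
      ≡⟨ cong (parity (λ i → parity (u i)) xor_) (∑₂.∑-swap (allFin n) (allFin n) (λ i j → u j i)) ⟩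
    parity (λ i → parity (u i)) xor parity (λ i → parity (u i))
      ≡⟨ Bool.xor-same (parity (λ i → parity (u i))) ⟩
    false
      ∎
    where
    open ≡-Reasoning
    u : Fin n → Fin n → Bool
    u i j with i Fin.<? j
    ... | yes _ = x i j
    ... | no _  = false
    split : ∀ i j → x i j ≡ u i j xor u j i
    split i j with i Fin.<? j | j Fin.<? i | Fin.<-cmp i j
    ... | yes p | yes q | _            = ⊥-elim (ℕ.<-asym p q)
    ... | yes _ | no _  | _            = sym (Bool.xor-identityʳ (x i j))
    ... | no _  | yes q | _            = x-sym i j (λ { refl → ℕ.<-irrefl refl q })
    ... | no ¬p | no _  | tri< p _ _   = ⊥-elim (¬p p)
    ... | no _  | no ¬q | tri> _ _ q   = ⊥-elim (¬q q)
    ... | no _  | no _  | tri≈ _ refl _ = x-diag i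

-- The Cai–Fürer–Immerman construction over the complete graph on n vertices: a vertex is a
-- base vertex with a 0/1-labelling of the base vertices, read as incident edges. Instead of
-- removing labellings of the wrong parity, they are kept as isolated vertices.
module CFI (n : ℕ) where

  Vertex : Set
  Vertex = Fin (n ℕ.* 2 ℕ.^ n)

  open Inverse Fin.2↔Bool using () renaming
    (to to fromBit; from to toBit; strictlyInverseˡ to fromBit-toBit; strictlyInverseʳ to toBit-fromBit)

  base : Vertex → Fin n
  base v = proj₁ (remQuot (2 ℕ.^ n) v)

  bits : Vertex → Fin n → Bool
  bits v = fromBit ∘ finToFun (proj₂ (remQuot {n} (2 ℕ.^ n) v))

  vertex : Fin n → (Fin n → Bool) → Vertex
  vertex i x = combine i (funToFin (toBit ∘ x))

  base-vertex : ∀ i x → base (vertex i x) ≡ i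
  base-vertex i x = cong proj₁ (Fin.remQuot-combine i (funToFin (toBit ∘ x)))

  bits-vertex : ∀ i x j → bits (vertex i x) j ≡ x j
  bits-vertex i x j = trans (cong (λ q → fromBit (finToFun (proj₂ q) j)) (Fin.remQuot-combine i (funToFin (toBit ∘ x))))
    (trans (cong fromBit (Fin.finToFun-funToFin (toBit ∘ x) j)) (fromBit-toBit (x j)))

  funToFin-cong : ∀ {m k} {f g : Fin m → Fin k} → (∀ i → f i ≡ g i) → funToFin f ≡ funToFin g
  funToFin-cong {zero}  h = refl
  funToFin-cong {suc m} h = cong₂ combine (h zero) (funToFin-cong (h ∘ suc))

  vertex-base-bits : ∀ v {x} → (∀ j → x j ≡ bits v j) → vertex (base v) x ≡ v
  vertex-base-bits v h = trans (cong (combine (base v)) (trans (funToFin-cong (λ j → trans (cong toBit (h j)) (toBit-fromBit _)))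
    (Fin.funToFin-finToFin {n} {2} (proj₂ (remQuot {n} (2 ℕ.^ n) v))))) (Fin.combine-remQuot {n} (2 ℕ.^ n) v)

  vertex-≡ : ∀ u v → base u ≡ base v → (∀ j → bits u j ≡ bits v j) → u ≡ v
  vertex-≡ u v p q = trans (sym (vertex-base-bits u (λ _ → refl))) (trans (cong (λ i → vertex i (bits u)) p) (vertex-base-bits v q))

  module _ (χ : Fin n → Bool) where

    Valid : Vertex → Set
    Valid v = bits v (base v) ≡ false × parity (bits v) ≡ χ (base v)

    Adjacent : Vertex → Vertex → Set
    Adjacent u v = base u ≢ base v × Valid u × Valid v × bits u (base v) ≡ bits v (base u)

    cfi : SimpleGraph
    cfi = record
      { order       = n ℕ.* 2 ℕ.^ n
      ; Adj         = Adjacent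
      ; adj?        = λ u v → ¬? (base u Fin.≟ base v) ×-dec valid? u ×-dec valid? v ×-dec (bits u (base v) Bool.≟ bits v (base u))
      ; symmetric   = λ (p , q , r , s) → p ∘ sym , r , q , sym s
      ; irreflexive = λ { refl (p , _) → p refl }
      }
      where
      valid? : ∀ v → Dec (Valid v)
      valid? v = (bits v (base v) Bool.≟ false) ×-dec (parity (bits v) Bool.≟ χ (base v))

    -- Each edge contributes to the parity at both of its ends, so the charges sum to zero.
    no-clique : 1 < n → parity χ ≡ true → ∀ (v : Fin n → Vertex) → (∀ i j → i ≢ j → Adjacent (v i) (v j)) → Empty
    no-clique 1<n odd v adj = true≢false (trans (sym odd) (trans (parity-cong (λ b → sym (proj₂ (valid b))))
        (symmetric-parity (λ b → bits (w b)) (λ b b′ b≢b′ → sym (edge b b′ b≢b′)) (λ b → proj₁ (valid b)))))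
      where
      true≢false : true ≢ false
      true≢false ()
      v-injective : ∀ {i j} → base (v i) ≡ base (v j) → i ≡ j
      v-injective {i} {j} eq with i Fin.≟ j
      ... | yes p = p
      ... | no i≢j = ⊥-elim (proj₁ (adj i j i≢j) eq)
      at : ∀ b → ∃ λ i → base (v i) ≡ b
      at = injective⇒surjective (base ∘ v) v-injective
      w : Fin n → Vertex
      w b = v (proj₁ (at b))
      at-≢ : ∀ {b b′} → b ≢ b′ → proj₁ (at b) ≢ proj₁ (at b′)
      at-≢ {b} {b′} b≢b′ eq = b≢b′ (trans (sym (proj₂ (at b))) (trans (cong (base ∘ v) eq) (proj₂ (at b′))))
      edge : ∀ b b′ → b ≢ b′ → bits (w b′) b ≡ bits (w b) b′
      edge b b′ b≢b′ = sym (subst₂ (λ i j → bits (w b) j ≡ bits (w b′) i) (proj₂ (at b)) (proj₂ (at b′))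
        (proj₂ (proj₂ (proj₂ (adj (proj₁ (at b)) (proj₁ (at b′)) (at-≢ b≢b′))))))
      -- Validity of `w b` is available only inside an adjacency, so a second base vertex is needed;
      -- this is the use of `1<n`.
      other : ∀ b → ∃ λ b′ → b ≢ b′
      other b with b′ , b′∉ ← free-index (b ∷ []) 1<n = b′ , λ eq → b′∉ (here (sym eq))
      valid : ∀ b → bits (w b) b ≡ false × parity (bits (w b)) ≡ χ b
      valid b with b′ , b≢b′ ← other b = subst (λ i → bits (w b) i ≡ false × parity (bits (w b)) ≡ χ i) (proj₂ (at b))
        (proj₁ (proj₂ (adj (proj₁ (at b)) (proj₁ (at b′)) (at-≢ b≢b′))))

  even : Fin n → Bool
  even _ = false

  parity-even : parity even ≡ false
  parity-even = ∑₂.∑-zero (allFin n) (λ _ → refl)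

  clique : List Vertex
  clique = map (λ i → vertex i even) (allFin n)

  clique-adjacent : AllPairs (Adjacent even) clique
  clique-adjacent = AllPairs.map⁺ (AllPairs.map (λ {i} {j} i≢j →
      (λ eq → i≢j (trans (sym (base-vertex i even)) (trans eq (base-vertex j even)))) ,
      valid i , valid j , trans (bits-vertex i even _) (sym (bits-vertex j even _))) (Unique.allFin⁺ n))
    where
    valid : ∀ i → Valid even (vertex i even)
    valid i = bits-vertex i even _ , trans (parity-cong (bits-vertex i even)) parity-even

  -- Duplicator's strategy by twisting

  module _ (χ : Fin n → Bool) where

    Shift : Set
    Shift = Vertex × Vertex

    at : Shift → Fin n
    at = base ∘ proj₁

    diff : Shift → Fin n → Bool
    diff (u , v) j = bits u j xor bits v j

    -- The second vertex is the first one twisted by the row `diff`. Parity χ for the row is what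
    -- exchanges validity for charge zero with validity for charge χ.
    Proper : Shift → Set
    Proper p = base (proj₂ p) ≡ at p × diff p (at p) ≡ false × parity (diff p) ≡ χ (at p)

    -- The rows are parts of one symmetric 0/1 matrix with row parities χ. For odd total charge no
    -- complete such matrix exists, so Duplicator maintains only the rows in use.
    Compatible : Shift → Shift → Set
    Compatible p q = diff p (at q) ≡ diff q (at p) × (at p ≡ at q → ∀ j → diff p j ≡ diff q j)

    Consistent : List Shift → Set
    Consistent l = All (λ p → Proper p × All (Compatible p) l) l

    consistent? : ∀ l → Dec (Consistent l)
    consistent? l = All.all? (λ p → (base (proj₂ p) Fin.≟ at p ×-dec (diff p (at p) Bool.≟ false) ×-dec (parity (diff p) Bool.≟ χ (at p)))
      ×-dec All.all? (λ q → (diff p (at q) Bool.≟ diff q (at p)) ×-dec ((at p Fin.≟ at q) →-dec Fin.all? (λ j → diff p j Bool.≟ diff q j))) l) l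

    module _ {l} (cons : Consistent l) where
      proper : ∀ {p} → p ∈ l → Proper p
      proper p∈ = proj₁ (All.lookup cons p∈)
      compatible : ∀ {p q} → p ∈ l → q ∈ l → Compatible p q
      compatible p∈ q∈ = All.lookup (proj₂ (All.lookup cons p∈)) q∈

    consistent : ∀ {l} → (∀ {p} → p ∈ l → Proper p) → (∀ {p q} → p ∈ l → q ∈ l → Compatible p q) → Consistent l
    consistent f g = All.tabulate (λ p∈ → f p∈ , All.tabulate (g p∈))

    consistent-≡ : ∀ {l p q} → Consistent l → p ∈ l → q ∈ l → proj₁ p ≡ proj₁ q ⇔ proj₂ p ≡ proj₂ q
    consistent-≡ {l} {p} {q} cons p∈ q∈ = mk⇔
      (λ eq → vertex-≡ (proj₂ p) (proj₂ q) (trans bp (trans (cong base eq) (sym bq)))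
        (λ j → xor-transfer (proj₂ (compatible cons p∈ q∈) (cong base eq) j) (cong (λ v → bits v j) eq)))
      (λ eq → vertex-≡ (proj₁ p) (proj₁ q) (trans (sym bp) (trans (cong base eq) bq))
        (λ j → xor-transfer′ (proj₂ (compatible cons p∈ q∈) (trans (sym bp) (trans (cong base eq) bq)) j) (cong (λ v → bits v j) eq)))
      where
      bp = proj₁ (proper cons p∈)
      bq = proj₁ (proper cons q∈)

    -- Adjacency compares two labels of the same edge, and compatible rows flip both or neither.
    consistent-adj : ∀ {l p q} → Consistent l → p ∈ l → q ∈ l →
                     Adjacent even (proj₁ p) (proj₁ q) ⇔ Adjacent χ (proj₂ p) (proj₂ q)
    consistent-adj {l} {p} {q} cons p∈ q∈ = mk⇔
      (λ (a , b , c , d) → (λ eq → a (trans (sym bp) (trans eq bq))) , valid⇒ p∈ b , valid⇒ q∈ c ,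
        subst₂ (λ i j → bits (proj₂ p) i ≡ bits (proj₂ q) j) (sym bq) (sym bp) (xor-transfer dd d))
      (λ (a , b , c , d) → (λ eq → a (trans bp (trans eq (sym bq)))) , ⇒valid p∈ b , ⇒valid q∈ c ,
        xor-transfer′ dd (subst₂ (λ i j → bits (proj₂ p) i ≡ bits (proj₂ q) j) bq bp d))
      where
      bp = proj₁ (proper cons p∈)
      bq = proj₁ (proper cons q∈)
      dd = proj₁ (compatible cons p∈ q∈)
      parities : ∀ {r} → r ∈ l → parity (bits (proj₁ r)) xor parity (bits (proj₂ r)) ≡ false xor χ (at r)
      parities {r} r∈ = trans (sym (parity-xor (bits (proj₁ r)) (bits (proj₂ r)))) (proj₂ (proj₂ (proper cons r∈)))
      valid⇒ : ∀ {r} → r ∈ l → Valid even (proj₁ r) → Valid χ (proj₂ r)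
      valid⇒ {r} r∈ (a , b) = subst (λ i → bits (proj₂ r) i ≡ false × parity (bits (proj₂ r)) ≡ χ i) (sym (proj₁ (proper cons r∈)))
        (trans (sym (xor≡false⇒≡ (proj₁ (proj₂ (proper cons r∈))))) a , xor-transfer (parities r∈) b)
      ⇒valid : ∀ {r} → r ∈ l → Valid χ (proj₂ r) → Valid even (proj₁ r)
      ⇒valid {r} r∈ v with a , b ← subst (λ i → bits (proj₂ r) i ≡ false × parity (bits (proj₂ r)) ≡ χ i) (proj₁ (proper cons r∈)) v =
        trans (xor≡false⇒≡ (proj₁ (proj₂ (proper cons r∈)))) a , xor-transfer′ (parities r∈) b

    -- The row prescribed at the bases in use is corrected to the right parity at an unused base.
    record Row (l : List Shift) (j : Fin n) : Set where
      field
        row       : Fin n → Bool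
        row-at    : ∀ {q} → q ∈ l → row (at q) ≡ diff q j
        row-zero  : row j ≡ false
        row-odd   : parity row ≡ χ j
        row-agree : ∀ {q} → q ∈ l → j ≡ at q → ∀ i → row i ≡ diff q i

    extend : ∀ {l} → Consistent l → length l < n ℕ.∸ 1 → ∀ j → Row l j
    extend {l} cons l< j with Any.any? (λ p → at p Fin.≟ j) l
    ... | yes found with p , p∈ , refl ← find found = record
      { row       = diff p
      ; row-at    = λ q∈ → proj₁ (compatible cons p∈ q∈)
      ; row-zero  = proj₁ (proj₂ (proper cons p∈))
      ; row-odd   = proj₂ (proj₂ (proper cons p∈))
      ; row-agree = λ q∈ → proj₂ (compatible cons p∈ q∈)
      }
    ... | no none = record
      { row       = λ i → r i xor s i
      ; row-at    = λ {q} q∈ → trans (cong₂ _xor_ (r-at q∈) (s-off (λ eq → i*∉ (there (subst (_∈ map at l) eq (∈-map⁺ at q∈)))))) (Bool.xor-identityʳ _)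
      ; row-zero  = trans (cong₂ _xor_ r-j (s-off (λ eq → i*∉ (here (sym eq))))) refl
      ; row-odd   = trans (parity-xor r s) (trans (cong (parity r xor_) (parity-single i* (parity r xor χ j))) (xor-cancelˡ (parity r) (χ j)))
      ; row-agree = λ q∈ eq → ⊥-elim (none (lose q∈ (sym eq)))
      }
      where
      -- Together with j, fewer than n - 1 pairs occupy fewer than n base vertices, so one remains
      -- free to absorb the parity. This fixes the level at n - 1.
      enough : length (j ∷ map at l) < n
      enough = subst (λ m → suc m < n) (sym (List.length-map at l)) (suc-< n l<)
        where
        suc-< : ∀ n → length l < n ℕ.∸ 1 → suc (length l) < n
        suc-< (suc n) p = s≤s p
      i* : Fin n
      i* = proj₁ (free-index (j ∷ map at l) enough)
      i*∉ : i* ∉ j ∷ map at l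
      i*∉ = proj₂ (free-index (j ∷ map at l) enough)
      -- Symmetry prescribes the entry at every base in use; the default zero elsewhere covers the
      -- diagonal entry at j.
      r : Fin n → Bool
      r i with Any.any? (λ p → at p Fin.≟ i) l
      ... | yes found = diff (proj₁ (find found)) j
      ... | no _      = false
      s : Fin n → Bool
      s i = if does (i Fin.≟ i*) then parity r xor χ j else false
      s-off : ∀ {i} → i ≢ i* → s i ≡ false
      s-off {i} i≢ with i Fin.≟ i*
      ... | yes p = ⊥-elim (i≢ p)
      ... | no _  = refl
      r-at : ∀ {q} → q ∈ l → r (at q) ≡ diff q j
      r-at {q} q∈ with Any.any? (λ p → at p Fin.≟ at q) l
      ... | yes found with p , p∈ , eq ← find found = proj₂ (compatible cons p∈ q∈) eq j
      ... | no ¬found = ⊥-elim (¬found (lose q∈ refl))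
      r-j : r j ≡ false
      r-j with Any.any? (λ p → at p Fin.≟ j) l
      ... | yes found = ⊥-elim (none found)
      ... | no _      = refl

    module _ {l} (cons : Consistent l) (l< : length l < n ℕ.∸ 1) where
      open module R j = Row (extend cons l< j)

      -- Duplicator's bijection: each vertex is twisted by the row at its base. Adding the same row
      -- twice cancels, so the map is its own inverse.
      shift : Vertex → Vertex
      shift v = vertex (base v) (λ i → bits v i xor row (base v) i)

      shift-involutive : ∀ v → shift (shift v) ≡ v
      shift-involutive v = trans (cong (λ b → vertex b (λ i → bits (shift v) i xor row b i)) (base-vertex (base v) _))
        (vertex-base-bits v (λ i → trans (cong (_xor row (base v) i) (bits-vertex (base v) _ i)) (cancel (bits v i) (row (base v) i))))
        where
        cancel : ∀ a b → (a xor b) xor b ≡ a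
        cancel a b = trans (Bool.xor-assoc a b b) (trans (cong (a xor_) (Bool.xor-same b)) (Bool.xor-identityʳ a))

      diff-shift : ∀ v i → diff (v , shift v) i ≡ row (base v) i
      diff-shift v i = trans (cong (bits v i xor_) (bits-vertex (base v) _ i)) (xor-cancelˡ (bits v i) (row (base v) i))

      shift-consistent : ∀ v → Consistent ((v , shift v) ∷ l)
      shift-consistent v = consistent
        (λ { (here refl) → base-vertex (base v) _ , trans (diff-shift v (base v)) (row-zero (base v)) ,
               trans (parity-cong (diff-shift v)) (row-odd (base v))
           ; (there p∈)  → proper cons p∈ })
        (λ { (here refl) (here refl) → refl , λ _ _ → refl
           ; (here refl) (there q∈)  → trans (diff-shift v _) (row-at (base v) q∈) ,
               λ eq i → trans (diff-shift v i) (row-agree (base v) q∈ eq i)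
           ; (there p∈)  (here refl) → sym (trans (diff-shift v _) (row-at (base v) p∈)) ,
               λ eq i → sym (trans (diff-shift v i) (row-agree (base v) p∈ (sym eq) i))
           ; (there p∈)  (there q∈)  → compatible cons p∈ q∈ })

    cfi-backAndForth : BackAndForth (orders (cfi even) (cfi χ)) (adjacency (cfi even) (cfi χ)) (n ℕ.∸ 1)
    cfi-backAndForth = record
      { S     = Consistent
      ; S?    = consistent?
      ; S-[]  = []
      ; S-⊆   = λ sub cons → consistent (λ p∈ → proper cons (sub p∈)) (λ p∈ q∈ → compatible cons (sub p∈) (sub q∈))
      ; S-≡   = λ {l} {p} {q} cons p∈ q∈ → ⇔⇒does-≡ (proj₁ p Fin.≟ proj₁ q) (proj₂ p Fin.≟ proj₂ q) (consistent-≡ cons p∈ q∈)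
      ; S-E   = λ {l} {p} {q} cons p∈ q∈ → ⇔⇒does-≡ (SimpleGraph.adj? (cfi even) (proj₁ p) (proj₁ q)) (SimpleGraph.adj? (cfi χ) (proj₂ p) (proj₂ q)) (consistent-adj cons p∈ q∈)
      ; S-ext = λ {l} cons l< φ ψ h → begin
          ∑ℚ.∑ vs φ                     ≡⟨ ∑ℚ.∑-cong vs (λ v → h v (shift cons l< v) (shift-consistent cons l< v)) ⟩
          ∑ℚ.∑ vs (ψ ∘ shift cons l<)   ≡⟨ ∑ℚ.sum≡∑ {n ℕ.* 2 ℕ.^ n} (ψ ∘ shift cons l<) ⟨
          sumℚ (ψ ∘ shift cons l<)      ≡⟨ sum-permute ψ (permutation (shift cons l<) (shift cons l<) (shift-involutive cons l<) (shift-involutive cons l<)) ⟨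
          sumℚ ψ                        ≡⟨ ∑ℚ.sum≡∑ {n ℕ.* 2 ℕ.^ n} ψ ⟩
          ∑ℚ.∑ vs ψ                     ∎
      }
      where
      open ≡-Reasoning
      open Sum (CommutativeRing.+-commutativeMonoid ℚ.+-*-commutativeRing) using (sum-permute)
      vs = allFin (n ℕ.* 2 ℕ.^ n)

-- Consequences of the Lasserre system

module _ where
  open CommutativeRing ℝ-commutativeRing hiding (zero; refl; sym; trans)
  open CommutativeRing ℝ-commutativeRing using () renaming (refl to ≈-refl; sym to ≈-sym; trans to ≈-trans)
  open ∑ℝ
  open import Relation.Binary.Reasoning.Setoid setoid
  open import Data.Fin.Subset using (∣_∣)
  open +-*-Solver using (solve; _:=_; _:+_; _:*_; :-_; _:-_; con)

  ∈-allSubsets : ∀ {n} (I : Subset n) → I ∈ allSubsets n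
  ∈-allSubsets Vec.[]             = here refl
  ∈-allSubsets (outside Vec.∷ I) = ∈-++⁺ˡ (∈-map⁺ (outside Vec.∷_) (∈-allSubsets I))
  ∈-allSubsets (inside  Vec.∷ I) = ∈-++⁺ʳ (map (outside Vec.∷_) (allSubsets _)) (∈-map⁺ (inside Vec.∷_) (∈-allSubsets I))

  subsets≤-index : ∀ {n} t (I : Subset n) → ∣ I ∣ ≤ t → ∃ λ i → lookup (subsets≤ n t) i ≡ I
  subsets≤-index t I I≤t = Any.index I∈ , sym (Any.lookup-index I∈)
    where
    I∈ = ∈-filter⁺ (λ I → ∣ I ∣ ℕ.≤? t) (∈-allSubsets I) I≤t

  positive-combination : ∀ {n} {M : Fin n → Fin n → ℝ} → PositiveSemidefinite M → ∀ (fs : List (ℝ × Fin n)) →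
    0ℝ ≤ʳ ∑ fs (λ { (a , i) → a * ∑ fs (λ { (b , j) → b * M i j }) })
  positive-combination {n} {M} psd fs = 0≤ʳ-resp {quadratic} {∑ fs (λ { (a , i) → a * ∑ fs (λ { (b , j) → b * M i j }) })}
    (unwrap eq) (PositiveSemidefinite.nonNegative psd x)
    where
    is = allFin n
    x : Fin n → ℝ
    x i = ∑ fs (λ { (a , j) → a * 𝟙 (i Fin.≟ j) })
    quadratic : ℝ
    quadratic = sumℝ (λ i → sumℝ (λ j → x i *ʳ M i j *ʳ x j))
    push : ∀ (f : Fin n → ℝ) → ∑ is (λ i → x i * f i) ≈ ∑ fs (λ { (a , i) → a * f i })
    push f = begin
      ∑ is (λ i → x i * f i)
        ≈⟨ ∑-cong is (λ i → *-distribʳ-∑ fs (f i) _) ⟩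
      ∑ is (λ i → ∑ fs (λ { (a , j) → a * 𝟙 (i Fin.≟ j) * f i }))
        ≈⟨ ∑-swap is fs _ ⟩
      ∑ fs (λ { (a , j) → ∑ is (λ i → a * 𝟙 (i Fin.≟ j) * f i) })
        ≈⟨ ∑-cong fs (λ { (a , j) → ≈-trans (∑-cong is (λ i → *-assoc a (𝟙 (i Fin.≟ j)) (f i)))
             (≈-trans (≈-sym (*-distribˡ-∑ is a _)) (*-congˡ (∑-δ Fin._≟_ f (Unique.allFin⁺ n) (∈-allFin j)))) }) ⟩
      ∑ fs (λ { (a , i) → a * f i })
        ∎
    eq : quadratic ≈ ∑ fs (λ { (a , i) → a * ∑ fs (λ { (b , j) → b * M i j }) })
    eq = begin
      quadratic
        ≡⟨ sum≡∑ {n} (λ i → sumℝ (λ j → x i *ʳ M i j *ʳ x j)) ⟩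
      ∑ is (λ i → sumℝ (λ j → x i *ʳ M i j *ʳ x j))
        ≈⟨ ∑-cong is (λ i → ≈-trans (reflexive (sum≡∑ {n} (λ j → x i *ʳ M i j *ʳ x j)))
             (≈-trans (∑-cong is (λ j → ≈-trans (*-assoc (x i) (M i j) (x j)) (*-congˡ (*-comm (M i j) (x j))))) (≈-sym (*-distribˡ-∑ is (x i) _)))) ⟩
      ∑ is (λ i → x i * ∑ is (λ j → x j * M i j))
        ≈⟨ push _ ⟩
      ∑ fs (λ { (a , i) → a * ∑ is (λ j → x j * M i j) })
        ≈⟨ ∑-cong fs (λ { (a , i) → *-congˡ (push (M i)) }) ⟩
      ∑ fs (λ { (a , i) → a * ∑ fs (λ { (b , j) → b * M i j }) })
        ∎

  module _ {G H : SimpleGraph} where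
    open PairSets G H

    sheraliAdams⇒real : ∀ {k y} → 1 ≤ k → IsSheraliAdamsSolution k G H y → RealSolution G H k (fromℚ ∘ y)
    sheraliAdams⇒real {suc k} {y} _ sol = record
      { nonNegative = λ I I≤ ε ε>0 → 0 , λ _ _ → ℚ.≤-trans (nonNegative I I≤) (≤-+ (y I) (ℚ.<⇒≤ ε>0))
      ; sumH   = λ { I (s≤s I≤) g → ≈-trans (reflexive (sym (sum≡∑ {order H} _)))
                       (≡⇒≋ (λ n → trans (seq-sumℝ {order H} (λ h → fromℚ (y (I ∪ ⁅ combine g h ⁆))) n) (sumH I I≤ g))) }
      ; sumG   = λ { I (s≤s I≤) h → ≈-trans (reflexive (sym (sum≡∑ {order G} _)))
                       (≡⇒≋ (λ n → trans (seq-sumℝ {order G} (λ g → fromℚ (y (I ∪ ⁅ combine g h ⁆))) n) (sumG I I≤ h))) }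
      ; vanish = λ I I≤ ¬PI → ≡⇒≋ (λ _ → vanish I I≤ ¬PI)
      ; empty  = ≡⇒≋ (λ _ → empty)
      }
      where open IsSheraliAdamsSolution sol

    module LasserreSolution {t} (1≤t : 1 ≤ t) {y : PairSet G H → ℝ} (sol : IsLasserreSolution t G H y) where
      open IsLasserreSolution sol

      t≤2t : t ≤ 2 ℕ.* t
      t≤2t = ℕ.m≤m+n t _

      -- Adding `m + 1 ≤ t` and `1 ≤ t` gives `m + 2 ≤ 2t`; sets of fewer than t pairs therefore
      -- fall under the sum constraints even for t = 1.
      <t⇒≤2t∸2 : ∀ {m} → m < t → m ≤ 2 ℕ.* t ℕ.∸ 2
      <t⇒≤2t∸2 {m} m<t = ℕ.≤-trans (ℕ.≤-reflexive (sym (ℕ.m+n∸n≡m m 2))) (ℕ.∸-monoˡ-≤ 2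
        (subst₂ _≤_ (sym (ℕ.+-comm m 2)) (cong (t ℕ.+_) (sym (ℕ.+-identityʳ t)))
          (subst (_≤ t ℕ.+ t) (ℕ.+-comm (suc m) 1) (ℕ.+-mono-≤ m<t 1≤t))))

      ∑-yʰ : ∀ I → ∣ I ∣ ≤ 2 ℕ.* t ℕ.∸ 2 → ∀ (g : V G) → ∑ (allFin (order H)) (λ h → y (I ∪ ⁅ combine g h ⁆)) ≈ y I
      ∑-yʰ I I≤ g = ≈-trans (reflexive (sym (sum≡∑ {order H} _))) (wrap (sumH I I≤ g))

      ∑-yᵍ : ∀ I → ∣ I ∣ ≤ 2 ℕ.* t ℕ.∸ 2 → ∀ (h : V H) → ∑ (allFin (order G)) (λ g → y (I ∪ ⁅ combine g h ⁆)) ≈ y I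
      ∑-yᵍ I I≤ h = ≈-trans (reflexive (sym (sum≡∑ {order G} _))) (wrap (sumG I I≤ h))

      y-diagonal : ∀ I → ∣ I ∣ ≤ t → 0ℝ ≤ʳ y I
      y-diagonal I I≤ with i , refl ← subsets≤-index t I I≤ = 0≤ʳ-resp {1ℝ * (1ℝ * M + 0ℝ) + 0ℝ} {y (lookup (subsets≤ _ t) i)}
        (unwrap (≈-trans (+-identityʳ _) (≈-trans (*-identityˡ _) (≈-trans (+-identityʳ _) (≈-trans (*-identityˡ _) (reflexive (cong y (Subset.∪-idem _))))))))
        (positive-combination psd ((1ℝ , i) ∷ []))
        where M = momentMatrix t y i i

      -- Nonnegativity comes from the diagonal of the moment matrix, whose rows are indexed by sets
      -- of at most t pairs; hence level t.
      lasserre⇒real : RealSolution G H t y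
      lasserre⇒real = record
        { nonNegative = y-diagonal
        ; sumH   = λ I I<t → ∑-yʰ I (<t⇒≤2t∸2 I<t)
        ; sumG   = λ I I<t → ∑-yᵍ I (<t⇒≤2t∸2 I<t)
        ; vanish = λ I I≤ ¬PI → wrap (vanish I (ℕ.≤-trans I≤ t≤2t) ¬PI)
        ; empty  = wrap empty
        }

      Y : Pairs G H → ℝ
      Y l = y (set l)

      Combination : Set
      Combination = List (ℝ × Pairs G H)

      Bounded : Combination → Set
      Bounded fs = ∀ {a l} → (a , l) ∈ fs → length l ≤ t

      -- The row of the moment form belonging to the combination `fs`, evaluated at `m`.
      ev : Combination → Pairs G H → ℝ
      ev fs m = ∑ fs (λ { (a , l) → a * Y (l ++ m) })

      form : Combination → Combination → ℝ
      form fs gs = ∑ gs (λ { (b , m) → b * ev fs m })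

      form-positive : ∀ fs → Bounded fs → 0ℝ ≤ʳ form fs fs
      form-positive fs bd = 0≤ʳ-resp {∑ is (λ { (a , i) → a * ∑ is (λ { (b , j) → b * momentMatrix t y i j }) })} {form fs fs}
        (unwrap (indices fs id)) (positive-combination psd is)
        where
        index : ∀ gs → gs ⊆ fs → List (ℝ × Fin (length (subsets≤ (order G ℕ.* order H) t)))
        index []             sub = []
        index ((a , l) ∷ gs) sub = (a , proj₁ (subsets≤-index t (set l) (ℕ.≤-trans (∣set∣≤ l) (bd (sub (here refl)))))) ∷ index gs (sub ∘ there)
        ∑-index : ∀ gs (sub : gs ⊆ fs) (f : ℝ → PairSet G H → ℝ) →
                  ∑ (index gs sub) (λ { (a , i) → f a (lookup (subsets≤ _ t) i) }) ≈ ∑ gs (λ { (a , l) → f a (set l) })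
        ∑-index []             sub f = ≈-refl
        ∑-index ((a , l) ∷ gs) sub f = +-cong (reflexive (cong (f a) (proj₂ (subsets≤-index t (set l) _)))) (∑-index gs (sub ∘ there) f)
        is = index fs id
        indices : ∀ gs (sub : gs ⊆ fs) →
          ∑ (index gs sub) (λ { (a , i) → a * ∑ is (λ { (b , j) → b * momentMatrix t y i j }) }) ≈ ∑ gs (λ { (b , m) → b * ev fs m })
        indices gs sub = ≈-trans (∑-index gs sub (λ a I → a * ∑ is (λ { (b , j) → b * y (I ∪ lookup (subsets≤ _ t) j) })))
          (∑-cong gs (λ { (a , l) → *-congˡ (≈-trans (∑-index fs id (λ b J → b * y (set l ∪ J)))
            (∑-cong fs (λ { (b , m) → *-congˡ (reflexive (cong y (trans (Subset.∪-comm (set l) (set m)) (set-++ m l)))) }))) }))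

      Y-cong : ∀ {l m} → l ⊆ m → m ⊆ l → Y l ≈ Y m
      Y-cong {l} {m} p q = reflexive (cong y (set-cong {l} {m} p q))

      -- A combination orthogonal to its own terms is a null vector of the form, hence in its radical.
      self-orthogonal⇒null : ∀ fs → Bounded fs → (∀ {b m} → (b , m) ∈ fs → ev fs m ≈ 0#) →
                             ∀ m → length m ≤ t → ev fs m ≈ 0#
      self-orthogonal⇒null fs bd orth m m≤t = begin
        ev fs m                            ≈⟨ ≡⇒≋ (λ n → halve (seq (ev fs m) n)) ⟩
        fromℚ ½ * (ev fs m + ev fs m)      ≈⟨ *-congˡ (wrap (≃0-unscale {Y (m ++ m)} {ev fs m + ev fs m} positive)) ⟩
        fromℚ ½ * 0ℝ                       ≈⟨ zeroʳ (fromℚ ½) ⟩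
        0ℝ                                 ∎
        where
        halve : ∀ e → e ≡ ½ ℚ.* (e ℚ.+ e)
        halve = solve 1 (λ e → e := con ½ :* (e :+ e)) refl
        scale : ℝ → ℝ × Pairs G H → ℝ × Pairs G H
        scale q (a , l) = q * a , l
        -- The test vector is m + q fs. As the form vanishes on `fs` itself, its value is affine in
        -- q with slope twice `ev fs m`, and nonnegativity for every rational q forces slope zero.
        hs : ℝ → Combination
        hs q = (1ℝ , m) ∷ map (scale q) fs
        bdh : ∀ q → Bounded (hs q)
        bdh q (here refl) = m≤t
        bdh q (there p) with (a , l) , al∈ , refl ← ∈-map⁻ (scale q) p = bd al∈
        ev-hs : ∀ q x → ev (hs q) x ≈ Y (m ++ x) + q * ev fs x
        ev-hs q x = +-cong (*-identityˡ (Y (m ++ x))) (≈-trans (reflexive (∑-map fs (scale q) _))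
          (≈-trans (∑-cong fs (λ { (a , l) → *-assoc q a (Y (l ++ x)) })) (≈-sym (*-distribˡ-∑ fs q _))))
        expand : ∀ q → form (hs q) (hs q) ≈ Y (m ++ m) + q * (ev fs m + ev fs m)
        expand q = begin
          1ℝ * ev (hs q) m + ∑ (map (scale q) fs) (λ { (a , l) → a * ev (hs q) l })
            ≈⟨ +-cong (≈-trans (*-identityˡ (ev (hs q) m)) (ev-hs q m)) (reflexive (∑-map fs (scale q) _)) ⟩
          Y (m ++ m) + q * ev fs m + ∑ fs (λ { (a , l) → q * a * ev (hs q) l })
            ≈⟨ +-congˡ (≈-trans (∑-cong∈ fs (λ { {a , l} al∈ → ≈-trans (*-assoc q a (ev (hs q) l)) (*-congˡ (*-congˡ
                 (≈-trans (ev-hs q l) (≈-trans (+-congˡ (≈-trans (*-congˡ (orth al∈)) (zeroʳ q))) (≈-trans (+-identityʳ (Y (m ++ l)))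
                   (reflexive (cong y (trans (sym (set-++ m l)) (trans (Subset.∪-comm (set m) (set l)) (set-++ l m))))))))))  }))
               (≈-sym (*-distribˡ-∑ fs q _))) ⟩
          Y (m ++ m) + q * ev fs m + q * ev fs m
            ≈⟨ +-assoc (Y (m ++ m)) (q * ev fs m) (q * ev fs m) ⟩
          Y (m ++ m) + (q * ev fs m + q * ev fs m)
            ≈⟨ +-congˡ (≈-sym (distribˡ q (ev fs m) (ev fs m))) ⟩
          Y (m ++ m) + q * (ev fs m + ev fs m)
            ∎
        positive : ∀ q → 0ℝ ≤ʳ Y (m ++ m) +ʳ fromℚ q *ʳ (ev fs m + ev fs m)
        positive q = 0≤ʳ-resp {form (hs (fromℚ q)) (hs (fromℚ q))} {Y (m ++ m) + fromℚ q * (ev fs m + ev fs m)}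
          (unwrap (expand (fromℚ q))) (form-positive (hs (fromℚ q)) (bdh (fromℚ q)))

  module _ {A : Set} {R : A → A → Set} where

    AllPairs-++⁻ : ∀ xs {ys} → AllPairs R (xs ++ ys) → AllPairs R xs × AllPairs R ys × All (λ x → All (R x) ys) xs
    AllPairs-++⁻ []       Rys = [] , Rys , []
    AllPairs-++⁻ (x ∷ xs) (Rx ∷ R) with Rxs , Rys , Rxsys ← AllPairs-++⁻ xs R =
      All.++⁻ˡ xs Rx ∷ Rxs , Rys , All.++⁻ʳ xs Rx ∷ Rxsys

    AllPairs-glue : ∀ xs ys {zs} → AllPairs R (xs ++ ys) → AllPairs R (ys ++ zs) → AllPairs R (xs ++ zs) → AllPairs R (xs ++ ys ++ zs)
    AllPairs-glue xs ys p q r with Rxs , _ , Rxsys ← AllPairs-++⁻ xs p | _ , _ , Rxszs ← AllPairs-++⁻ xs r =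
      AllPairs.++⁺ Rxs q (All.zipWith (λ (a , b) → All.++⁺ a b) (Rxsys , Rxszs))

    AllPairs-lookup : Symmetric R → ∀ {xs} → AllPairs R xs → ∀ i j → i ≢ j → R (lookup xs i) (lookup xs j)
    AllPairs-lookup R-sym (Rx ∷ R) zero    zero    i≢j = ⊥-elim (i≢j refl)
    AllPairs-lookup R-sym (Rx ∷ R) zero    (suc j) i≢j = All.lookup Rx (∈-lookup j)
    AllPairs-lookup R-sym (Rx ∷ R) (suc i) zero    i≢j = R-sym (All.lookup Rx (∈-lookup i))
    AllPairs-lookup R-sym (Rx ∷ R) (suc i) (suc j) i≢j = AllPairs-lookup R-sym R i j (i≢j ∘ cong suc)

  AllPairs-map : ∀ {A B C : Set} {R : B → B → Set} {R′ : C → C → Set} (f : A → B) (g : A → C) l →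
                 (∀ {p q} → p ∈ l → q ∈ l → R (f p) (f q) → R′ (g p) (g q)) → AllPairs R (map f l) → AllPairs R′ (map g l)
  AllPairs-map f g []      h []       = []
  AllPairs-map f g (p ∷ l) h (Rp ∷ R) =
    All.map⁺ (All.tabulate (λ q∈ → h (here refl) (there q∈) (All.lookup (All.map⁻ Rp) q∈))) ∷
    AllPairs-map f g l (λ p∈ q∈ → h (there p∈) (there q∈)) R

  module _ {A B : Set} where

    map-proj₁-zip : ∀ (u : List A) (v : List B) → length u ≡ length v → map proj₁ (zip u v) ≡ u
    map-proj₁-zip []      []      _ = refl
    map-proj₁-zip (x ∷ u) (y ∷ v) p = cong (x ∷_) (map-proj₁-zip u v (ℕ.suc-injective p))

    map-proj₂-zip : ∀ (u : List A) (v : List B) → length u ≡ length v → map proj₂ (zip u v) ≡ v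
    map-proj₂-zip []      []      _ = refl
    map-proj₂-zip (x ∷ u) (y ∷ v) p = cong (y ∷_) (map-proj₂-zip u v (ℕ.suc-injective p))

    length-zip≤ˡ : ∀ (u : List A) (v : List B) → length (zip u v) ≤ length u
    length-zip≤ˡ u v = subst (_≤ length u) (sym (List.length-zipWith _,_ u v)) (ℕ.m⊓n≤m (length u) (length v))

    length-zip≤ʳ : ∀ (u : List A) (v : List B) → length (zip u v) ≤ length v
    length-zip≤ʳ u v = subst (_≤ length v) (sym (List.length-zipWith _,_ u v)) (ℕ.m⊓n≤n (length u) (length v))

  module _ {m n : ℕ} where

    -- A position where the two tuples differ gives two pairs with the same second entry and
    -- different first entries, which no partial isomorphism contains.
    zip-differˡ : ∀ (u u′ : List (Fin m)) (v : List (Fin n)) → length u ≡ length v → length u′ ≡ length v → u ≢ u′ →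
                  ∃ λ x → ∃ λ x′ → ∃ λ y → (x , y) ∈ zip u v × (x′ , y) ∈ zip u′ v × x ≢ x′
    zip-differˡ []      []        []      _ _ u≢u′ = ⊥-elim (u≢u′ refl)
    zip-differˡ (x ∷ u) (x′ ∷ u′) (y ∷ v) p q u≢u′ = by-head (x Fin.≟ x′)
      where
      by-head : Dec (x ≡ x′) → ∃ λ x″ → ∃ λ x‴ → ∃ λ z → (x″ , z) ∈ zip (x ∷ u) (y ∷ v) × (x‴ , z) ∈ zip (x′ ∷ u′) (y ∷ v) × x″ ≢ x‴
      by-head (no x≢x′) = x , x′ , y , here refl , here refl , x≢x′
      by-head (yes refl) with a , b , z , a∈ , b∈ , a≢b ← zip-differˡ u u′ v (ℕ.suc-injective p) (ℕ.suc-injective q) (u≢u′ ∘ cong (x ∷_)) =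
        a , b , z , there a∈ , there b∈ , a≢b

    zip-differʳ : ∀ (u : List (Fin m)) (v v′ : List (Fin n)) → length u ≡ length v → length u ≡ length v′ → v ≢ v′ →
                  ∃ λ y → ∃ λ y′ → ∃ λ x → (x , y) ∈ zip u v × (x , y′) ∈ zip u v′ × y ≢ y′
    zip-differʳ []      []      []        _ _ v≢v′ = ⊥-elim (v≢v′ refl)
    zip-differʳ (x ∷ u) (y ∷ v) (y′ ∷ v′) p q v≢v′ = by-head (y Fin.≟ y′)
      where
      by-head : Dec (y ≡ y′) → ∃ λ y″ → ∃ λ y‴ → ∃ λ z → (z , y″) ∈ zip (x ∷ u) (y ∷ v) × (z , y‴) ∈ zip (x ∷ u) (y′ ∷ v′) × y″ ≢ y‴
      by-head (no y≢y′) = y , y′ , x , here refl , here refl , y≢y′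
      by-head (yes refl) with a , b , z , a∈ , b∈ , a≢b ← zip-differʳ u v v′ (ℕ.suc-injective p) (ℕ.suc-injective q) (v≢v′ ∘ cong (y ∷_)) =
        a , b , z , there a∈ , there b∈ , a≢b

  0≤ʳ-𝟙 : ∀ {P Q : Set} (d : Dec P) (e : Dec Q) → 0ℝ ≤ʳ 𝟙 d * (𝟙 e * 1#)
  0≤ʳ-𝟙 d e = 0≤ʳ-resp-≋ (*-congˡ {𝟙 d} (≈-sym (*-identityʳ (𝟙 e)))) (nonneg d e)
    where
    0≤1 : 0ℝ ≤ʳ 1ℝ
    0≤1 ε ε>0 = 0 , λ _ _ → ℚ.≤-trans (ℚ.nonNegative⁻¹ 1ℚ) (≤-+ 1ℚ (ℚ.<⇒≤ ε>0))
    nonneg : ∀ {P Q : Set} (d : Dec P) (e : Dec Q) → 0ℝ ≤ʳ 𝟙 d * 𝟙 e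
    nonneg (yes _) (yes _) = 0≤ʳ-resp-≋ (≈-sym (*-identityˡ 1#)) 0≤1
    nonneg (yes _) (no _)  = 0≤ʳ-resp-≋ (≈-sym (zeroʳ 1#)) 0≤ʳ-refl
    nonneg (no _)  e       = 0≤ʳ-resp-≋ (≈-sym (zeroˡ (𝟙 e))) 0≤ʳ-refl

  Clique : (X : SimpleGraph) → List (V X) → Set
  Clique X = AllPairs (Adj X)

  clique? : ∀ X l → Dec (Clique X l)
  clique? X = allPairs? (SimpleGraph.adj? X)

  -- Cliques seen through Lasserre moments

  module Separation {G H t} (1≤t : 1 ≤ t) {y : PairSet G H → ℝ} (sol : IsLasserreSolution t G H y) where
    open PairSets G H
    open LasserreSolution {G} {H} 1≤t sol
    open IsLasserreSolution sol using (vanish; empty)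

    t+t≤2t : t ℕ.+ t ≤ 2 ℕ.* t
    t+t≤2t = ℕ.≤-reflexive (cong (t ℕ.+_) (sym (ℕ.+-identityʳ t)))

    ++≤2t : ∀ (l m : Pairs G H) → length l ≤ t → length m ≤ t → length (l ++ m) ≤ 2 ℕ.* t
    ++≤2t l m l≤ m≤ = subst (_≤ 2 ℕ.* t) (sym (List.length-++ l)) (ℕ.≤-trans (ℕ.+-mono-≤ l≤ m≤) t+t≤2t)

    Y-vanish : ∀ l → length l ≤ 2 ℕ.* t → ¬ PartialIsomorphism G H (set l) → Y l ≈ 0#
    Y-vanish l l≤ ¬PI = wrap (vanish (set l) (ℕ.≤-trans (∣set∣≤ l) l≤) ¬PI)

    Y-conflict : ∀ {l p q} → length l ≤ 2 ℕ.* t → p ∈ l → q ∈ l → ¬ (proj₁ p ≡ proj₁ q ⇔ proj₂ p ≡ proj₂ q) → Y l ≈ 0#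
    Y-conflict {l} {p} {q} l≤ p∈ q∈ ¬iff = Y-vanish l l≤ (λ PI →
      ¬iff (proj₁ (PI (proj₁ p) (proj₁ q) (proj₂ p) (proj₂ q) (∈-set⁺ {l = l} p∈) (∈-set⁺ {l = l} q∈))))

    -- Either the pairs form a partial isomorphism, which preserves cliques in both directions, or
    -- the moment is zero.
    Y-clique : ∀ l → length l ≤ 2 ℕ.* t → 𝟙 (clique? G (map proj₁ l)) * Y l ≈ 𝟙 (clique? H (map proj₂ l)) * Y l
    Y-clique l l≤ = by-cases (partialIsomorphism? G H (set l))
      where
      by-cases : Dec (PartialIsomorphism G H (set l)) → 𝟙 (clique? G (map proj₁ l)) * Y l ≈ 𝟙 (clique? H (map proj₂ l)) * Y l
      by-cases (no ¬PI) = ≈-trans (≈-trans (*-congˡ (Y-vanish l l≤ ¬PI)) (zeroʳ (𝟙 (clique? G (map proj₁ l))))) (≈-sym (≈-trans (*-congˡ (Y-vanish l l≤ ¬PI)) (zeroʳ (𝟙 (clique? H (map proj₂ l))))))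
      by-cases (yes PI) = *-congʳ (reflexive (𝟙-cong (clique? G (map proj₁ l)) (clique? H (map proj₂ l))
        (AllPairs-map proj₁ proj₂ l (λ p∈ q∈ → Equivalence.to (iff p∈ q∈)))
        (AllPairs-map proj₂ proj₁ l (λ p∈ q∈ → Equivalence.from (iff p∈ q∈)))))
        where
        iff : ∀ {p q} → p ∈ l → q ∈ l → Adj G (proj₁ p) (proj₁ q) ⇔ Adj H (proj₂ p) (proj₂ q)
        iff {p} {q} p∈ q∈ = proj₂ (PI (proj₁ p) (proj₁ q) (proj₂ p) (proj₂ q) (∈-set⁺ {l = l} p∈) (∈-set⁺ {l = l} q∈))

    Y-++-comm : ∀ l m → Y (l ++ m) ≈ Y (m ++ l)
    Y-++-comm l m = Y-cong {l ++ m} {m ++ l} (flip l m) (flip m l)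
      where
      flip : ∀ (l m : Pairs G H) → l ++ m ⊆ m ++ l
      flip l m p∈ = [ ∈-++⁺ʳ m , ∈-++⁺ˡ ]′ (∈-++⁻ l p∈)

    Y-absorb : ∀ {l m} → m ⊆ l → Y (l ++ m) ≈ Y l
    Y-absorb {l} {m} sub = Y-cong {l ++ m} {l} (λ p∈ → [ id , sub ]′ (∈-++⁻ l p∈)) ∈-++⁺ˡ

    module _ {n} (p : Fin n → V G × V H)
             (conflict : ∀ {i j l} → i ≢ j → length l ≤ 2 ℕ.* t → p i ∈ l → p j ∈ l → Y l ≈ 0#)
             (total : ∀ l → length l ≤ 2 ℕ.* t ℕ.∸ 2 → ∑ (allFin n) (λ i → Y (p i ∷ l)) ≈ Y l) where

      -- The constraint Σ y(I ∪ {p}) = y(I) is only given for |I| ≤ 2t - 2; positivity extends it to |I| ≤ 2t - 1.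
      marginal : ∀ l m → length l < t → length m ≤ t → ∑ (allFin n) (λ i → Y (p i ∷ l ++ m)) ≈ Y (l ++ m)
      marginal l m l<t m≤t = begin
        s m                          ≈⟨ ≈-sym (≈-trans (+-congˡ (-‿inverseˡ (Y (l ++ m)))) (+-identityʳ (s m))) ⟩
        s m + (- Y (l ++ m) + Y (l ++ m))  ≈⟨ ≈-sym (+-assoc (s m) (- Y (l ++ m)) (Y (l ++ m))) ⟩
        s m + - Y (l ++ m) + Y (l ++ m)  ≈⟨ +-congʳ (≈-trans (+-comm (s m) (- Y (l ++ m))) (≈-trans (≈-sym (ev-fs m)) (self-orthogonal⇒null fs bd orth m m≤t))) ⟩
        0# + Y (l ++ m)              ≈⟨ +-identityˡ (Y (l ++ m)) ⟩
        Y (l ++ m)                   ∎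
        where
        s : Pairs G H → ℝ
        s x = ∑ (allFin n) (λ i → Y (p i ∷ l ++ x))
        fs : Combination
        fs = (- 1# , l) ∷ map (λ i → 1# , p i ∷ l) (allFin n)
        l≤t : length l ≤ t
        l≤t = ℕ.<⇒≤ l<t
        bd : Bounded fs
        bd (here refl) = l≤t
        bd (there q∈) with i , _ , refl ← ∈-map⁻ (λ i → 1# , p i ∷ l) q∈ = l<t
        ev-fs : ∀ x → ev fs x ≈ - Y (l ++ x) + s x
        ev-fs x = +-cong (≈-trans (*-congʳ (*-identityʳ (fromℚ (ℚ.- 1ℚ)))) ≈-refl)
          (≈-trans (reflexive (∑-map (allFin n) (λ i → 1# , p i ∷ l) _)) (∑-cong (allFin n) (λ i → *-identityˡ (Y (p i ∷ l ++ x)))))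
        cancel : ∀ {a b c} → b ≈ a → c ≈ a → - b + c ≈ 0#
        cancel {a} b≈a c≈a = ≈-trans (+-cong (-‿cong b≈a) c≈a) (-‿inverseˡ a)
        orth : ∀ {b x} → (b , x) ∈ fs → ev fs x ≈ 0#
        orth (here refl) = ≈-trans (ev-fs l) (cancel {Y l} (Y-absorb {l} id)
          (≈-trans (∑-cong (allFin n) (λ i → Y-absorb {p i ∷ l} there)) (total l (<t⇒≤2t∸2 l<t))))
        -- Every other `p j` conflicts with `p i`, so the sum keeps the single term `Y (p i ∷ l)`
        -- without any appeal to a sum constraint.
        orth (there q∈) with i , _ , refl ← ∈-map⁻ (λ i → 1# , p i ∷ l) q∈ = ≈-trans (ev-fs (p i ∷ l)) (cancel {Y (p i ∷ l)}
          (≈-trans (Y-++-comm l (p i ∷ l)) (Y-absorb {p i ∷ l} there))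
          (≈-trans (∑-pick (λ j → Y (p j ∷ l ++ p i ∷ l)) (Unique.allFin⁺ n) (∈-allFin i) (λ {j} _ j≢i →
              conflict j≢i (++≤2t (p j ∷ l) (p i ∷ l) l<t l<t) (here refl) (there (∈-++⁺ʳ l (here refl)))))
            (Y-absorb {p i ∷ l} id)))

    -- The images of `a` are summed out one by one. The remaining pairs may number 2t - 1, which is
    -- why `marginal` is needed instead of the given constraint.
    ∑-zipʰ : ∀ a m → length a ≤ t → length m ≤ t → ∑ (tuples (order H) (length a)) (λ b → Y (zip a b ++ m)) ≈ Y m
    ∑-zipʰ []      m _   _   = +-identityʳ (Y m)
    ∑-zipʰ (g ∷ a) m a<t m≤t = begin
      ∑ (tuples (order H) (suc (length a))) (λ b → Y (zip (g ∷ a) b ++ m))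
        ≈⟨ ∑-cartesianProductWith _∷_ (allFin (order H)) ts _ ⟩
      ∑ (allFin (order H)) (λ h → ∑ ts (λ b → Y ((g , h) ∷ zip a b ++ m)))
        ≈⟨ ∑-swap (allFin (order H)) ts _ ⟩
      ∑ ts (λ b → ∑ (allFin (order H)) (λ h → Y ((g , h) ∷ zip a b ++ m)))
        ≈⟨ ∑-cong ts (λ b → marginal (g ,_)
             (λ i≢j l≤ p∈ q∈ → Y-conflict l≤ p∈ q∈ (λ e → i≢j (Equivalence.to e refl)))
             (λ l l≤ → ∑-yʰ (set l) (ℕ.≤-trans (∣set∣≤ l) l≤) g)
             (zip a b) m (ℕ.≤-<-trans (length-zip≤ˡ a b) a<t) m≤t) ⟩
      ∑ ts (λ b → Y (zip a b ++ m))
        ≈⟨ ∑-zipʰ a m (ℕ.<⇒≤ a<t) m≤t ⟩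
      Y m
        ∎
      where ts = tuples (order H) (length a)

    ∑-zipᵍ : ∀ b m → length b ≤ t → length m ≤ t → ∑ (tuples (order G) (length b)) (λ a → Y (zip a b ++ m)) ≈ Y m
    ∑-zipᵍ []      m _   _   = +-identityʳ (Y m)
    ∑-zipᵍ (h ∷ b) m b<t m≤t = begin
      ∑ (tuples (order G) (suc (length b))) (λ a → Y (zip a (h ∷ b) ++ m))
        ≈⟨ ∑-cartesianProductWith _∷_ (allFin (order G)) ts _ ⟩
      ∑ (allFin (order G)) (λ g → ∑ ts (λ a → Y ((g , h) ∷ zip a b ++ m)))
        ≈⟨ ∑-swap (allFin (order G)) ts _ ⟩
      ∑ ts (λ a → ∑ (allFin (order G)) (λ g → Y ((g , h) ∷ zip a b ++ m)))
        ≈⟨ ∑-cong ts (λ a → marginal (_, h)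
             (λ i≢j l≤ p∈ q∈ → Y-conflict l≤ p∈ q∈ (λ e → i≢j (Equivalence.from e refl)))
             (λ l l≤ → ∑-yᵍ (set l) (ℕ.≤-trans (∣set∣≤ l) l≤) h)
             (zip a b) m (ℕ.≤-<-trans (length-zip≤ʳ a b) b<t) m≤t) ⟩
      ∑ ts (λ a → Y (zip a b ++ m))
        ≈⟨ ∑-zipᵍ b m (ℕ.<⇒≤ b<t) m≤t ⟩
      Y m
        ∎
      where ts = tuples (order G) (length b)

    TG : List (List (V G))
    TG = tuples (order G) t

    TH : List (List (V H))
    TH = tuples (order H) t

    AG : List (V G) → List (V G) → ℝ
    AG u v = 𝟙 (clique? G (u ++ v))

    AH : List (V H) → List (V H) → ℝ
    AH u v = 𝟙 (clique? H (u ++ v))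

    module _ (u : List (V G)) (v : List (V H)) (u≡ : length u ≡ t) (v≡ : length v ≡ t) where
      zip≤t : length (zip u v) ≤ t
      zip≤t = subst (length (zip u v) ≤_) u≡ (length-zip≤ˡ u v)
      same-length : length u ≡ length v
      same-length = trans u≡ (sym v≡)

    transfer : ∀ a a′ b b′ → length a ≡ t → length a′ ≡ t → length b ≡ t → length b′ ≡ t →
               AG a a′ * Y (zip a b ++ zip a′ b′) ≈ AH b b′ * Y (zip a b ++ zip a′ b′)
    transfer a a′ b b′ p p′ q q′ = subst₂ (λ u v → 𝟙 (clique? G u) * Y l ≈ 𝟙 (clique? H v) * Y l)
      (trans (List.map-++ proj₁ (zip a b) (zip a′ b′)) (cong₂ _++_ (map-proj₁-zip a b (same-length a b p q)) (map-proj₁-zip a′ b′ (same-length a′ b′ p′ q′))))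
      (trans (List.map-++ proj₂ (zip a b) (zip a′ b′)) (cong₂ _++_ (map-proj₂-zip a b (same-length a b p q)) (map-proj₂-zip a′ b′ (same-length a′ b′ p′ q′))))
      (Y-clique l (++≤2t (zip a b) (zip a′ b′) (zip≤t a b p q) (zip≤t a′ b′ p′ q′)))
      where
      l : Pairs G H
      l = zip a b ++ zip a′ b′

    -- The moments intertwine the clique matrices: A_G X = X A_H holds modulo null vectors.
    intertwine : ∀ a b m → length a ≡ t → length b ≡ t → length m ≤ t →
      ∑ TG (λ a′ → AG a a′ * Y (zip a′ b ++ m)) ≈ ∑ TH (λ b′ → AH b′ b * Y (zip a b′ ++ m))
    intertwine a b m a≡ b≡ m≤t = begin
      sG m                        ≈⟨ ≈-sym (≈-trans (+-congˡ (-‿inverseˡ (sH m))) (+-identityʳ (sG m))) ⟩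
      sG m + (- sH m + sH m)      ≈⟨ ≈-sym (+-assoc (sG m) (- sH m) (sH m)) ⟩
      sG m + - sH m + sH m        ≈⟨ +-congʳ (≈-trans (≈-sym (ev-fs m)) (self-orthogonal⇒null fs bd orth m m≤t)) ⟩
      0# + sH m                   ≈⟨ +-identityˡ (sH m) ⟩
      sH m                        ∎
      where
      lenG : ∀ {u} → u ∈ TG → length u ≡ t
      lenG = length-tuples (order G) t
      lenH : ∀ {v} → v ∈ TH → length v ≡ t
      lenH = length-tuples (order H) t
      sG sH : Pairs G H → ℝ
      sG x = ∑ TG (λ a′ → AG a a′ * Y (zip a′ b ++ x))
      sH x = ∑ TH (λ b′ → AH b′ b * Y (zip a b′ ++ x))
      termG : List (V G) → ℝ × Pairs G H
      termG a′ = AG a a′ , zip a′ b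
      termH : List (V H) → ℝ × Pairs G H
      termH b′ = - AH b′ b , zip a b′
      fs : Combination
      fs = map termG TG ++ map termH TH
      ∈-fs : ∀ {c l} → (c , l) ∈ fs → (∃ λ a′ → a′ ∈ TG × l ≡ zip a′ b) ⊎ (∃ λ b′ → b′ ∈ TH × l ≡ zip a b′)
      ∈-fs q∈ with ∈-++⁻ (map termG TG) q∈
      ... | inj₁ r∈ with a′ , a′∈ , refl ← ∈-map⁻ termG r∈ = inj₁ (a′ , a′∈ , refl)
      ... | inj₂ r∈ with b′ , b′∈ , refl ← ∈-map⁻ termH r∈ = inj₂ (b′ , b′∈ , refl)
      bd : Bounded fs
      bd q∈ with ∈-fs q∈
      ... | inj₁ (a′ , a′∈ , refl) = zip≤t a′ b (lenG a′∈) b≡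
      ... | inj₂ (b′ , b′∈ , refl) = zip≤t a b′ a≡ (lenH b′∈)
      ev-fs : ∀ x → ev fs x ≈ sG x + - sH x
      ev-fs x = ≈-trans (∑-++ (map termG TG) (map termH TH) _) (+-cong (reflexive (∑-map TG termG _))
        (≈-trans (reflexive (∑-map TH termH _)) (≈-trans (∑-cong TH (λ b′ → *-assoc (fromℚ (ℚ.- 1ℚ)) (AH b′ b) (Y (zip a b′ ++ x))))
          (≈-sym (*-distribˡ-∑ TH (fromℚ (ℚ.- 1ℚ)) _)))))
      cancel : ∀ {p q r} → p ≈ r → q ≈ r → p + - q ≈ 0#
      cancel {r = r} p≈r q≈r = ≈-trans (+-cong p≈r (-‿cong q≈r)) (-‿inverseʳ r)
      orth : ∀ {c x} → (c , x) ∈ fs → ev fs x ≈ 0#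
      orth {c} {x} q∈ = ≈-trans (ev-fs x) (orth′ (∈-fs q∈))
        where
        orth′ : ∀ {x} → (∃ λ a′ → a′ ∈ TG × x ≡ zip a′ b) ⊎ (∃ λ b′ → b′ ∈ TH × x ≡ zip a b′) → sG x + - sH x ≈ 0#
        -- In the sum over G, distinct tuples paired with the same `b` conflict, so only `a″` is
        -- left. In the sum over H, `transfer` makes the coefficient constant in `b′`, after which
        -- the images of `a` are summed out.
        orth′ (inj₁ (a″ , a″∈ , refl)) = cancel {r = AG a a″ * Y (zip a″ b)}
          (≈-trans (∑-pick (λ a′ → AG a a′ * Y (zip a′ b ++ zip a″ b)) (tuples-unique (order G) t) a″∈ (λ {a′} a′∈ a′≢a″ →
              ≈-trans (*-congˡ (differ a′∈ a′≢a″)) (zeroʳ (AG a a′))))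
            (*-congˡ (Y-absorb {zip a″ b} id)))
          (begin
            sH (zip a″ b)
              ≈⟨ ∑-cong∈ TH (λ {b′} b′∈ → ≈-sym (transfer a a″ b′ b a≡ (lenG a″∈) (lenH b′∈) b≡)) ⟩
            ∑ TH (λ b′ → AG a a″ * Y (zip a b′ ++ zip a″ b))
              ≈⟨ ≈-sym (*-distribˡ-∑ TH (AG a a″) _) ⟩
            AG a a″ * ∑ TH (λ b′ → Y (zip a b′ ++ zip a″ b))
              ≈⟨ *-congˡ (≈-trans (reflexive (cong (λ m → ∑ (tuples (order H) m) (λ b′ → Y (zip a b′ ++ zip a″ b))) (sym a≡)))
                   (∑-zipʰ a (zip a″ b) (ℕ.≤-reflexive a≡) (zip≤t a″ b (lenG a″∈) b≡))) ⟩
            AG a a″ * Y (zip a″ b)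
              ∎)
          where
          differ : ∀ {a′} → a′ ∈ TG → a′ ≢ a″ → Y (zip a′ b ++ zip a″ b) ≈ 0#
          differ {a′} a′∈ a′≢a″ with x , x′ , z , p∈ , q∈ , x≢x′ ← zip-differˡ a′ a″ b (same-length a′ b (lenG a′∈) b≡) (same-length a″ b (lenG a″∈) b≡) a′≢a″ =
            Y-conflict (++≤2t (zip a′ b) (zip a″ b) (zip≤t a′ b (lenG a′∈) b≡) (zip≤t a″ b (lenG a″∈) b≡)) (∈-++⁺ˡ p∈) (∈-++⁺ʳ (zip a′ b) q∈)
              (λ e → x≢x′ (Equivalence.from e refl))
        orth′ (inj₂ (b″ , b″∈ , refl)) = cancel {r = AH b″ b * Y (zip a b″)}
          (begin
            sG (zip a b″)
              ≈⟨ ∑-cong∈ TG (λ {a′} a′∈ → ≈-trans (*-congˡ (Y-++-comm (zip a′ b) (zip a b″)))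
                   (≈-trans (transfer a a′ b″ b a≡ (lenG a′∈) (lenH b″∈) b≡) (*-congˡ (Y-++-comm (zip a b″) (zip a′ b))))) ⟩
            ∑ TG (λ a′ → AH b″ b * Y (zip a′ b ++ zip a b″))
              ≈⟨ ≈-sym (*-distribˡ-∑ TG (AH b″ b) _) ⟩
            AH b″ b * ∑ TG (λ a′ → Y (zip a′ b ++ zip a b″))
              ≈⟨ *-congˡ (≈-trans (reflexive (cong (λ m → ∑ (tuples (order G) m) (λ a′ → Y (zip a′ b ++ zip a b″))) (sym b≡)))
                   (∑-zipᵍ b (zip a b″) (ℕ.≤-reflexive b≡) (zip≤t a b″ a≡ (lenH b″∈)))) ⟩
            AH b″ b * Y (zip a b″)
              ∎)
          (≈-trans (∑-pick (λ b′ → AH b′ b * Y (zip a b′ ++ zip a b″)) (tuples-unique (order H) t) b″∈ (λ {b′} b′∈ b′≢b″ →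
              ≈-trans (*-congˡ (differ b′∈ b′≢b″)) (zeroʳ (AH b′ b))))
            (*-congˡ (Y-absorb {zip a b″} id)))
          where
          differ : ∀ {b′} → b′ ∈ TH → b′ ≢ b″ → Y (zip a b′ ++ zip a b″) ≈ 0#
          differ {b′} b′∈ b′≢b″ with x , x′ , z , p∈ , q∈ , x≢x′ ← zip-differʳ a b′ b″ (same-length a b′ a≡ (lenH b′∈)) (same-length a b″ a≡ (lenH b″∈)) b′≢b″ =
            Y-conflict (++≤2t (zip a b′) (zip a b″) (zip≤t a b′ a≡ (lenH b′∈)) (zip≤t a b″ a≡ (lenH b″∈))) (∈-++⁺ˡ p∈) (∈-++⁺ʳ (zip a b′) q∈)
              (λ e → x≢x′ (Equivalence.to e refl))

    -- Comparing the weights of triangles of the clique matrices through a fixed edge (a, a′).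
    clique⇒¬cliqueFree : ∀ a a* a′ → length a ≡ t → length a* ≡ t → length a′ ≡ t →
      Clique G (a ++ a*) → Clique G (a* ++ a′) → Clique G (a ++ a′) →
      ¬ (∀ u v w → length u ≡ t → length v ≡ t → length w ≡ t → ¬ Clique H (u ++ v ++ w))
    -- The sum counts blocks completing `a` and `a′` to a triangle of the clique matrix. Its terms
    -- are nonnegative and the one at `a*` is 1, yet `free` makes the whole sum zero.
    clique⇒¬cliqueFree a a* a′ a≡ a*≡ a′≡ ca ca* ca′ free = 1≉0 (≈-trans (≈-sym one) (∑≋0⇒≋0 TG (λ a″ → AG a a″ * (AG a″ a′ * 1#))
      (λ a″ → 0≤ʳ-𝟙 (clique? G (a ++ a″)) (clique? G (a″ ++ a′))) sum≈0 (subst (λ m → a* ∈ tuples (order G) m) a*≡ (∈-tuples a*))))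
      where
      lenG : ∀ {u} → u ∈ TG → length u ≡ t
      lenG = length-tuples (order G) t
      lenH : ∀ {v} → v ∈ TH → length v ≡ t
      lenH = length-tuples (order H) t
      one : AG a a* * (AG a* a′ * 1#) ≈ 1#
      one = ≈-trans (*-cong (reflexive (𝟙-yes (clique? G (a ++ a*)) ca)) (≈-trans (*-congʳ (reflexive (𝟙-yes (clique? G (a* ++ a′)) ca*))) (*-identityˡ 1#))) (*-identityˡ 1#)
      total : ∀ u → length u ≡ t → ∑ TH (λ b → ∑ TH (λ b′ → Y (zip u b ++ zip a′ b′))) ≈ 1#
      total u u≡ = begin
        ∑ TH (λ b → ∑ TH (λ b′ → Y (zip u b ++ zip a′ b′)))
          ≈⟨ ∑-swap TH TH _ ⟩
        ∑ TH (λ b′ → ∑ TH (λ b → Y (zip u b ++ zip a′ b′)))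
          ≈⟨ ∑-cong∈ TH (λ {b′} b′∈ → ≈-trans (reflexive (cong (λ m → ∑ (tuples (order H) m) (λ b → Y (zip u b ++ zip a′ b′))) (sym u≡)))
               (∑-zipʰ u (zip a′ b′) (ℕ.≤-reflexive u≡) (zip≤t a′ b′ a′≡ (lenH b′∈)))) ⟩
        ∑ TH (λ b′ → Y (zip a′ b′))
          ≈⟨ ≈-trans (reflexive (cong (λ m → ∑ (tuples (order H) m) (λ b′ → Y (zip a′ b′))) (sym a′≡)))
               (≈-trans (∑-cong (tuples (order H) (length a′)) (λ b′ → reflexive (cong Y (sym (List.++-identityʳ (zip a′ b′))))))
                 (∑-zipʰ a′ [] (ℕ.≤-reflexive a′≡) z≤n)) ⟩
        Y []
          ≈⟨ wrap empty ⟩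
        1#
          ∎
      no-triangle : ∀ {b b′ b″} → b ∈ TH → b′ ∈ TH → b″ ∈ TH → AH b b′ * (AH b″ b * Y (zip a b″ ++ zip a′ b′)) ≈ 0#
      no-triangle {b} {b′} {b″} b∈ b′∈ b″∈ = ≈-trans (*-congˡ (*-congˡ Y≈)) (by-cases (clique? H (b ++ b′)) (clique? H (b″ ++ b)) (clique? H (b″ ++ b′)))
        where
        Yx : ℝ
        Yx = Y (zip a b″ ++ zip a′ b′)
        -- The clique on `a` and `a′` has indicator 1 in G; transferred to H it supplies the third
        -- side of the triangle.
        Y≈ : Yx ≈ AH b″ b′ * Yx
        Y≈ = ≈-trans (≈-sym (≈-trans (*-congʳ (reflexive (𝟙-yes (clique? G (a ++ a′)) ca′))) (*-identityˡ Yx))) (transfer a a′ b″ b′ a≡ a′≡ (lenH b″∈) (lenH b′∈))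
        by-cases : (d : Dec (Clique H (b ++ b′))) (e : Dec (Clique H (b″ ++ b))) (f : Dec (Clique H (b″ ++ b′))) →
                   𝟙 d * (𝟙 e * (𝟙 f * Yx)) ≈ 0#
        by-cases (yes p) (yes q) (yes r) = ⊥-elim (free b″ b b′ (lenH b″∈) (lenH b∈) (lenH b′∈) (AllPairs-glue b″ b q p r))
        by-cases (no _)  e       f       = zeroˡ (𝟙 e * (𝟙 f * Yx))
        by-cases (yes _) (no _)  f       = ≈-trans (*-congˡ (zeroˡ (𝟙 f * Yx))) (zeroʳ 1#)
        by-cases (yes _) (yes _) (no _)  = ≈-trans (*-congˡ (≈-trans (*-congˡ (zeroˡ Yx)) (zeroʳ 1#))) (zeroʳ 1#)
      sum≈0 : ∑ TG (λ a″ → AG a a″ * (AG a″ a′ * 1#)) ≈ 0#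
      sum≈0 = begin
        ∑ TG (λ a″ → AG a a″ * (AG a″ a′ * 1#))
          ≈⟨ ∑-cong∈ TG (λ {a″} a″∈ → *-congˡ (begin
               AG a″ a′ * 1#
                 -- The factor 1 is expanded into the total weight of all images of `a″` and `a′`,
                 -- which lets the clique test move to H.
                 ≈⟨ *-congˡ (≈-sym (total a″ (lenG a″∈))) ⟩
               AG a″ a′ * ∑ TH (λ b → ∑ TH (λ b′ → Y (zip a″ b ++ zip a′ b′)))
                 ≈⟨ ≈-trans (*-distribˡ-∑ TH (AG a″ a′) _) (∑-cong TH (λ b → *-distribˡ-∑ TH (AG a″ a′) _)) ⟩
               ∑ TH (λ b → ∑ TH (λ b′ → AG a″ a′ * Y (zip a″ b ++ zip a′ b′)))
                 ≈⟨ ∑-cong∈ TH (λ {b} b∈ → ∑-cong∈ TH (λ {b′} b′∈ → transfer a″ a′ b b′ (lenG a″∈) a′≡ (lenH b∈) (lenH b′∈))) ⟩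
               ∑ TH (λ b → ∑ TH (λ b′ → AH b b′ * Y (zip a″ b ++ zip a′ b′)))
                 ∎)) ⟩
        ∑ TG (λ a″ → AG a a″ * ∑ TH (λ b → ∑ TH (λ b′ → AH b b′ * Y (zip a″ b ++ zip a′ b′))))
          ≈⟨ ≈-trans (∑-cong TG (λ a″ → ≈-trans (*-distribˡ-∑ TH (AG a a″) _) (∑-cong TH (λ b → *-distribˡ-∑ TH (AG a a″) _))))
               (≈-trans (∑-swap TG TH _) (∑-cong TH (λ b → ∑-swap TG TH _))) ⟩
        ∑ TH (λ b → ∑ TH (λ b′ → ∑ TG (λ a″ → AG a a″ * (AH b b′ * Y (zip a″ b ++ zip a′ b′)))))
          -- `intertwine` trades the block `a″` of G for a block `b″` of H paired with `a`; each
          -- term now tests all three sides of a triangle in H.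
          ≈⟨ ∑-cong∈ TH (λ {b} b∈ → ∑-cong∈ TH (λ {b′} b′∈ → ≈-trans
               (∑-cong TG (λ a″ → pull (AG a a″) (AH b b′) (Y (zip a″ b ++ zip a′ b′))))
               (≈-trans (≈-sym (*-distribˡ-∑ TG (AH b b′) _))
               (≈-trans (*-congˡ (intertwine a b (zip a′ b′) a≡ (lenH b∈) (zip≤t a′ b′ a′≡ (lenH b′∈))))
               (≈-trans (*-distribˡ-∑ TH (AH b b′) _) (∑-zero TH (λ b″∈ → no-triangle b∈ b′∈ b″∈))))))) ⟩
        ∑ TH (λ b → ∑ TH (λ b′ → 0#))
          ≈⟨ ∑-zero TH (λ _ → ∑-zero TH (λ _ → ≈-refl)) ⟩
        0#
          ∎
        where
        pull : ∀ p q r → p * (q * r) ≈ q * (p * r)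
        pull p q r = ≈-trans (≈-sym (*-assoc p q r)) (≈-trans (*-congʳ (*-comm p q)) (*-assoc q p r))

  -- The separating pair of graphs

  module _ {t} (1≤t : 1 ≤ t) where

    private
      n : ℕ
      n = 3 ℕ.* t

      1<n : 1 < n
      1<n = ℕ.≤-trans (s≤s (s≤s (z≤n {1}))) (ℕ.*-monoʳ-≤ 3 1≤t)

      root : Fin n
      root = fromℕ< (ℕ.<-trans ℕ.z<s 1<n)

      χ : Fin n → _
      -- A single charged base vertex makes the total charge odd, in the form that `parity-single`
      -- expects.
      χ j = if does (j Fin.≟ root) then true else false

    open CFI n

    separated : ¬ (cfi even ≃ᴸ[ t ] cfi χ)
    separated (y , sol) = Separation.clique⇒¬cliqueFree 1≤t sol a a* a′ len-a len-a* len-a′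
      (AllPairs.++⁺ (proj₁ first) (proj₁ second) (All.map (All.++⁻ˡ a*) (proj₂ (proj₂ first))))
      (proj₁ (proj₂ first))
      (AllPairs.++⁺ (proj₁ first) (proj₁ (proj₂ second)) (All.map (All.++⁻ʳ a*) (proj₂ (proj₂ first))))
      -- Three blocks of t vertices are exactly as many as the base graph has, so a clique on them
      -- would give the family excluded by `no-clique`.
      (λ u v w u≡ v≡ w≡ cl → no-clique χ 1<n (parity-single root true)
        (λ i → lookup (u ++ v ++ w) (cast (sym (len u v w u≡ v≡ w≡)) i))
        (λ i j i≢j → AllPairs-lookup (SimpleGraph.symmetric (cfi χ)) cl _ _ (i≢j ∘ cast-injective (sym (len u v w u≡ v≡ w≡)))))
      where
      a a* a′ : List Vertex
      a  = take t clique
      a* = take t (drop t clique)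
      a′ = drop t (drop t clique)
      n≡ : length clique ≡ t ℕ.+ (t ℕ.+ t)
      n≡ = trans (List.length-map _ (allFin n)) (trans (List.length-tabulate {n = n} id) (cong (λ m → t ℕ.+ (t ℕ.+ m)) (ℕ.+-identityʳ t)))
      len-drop : length (drop t clique) ≡ t ℕ.+ t
      len-drop = trans (List.length-drop t clique) (trans (cong (ℕ._∸ t) n≡) (ℕ.m+n∸m≡n t (t ℕ.+ t)))
      len-a : length a ≡ t
      len-a = trans (List.length-take t clique) (ℕ.m≤n⇒m⊓n≡m (subst (t ≤_) (sym n≡) (ℕ.m≤m+n t _)))
      len-a* : length a* ≡ t
      len-a* = trans (List.length-take t (drop t clique)) (ℕ.m≤n⇒m⊓n≡m (subst (t ≤_) (sym len-drop) (ℕ.m≤m+n t t)))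
      len-a′ : length a′ ≡ t
      len-a′ = trans (List.length-drop t (drop t clique)) (trans (cong (ℕ._∸ t) len-drop) (ℕ.m+n∸m≡n t t))
      whole : AllPairs (Adjacent even) (a ++ a* ++ a′)
      whole = subst (AllPairs (Adjacent even)) (sym (trans (cong (a ++_) (List.take++drop≡id t (drop t clique))) (List.take++drop≡id t clique))) clique-adjacent
      first = AllPairs-++⁻ a whole
      second = AllPairs-++⁻ a* (proj₁ (proj₂ first))
      len : ∀ (u v w : List Vertex) → length u ≡ t → length v ≡ t → length w ≡ t → length (u ++ v ++ w) ≡ n
      len u v w u≡ v≡ w≡ = trans (length-++-≡ u (v ++ w) u≡ (length-++-≡ v w v≡ w≡)) (cong (λ m → t ℕ.+ (t ℕ.+ m)) (sym (ℕ.+-identityʳ t)))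
      cast-injective : ∀ {m n} (eq : m ≡ n) {i j : Fin m} → cast eq i ≡ cast eq j → i ≡ j
      cast-injective refl {i} {j} p = trans (sym (Fin.cast-is-id refl i)) (trans p (Fin.cast-is-id refl j))

    separatingGraphs : ∃₂ λ (G H : SimpleGraph) → (G ≃ˢᴬ[ 3 ℕ.* t ℕ.∸ 1 ] H) × ¬ (G ≃ᴸ[ t ] H)
    separatingGraphs = cfi even , cfi χ , (_ , Uniform.isSheraliAdams (cfi-backAndForth χ) (ℕ.∸-monoˡ-≤ 1 1<n)) , separated

open import Data.Nat using (_*_; _∸_)

theorem1p1 : (∀ (G H : SimpleGraph) (t : ℕ) → 1 ≤ t →
    (G ≃ˢᴬ[ 3 * t ] H → G ≃ᴸ[ t ] H) × (G ≃ᴸ[ t ] H → G ≃ˢᴬ[ t ] H))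
    × (∀ (t : ℕ) → 1 ≤ t →
    ∃₂ λ (G H : SimpleGraph) → (G ≃ˢᴬ[ 3 * t ∸ 1 ] H) × ¬ (G ≃ᴸ[ t ] H))
theorem1p1 = (λ G H t 1≤t →
    (λ (_ , sol) → _ , isLasserre 1≤t (real⇒backAndForth G H (3 * t) (sheraliAdams⇒real (ℕ.≤-trans 1≤t (ℕ.m≤m+n t _)) sol))) ,
    (λ (_ , sol) → _ , Uniform.isSheraliAdams (real⇒backAndForth G H t (LasserreSolution.lasserre⇒real 1≤t sol)) 1≤t)) ,
  λ t 1≤t → separatingGraphs 1≤t
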